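{- Let $S$ be a finite ordered tree and let $A=\{x\in S\colon x\text{ is not the root of }S\text{ and }x\text{ has at most one immediate successor in }S\}$. Then for every finite ordered tree $T$ and every integer $r>0$ there is a finite ordered tree $V$ such that for every coloring $\chi\colon\mathrm{Hom}_{Conn_T}(S,V)\to r$ there is $(t,j)\in\mathrm{Hom}_{Conn_T}(T,V)$ such that for every connection $(s,i)\in\mathrm{Hom}_{Conn_T}(S,T)$, the color $\chi((t,j)\circ(s,i))$ depends only on the set $B=\{x\in A\colon i_s(x)\neq i(x)\}$. In particular, $rd(S)\leq|\mathcal{P}(A)|$ in $Conn_T$.
   Context: All trees are finite. A tree is a partial order $(T,\sqsubseteq_T)$ with a least element (the root) such that the predecessors of every element are linearly ordered; $v\wedge_T w$ is the largest common predecessor. A tree is ordered if each set of immediate successors carries a linear order; this induces a linear order $\leq_T$ on $T$: $v\leq_T w$ iff $v\sqsubseteq_T w$, or $w\not\sqsubseteq_T v$ and the immediate successor of $v\wedge w$ below $v$ precedes the one below $w$. An embedding $i\colon S\to T$ sends root to root, satisfies $x<_S y\Rightarrow i(x)<_T i(y)$, and $i(x\wedge y)=i(x)\wedge i(y)$. A map $s\colon T\to S$ is a rigid surjection if there is an embedding $i\colon S\to T$ with $s(i(x))=x$ and $i(s(y))\sqsubseteq_T y$ for all $x,y$; then $i=i_s$, $i_s(x)=\bigwedge s^{ -1}(x)$. A connection $(s,i)\colon T\leftrightarrows S$ is a pair with $s\colon T\to S$ a rigid surjection, $i\colon S\to T$ an embedding, and for all $x\in S$: $s(i(x))=x$ and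 $s(y)\leq_S x$ for all $y<_T i(x)$. $Conn_T$ is the category whose objects are finite ordered trees, with $\mathrm{Hom}_{Conn_T}(S,T)$ the set of connections $(s,i)\colon T\leftrightarrows S$, and composition $(t,j)\circ(s,i)=(s\circ t, j\circ i)$. A coloring $\chi\colon X\to r$ is a map to $\{0,\dots,r-1\}$. For objects $A,B$, $rd(A,B)$ is the least $k$ such that for every $r>0$ there is an object $C$ such that for every $r$-coloring of $\mathrm{Hom}(A,C)$ there is $f\in\mathrm{Hom}(B,C)$ with at most $k$ colors on $f\circ\mathrm{Hom}(A,B)$; $rd(A)=\sup_B rd(A,B)$. -}

module Defs where

open import Data.Nat using (ℕ; zero; suc; _≤_; _<_; _^_)
open import Data.Nat.Properties using (_≟_; _≤?_)
open import Data.Fin using (Fin; toℕ) renaming (zero to fzero; suc to fsuc)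
import Data.Fin.Properties as FinP
open import Data.List using (List; length; filter)
open import Data.List.Base using ()
open import Data.Fin.Base using ()
open import Data.List using (List)
open import Data.Vec.Functional using ()
open import Data.Product using (Σ; ∃; _×_; _,_)
open import Data.Sum using (_⊎_)
open import Relation.Binary.PropositionalEquality using (_≡_; _≢_)
open import Relation.Nullary using (¬_; Dec)
open import Relation.Nullary.Decidable using (_×-dec_; ¬?)
import Data.List as L
open import Data.List.Membership.Propositional using (_∈_)

-- Finite ordered trees.
-- A finite ordered tree with nodes Fin (suc size): node 0 is the root,
-- node (suc k) has parent (par k), whose index is smaller than suc k.
-- The immediate successors of a node are linearly ordered by their
-- index.  Every finite ordered tree is isomorphic to such a tree
-- (number the nodes in depth-first order).

record Tree : Set where
  field
    size : ℕ
    par  : Fin size → Fin (suc size)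
    par< : ∀ k → toℕ (par k) ≤ toℕ k

open Tree public

Node : Tree → Set
Node T = Fin (suc (size T))

root : (T : Tree) → Node T
root T = fzero

parent : (T : Tree) → Node T → Node T
parent T fzero    = fzero
parent T (fsuc k) = par T k

iter : {A : Set} → (A → A) → ℕ → A → A
iter f zero    a = a
iter f (suc m) a = f (iter f m a)

_∋_⊑_ : (T : Tree) → Node T → Node T → Set
T ∋ v ⊑ w = ∃ λ m → iter (parent T) m w ≡ v

ImmSucc : (T : Tree) → Node T → Node T → Set
ImmSucc T v w = ∃ λ k → (w ≡ fsuc k) × (par T k ≡ v)

IsMeet : (T : Tree) → Node T → Node T → Node T → Set
IsMeet T v w z =
  (T ∋ z ⊑ v) × (T ∋ z ⊑ w) ×
  (∀ u → T ∋ u ⊑ v → T ∋ u ⊑ w → T ∋ u ⊑ z)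

IsMeetOf : (T : Tree) → (Node T → Set) → Node T → Set
IsMeetOf T P z =
  (∀ y → P y → T ∋ z ⊑ y) ×
  (∀ u → (∀ y → P y → T ∋ u ⊑ y) → T ∋ u ⊑ z)

_∋_≤T_ : (T : Tree) → Node T → Node T → Set
T ∋ v ≤T w =
  (T ∋ v ⊑ w) ⊎
  ((¬ (T ∋ w ⊑ v)) ×
    (∃ λ z → IsMeet T v w z ×
      (∃ λ cv → ∃ λ cw →
        ImmSucc T z cv × ImmSucc T z cw ×
        (T ∋ cv ⊑ v) × (T ∋ cw ⊑ w) × (toℕ cv < toℕ cw))))

_∋_<T_ : (T : Tree) → Node T → Node T → Set
T ∋ v <T w = (T ∋ v ≤T w) × (v ≢ w)

IsEmbedding : (S T : Tree) → (Node S → Node T) → Set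
IsEmbedding S T i =
  (i (root S) ≡ root T) ×
  (∀ x y → S ∋ x <T y → T ∋ i x <T i y) ×
  (∀ x y z → IsMeet S x y z → IsMeet T (i x) (i y) (i z))

IsRigidSurj : (T S : Tree) → (Node T → Node S) → Set
IsRigidSurj T S s =
  ∃ λ (i : Node S → Node T) → IsEmbedding S T i ×
    (∀ x → s (i x) ≡ x) × (∀ y → T ∋ i (s y) ⊑ y)

IsConnection : (T S : Tree) → (Node T → Node S) → (Node S → Node T) → Set
IsConnection T S s i =
  IsRigidSurj T S s × IsEmbedding S T i ×
  (∀ x → s (i x) ≡ x) ×
  (∀ x y → T ∋ y <T i x → S ∋ s y ≤T x)

record Hom (S T : Tree) : Set where
  constructor conn
  field
    sm   : Node T → Node S
    im   : Node S → Node T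
    isConn : IsConnection T S sm im

open Hom public

_≈H_ : {S T : Tree} → Hom S T → Hom S T → Set
_≈H_ {S} {T} f g = (∀ y → sm f y ≡ sm g y) × (∀ x → im f x ≡ im g x)

IsComp : {S T V : Tree} → Hom T V → Hom S T → Hom S V → Set
IsComp tj si d =
  (∀ y → sm d y ≡ sm si (sm tj y)) × (∀ x → im d x ≡ im tj (im si x))

-- an r-coloring of Hom(S , V) (a function on the set of connections,
-- i.e. respecting equality of connections)
RespectsH : {S V : Tree} {r : ℕ} → (Hom S V → Fin r) → Set
RespectsH {S} {V} χ = ∀ f g → f ≈H g → χ f ≡ χ g

childCount : (S : Tree) → Node S → ℕ
childCount S x = length (filter (λ k → par S k FinP.≟ x) (L.allFin (size S)))

IsA : (S : Tree) → Node S → Set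
IsA S x = (x ≢ root S) × (childCount S x ≤ 1)

isA? : (S : Tree) → (x : Node S) → Dec (IsA S x)
isA? S x = ¬? (x FinP.≟ root S) ×-dec (childCount S x ≤? 1)

cardA : Tree → ℕ
cardA S = length (filter (isA? S) (L.allFin (suc (size S))))

-- x ∈ B for (s , i) : i_s(x) ≠ i(x), where i_s(x) = ⋀ s⁻¹(x)
InB : {S T : Tree} → Hom S T → Node S → Set
InB {S} {T} si x = ¬ IsMeetOf T (λ y → sm si y ≡ x) (im si x)

SameB : {S T : Tree} → Hom S T → Hom S T → Set
SameB {S} si si' =
  ∀ x → IsA S x → (InB si x → InB si' x) × (InB si' x → InB si x)

{-# OPTIONS --safe #-}
-- A connection (s , i) from T to S with B = {x : i_s(x) ≠ i(x)} amounts to a rigid surjection from T onto the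
-- tree obtained from S by replacing each x in B by a chain x, x′ of two nodes: i_s(x) and i(x) are the least
-- nodes sent to x and to x′. This needs that i_s(x) = i(x) whenever x has two immediate successors. Hence it
-- suffices to apply, once for each B, a Ramsey theorem for rigid surjections onto a given tree. That theorem
-- holds by induction on the target, a forest whose nodes sit above a chain of further nodes, the letters. For
-- the empty forest it is a Hales–Jewett theorem for trees labelled by letters. Otherwise consider the node y
-- hit by the first root of the target: product arguments and the induction hypothesis make the colour depend
-- only on y and the labels on the way to y, the Hales–Jewett theorem removes the dependence on the labels,
-- and the pigeonhole principle for the nodes of trees removes the dependence on y.
module Submission where

open import Defs
open import Data.Nat using (ℕ; zero; suc; _+_; _*_; _<_; _≤_; _^_; z≤n; s≤s)
open import Data.Nat.Properties using (n<1+n; <-irrefl; <⇒≱; ≤-pred; ≤-trans; ≤-refl; ≤-reflexive; <⇒≤; +-suc; 0≢1+n; <-cmp; +-identityʳ)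
  renaming (suc-injective to suc-injectiveℕ)
open import Data.Fin using (Fin; zero; suc; toℕ; fromℕ; fromℕ<; inject₁; punchOut; combine; remQuot; join; splitAt; funToFin; finToFun)
open import Data.Fin.Relation.Unary.Top using (‵fromℕ; ‵inject₁) renaming (view to topView)
open import Data.Fin.Properties using (any?; suc-injective; toℕ-injective; toℕ-inject₁; toℕ-fromℕ; toℕ-fromℕ<; toℕ<n; inject₁-injective; punchOut-injective; pigeonhole; remQuot-combine; splitAt-join; finToFun-funToFin)
  renaming (_≟_ to _≟F_)
open import Data.List using (List; length; []; _∷_)
open import Data.List.Membership.Propositional using (_∈_)
open import Data.Vec using (Vec; []; _∷_; lookup; map; _++_; allFin; replicate)
open import Data.Vec.Properties using (map-∘; map-cong; map-id; map-++; lookup-map; lookup∘tabulate; tabulate-∘; lookup-allFin; map-lookup-allFin)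
open import Data.Vec.Relation.Unary.Any using (Any; here; there)
import Data.Vec.Relation.Unary.Any.Properties as AnyP
open import Data.Product using (Σ; ∃; _×_; _,_; proj₁; proj₂)
open import Data.Sum using (_⊎_; inj₁; inj₂)
import Data.Sum as Sum
open import Data.Sum.Properties using (inj₁-injective; inj₂-injective)
open import Data.Empty using (⊥; ⊥-elim)
open import Data.Unit using (⊤; tt)
open import Data.Bool using (Bool; true; false)
open import Data.Maybe using (Maybe; just; nothing; maybe)
import Data.Maybe as Maybe
open import Data.Maybe.Properties using (just-injective)
open import Function using (_∘_; id)
open import Relation.Nullary using (¬_; Dec; yes; no)
import Relation.Nullary.Decidable as Dec
open import Relation.Binary.PropositionalEquality using (_≡_; _≢_; refl; sym; trans; cong; cong₂; subst; subst₂; module ≡-Reasoning)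
open import Relation.Binary.Definitions using (tri<; tri≈; tri>)
import Data.List as List
open import Data.List.Properties using (length-map; length-++)
open import Data.List.Relation.Unary.Any using (here; there)
open import Data.List.Relation.Unary.All using (All; []; _∷_)
open import Data.List.Relation.Unary.AllPairs using ([]; _∷_)
open import Data.List.Relation.Unary.All.Properties using (all-filter)
import Data.List.Relation.Unary.Unique.Propositional.Properties as Unique
open import Data.List.Membership.Propositional.Properties using (∈-filter⁺; ∈-filter⁻; ∈-map⁺; ∈-++⁺ˡ; ∈-++⁺ʳ; ∈-allFin)
import Data.List.Membership.DecPropositional as DecMembership
open import Relation.Nullary.Decidable using (⌊_⌋)

-- Letters are needed because of what lies above the node hit by the first root: nodes there may
-- still be sent to that root or to anything below it. So the recursion passes to the forest above
-- the first root of the target and adds one letter. Preservation of meets shapes the other cases: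
-- two roots of the target have no meet, so at most one tree of the target can occur above a node
-- sent to a letter. The same fact is the obstacle to removing the labels on the way to a node. The
-- trees above a node must part at the image of that node, so no single branch can serve all of
-- them; the Hales-Jewett alphabet therefore consists of pairs of a label and a direction, and one
-- substitution decides both which label a branch reads and where it turns. Trees themselves are the
-- case of no letters: the root must be hit, and everything above it has one letter, so a positive
-- number of letters suffices in the Ramsey statements. The morphism found for T has as its
-- embedding the least section of its surjection, so composing with it is composing rigid
-- surjections, for every doubled tree at once.

record Finite (X : Set) : Set where
  field
    card : ℕ
    enc : X → Fin card
    dec : Fin card → X
    dec-enc : ∀ x → dec (enc x) ≡ x

  enc-injective : ∀ {x y} → enc x ≡ enc y → x ≡ y
  enc-injective {x} {y} e = trans (sym (dec-enc x)) (trans (cong dec e) (dec-enc y))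

  _≟_ : (x y : X) → Dec (x ≡ y)
  x ≟ y with enc x ≟F enc y
  ... | yes e = yes (enc-injective e)
  ... | no ne = no (ne ∘ cong enc)

  search : {P : X → Set} → (∀ x → Dec (P x)) → Dec (∃ P)
  search {P} P? with any? (P? ∘ dec)
  ... | yes (i , p) = yes (dec i , p)
  ... | no np = no λ { (x , p) → np (enc x , subst P (sym (dec-enc x)) p) }

  funs : ℕ → ℕ
  funs r = r ^ card

  -- Turns a whole colouring of `X` into one colour out of `funs r`, so that uniformity over all of
  -- `X` costs only an increase in the number of colours.
  code : ∀ {r} → (X → Fin r) → Fin (funs r)
  code χ = funToFin (χ ∘ dec)

  code-injective : ∀ {r} (χ χ′ : X → Fin r) → code χ ≡ code χ′ → ∀ x → χ x ≡ χ′ x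
  code-injective χ χ′ e x = begin
    χ x                              ≡⟨ cong χ (dec-enc x) ⟨
    χ (dec (enc x))                  ≡⟨ finToFun-funToFin (χ ∘ dec) (enc x) ⟨
    finToFun (code χ) (enc x)        ≡⟨ cong (λ c → finToFun c (enc x)) e ⟩
    finToFun (code χ′) (enc x)       ≡⟨ finToFun-funToFin (χ′ ∘ dec) (enc x) ⟩
    χ′ (dec (enc x))                 ≡⟨ cong χ′ (dec-enc x) ⟩
    χ′ x                             ∎
    where open ≡-Reasoning

open Finite using (funs; code; code-injective)

finite-retract : {X Y : Set} → Finite Y → (f : X → Y) (g : Y → X) → (∀ x → g (f x) ≡ x) → Finite X
finite-retract Y f g gf = record
  { card = card ; enc = enc ∘ f ; dec = g ∘ dec ; dec-enc = λ x → trans (cong g (dec-enc (f x))) (gf x) }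
  where open Finite Y

finite-Fin : ∀ n → Finite (Fin n)
finite-Fin n = record { card = n ; enc = id ; dec = id ; dec-enc = λ _ → refl }

finite-⊤ : Finite ⊤
finite-⊤ = finite-retract (finite-Fin 1) (λ _ → zero) (λ _ → tt) λ _ → refl

finite-⊥ : Finite ⊥
finite-⊥ = finite-retract (finite-Fin 0) (λ ()) (λ ()) λ ()

finite-× : {X Y : Set} → Finite X → Finite Y → Finite (X × Y)
finite-× X Y = record
  { card = X.card * Y.card
  ; enc = λ (x , y) → combine (X.enc x) (Y.enc y)
  ; dec = λ i → let (a , b) = remQuot Y.card i in X.dec a , Y.dec b
  ; dec-enc = λ (x , y) → trans (cong (λ (a , b) → X.dec a , Y.dec b) (remQuot-combine (X.enc x) (Y.enc y)))
                                (cong₂ _,_ (X.dec-enc x) (Y.dec-enc y))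
  }
  where
  module X = Finite X
  module Y = Finite Y

finite-⊎ : {X Y : Set} → Finite X → Finite Y → Finite (X ⊎ Y)
finite-⊎ {X′} {Y′} X Y = record
  { card = X.card + Y.card
  ; enc = λ z → join X.card Y.card (e z)
  ; dec = λ i → d (splitAt X.card i)
  ; dec-enc = λ z → trans (cong d (splitAt-join X.card Y.card (e z))) (de z)
  }
  where
  module X = Finite X
  module Y = Finite Y
  e : X′ ⊎ Y′ → Fin X.card ⊎ Fin Y.card
  e (inj₁ x) = inj₁ (X.enc x)
  e (inj₂ y) = inj₂ (Y.enc y)
  d : Fin X.card ⊎ Fin Y.card → X′ ⊎ Y′
  d (inj₁ x) = inj₁ (X.dec x)
  d (inj₂ y) = inj₂ (Y.dec y)
  de : ∀ z → d (e z) ≡ z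
  de (inj₁ x) = cong inj₁ (X.dec-enc x)
  de (inj₂ y) = cong inj₂ (Y.dec-enc y)

finite-Vec : {X : Set} → Finite X → ∀ N → Finite (Vec X N)
finite-Vec X zero = finite-retract finite-⊤ (λ _ → tt) (λ _ → []) λ { [] → refl }
finite-Vec X (suc N) = finite-retract (finite-× X (finite-Vec X N))
  (λ { (x ∷ xs) → x , xs }) (λ (x , xs) → x ∷ xs) λ { (x ∷ xs) → refl }

-- The Hales–Jewett theorem, by colour focusing

Subst : ℕ → ℕ → Set
Subst n m = Vec (Fin m) n

idS : ∀ {n} → Subst n n
idS = allFin _

_⟨_⟩ : ∀ {m n} → Subst n m → ∀ {N} → Vec (Fin n) N → Vec (Fin m) N
σ ⟨ w ⟩ = map (lookup σ) w

-- A variable word over Fin k is a word over Fin (suc k) containing zero, the variable.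
HasVar : ∀ {k N} → Vec (Fin (suc k)) N → Set
HasVar = Any (zero ≡_)

inst : ∀ {k N} → Vec (Fin (suc k)) N → Fin k → Vec (Fin k) N
inst w a = (a ∷ idS) ⟨ w ⟩

inst-suc : ∀ {k N} (w : Vec (Fin k) N) a → inst (map suc w) a ≡ w
inst-suc w a = begin
  map (lookup (a ∷ idS)) (map suc w) ≡⟨ map-∘ _ _ w ⟨
  map (lookup idS) w                 ≡⟨ map-cong lookup-allFin w ⟩
  map id w                           ≡⟨ map-id w ⟩
  w                                  ∎
  where open ≡-Reasoning

inst-++ : ∀ {k N M} (u : Vec (Fin (suc k)) N) (v : Vec (Fin (suc k)) M) a → inst (u ++ v) a ≡ inst u a ++ inst v a
inst-++ u v a = map-++ _ u v

Mono : ∀ {k N r} → (Vec (Fin k) N → Fin r) → Set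
Mono {k} {N} χ = Σ (Vec (Fin (suc k)) N) λ w → HasVar w × (∀ a b → χ (inst w a) ≡ χ (inst w b))

HJ : ℕ → Set
HJ k = ∀ r → Σ ℕ λ N → (χ : Vec (Fin k) N → Fin r) → Mono χ

-- All lines meet where the variable is the letter `zero`; at the other letters each is
-- monochromatic, in a colour of its own.
record Focused {k N r} (χ : Vec (Fin (suc k)) N → Fin r) (j : ℕ) : Set where
  field
    focus : Vec (Fin (suc k)) N
    line : Fin j → Vec (Fin (suc (suc k))) N
    hasVar : ∀ i → HasVar (line i)
    atFocus : ∀ i → inst (line i) zero ≡ focus
    colour : Fin j → Fin r
    coloured : ∀ i a → χ (inst (line i) (suc a)) ≡ colour i
    distinct : ∀ i i′ → colour i ≡ colour i′ → i ≡ i′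

module _ {k : ℕ} (hj : HJ (suc k)) (r : ℕ) where
  private K = suc k

  -- The smaller alphabet occupies the nonzero letters, so the letter `zero` can enter the extended
  -- line only through its variable.
  ext : ∀ {N} → Vec (Fin (suc K)) N → Vec (Fin (suc (suc K))) N
  ext = map λ { zero → zero ; (suc a) → suc (suc a) }

  ext-hasVar : ∀ {N} {w : Vec (Fin (suc K)) N} → HasVar w → HasVar (ext w)
  ext-hasVar (here refl) = here refl
  ext-hasVar (there p) = there (ext-hasVar p)

  inst-ext : ∀ {N} (w : Vec (Fin (suc K)) N) a → inst (ext w) (suc a) ≡ map suc (inst w a)
  inst-ext w a = begin
    inst (ext w) (suc a)                           ≡⟨ map-∘ _ _ w ⟨
    map _ w                                        ≡⟨ map-cong (λ { zero → refl ; (suc b) → trans (lookup∘tabulate id (suc b)) (cong suc (sym (lookup-allFin b))) }) w ⟩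
    map (suc ∘ lookup (a ∷ idS)) w                 ≡⟨ map-∘ suc _ w ⟩
    map suc (inst w a)                             ∎
    where open ≡-Reasoning

  -- One more line is gained from a front block in which the smaller alphabet has a line `L` along
  -- which the induced colouring of the back block is constant. Moving along `L` through nonzero
  -- letters then changes no colour, whatever stands behind.
  focusing : ∀ j → Σ ℕ λ N → (χ : Vec (Fin (suc K)) N → Fin r) → Mono χ ⊎ Focused χ j
  focusing zero = 0 , λ χ → inj₂ record
    { focus = [] ; line = λ () ; hasVar = λ () ; atFocus = λ () ; colour = λ () ; coloured = λ () ; distinct = λ () }
  focusing (suc j) = N′ + N , step
    where
    N = proj₁ (focusing j)
    words = finite-Vec (finite-Fin (suc K)) N
    -- The front block is coloured by colourings of the back block, so its length is chosen after
    -- that of the back block.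
    N′ = proj₁ (hj (funs words r))
    step : (χ : Vec (Fin (suc K)) (N′ + N) → Fin r) → Mono χ ⊎ Focused χ (suc j)
    step χ with proj₂ (hj (funs words r)) (λ u → code words (λ v → χ (map suc u ++ v)))
    ... | L , L-var , L-mono with proj₂ (focusing j) (λ v → χ (inst (ext L) (suc zero) ++ v))
    ...   | inj₁ (w , w-var , w-mono) = inj₁ (map suc u₀ ++ w , AnyP.++⁺ʳ (map suc u₀) w-var , mono)
      where
      u₀ = inst (ext L) (suc zero)
      eq : ∀ a → inst (map suc u₀ ++ w) a ≡ u₀ ++ inst w a
      eq a = trans (inst-++ (map suc u₀) w a) (cong (_++ inst w a) (inst-suc u₀ a))
      mono : ∀ a b → _
      mono a b = trans (cong χ (eq a)) (trans (w-mono a b) (cong χ (sym (eq b))))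
    ...   | inj₂ F = result
      where
      open Focused F
      u₀ = inst (ext L) (suc zero)
      const : ∀ a v → χ (inst (ext L) (suc a) ++ v) ≡ χ (u₀ ++ v)
      const a v = trans (cong (λ u → χ (u ++ v)) (inst-ext L a))
        (trans (code-injective words (λ v → χ (map suc (inst L a) ++ v)) (λ v → χ (map suc (inst L zero) ++ v)) (L-mono a zero) v)
               (cong (λ u → χ (u ++ v)) (sym (inst-ext L zero))))
      -- If the focus already has the colour of one of the lines, that line is monochromatic.
      result : Mono χ ⊎ Focused χ (suc j)
      result with any? (λ i → colour i ≟F χ (u₀ ++ focus))
      ... | yes (i , e) = inj₁ (map suc u₀ ++ line i , AnyP.++⁺ʳ (map suc u₀) (hasVar i) , λ a b → trans (mono a) (sym (mono b)))
        where
        mono : ∀ a → χ (inst (map suc u₀ ++ line i) a) ≡ colour i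
        mono a = trans (cong χ (trans (inst-++ (map suc u₀) (line i) a) (cong (_++ inst (line i) a) (inst-suc u₀ a)))) (at a)
          where
          at : ∀ a → χ (u₀ ++ inst (line i) a) ≡ colour i
          at zero = trans (cong (λ v → χ (u₀ ++ v)) (atFocus i)) (sym e)
          at (suc a) = coloured i a
      -- The old lines are prolonged by moving in both blocks together; the new line moves in front
      -- only and keeps the old focus behind. At `zero` all of them reach the new focus.
      ... | no new = inj₂ record
        { focus = inst (ext L) zero ++ focus
        ; line = line′
        ; hasVar = λ { zero → AnyP.++⁺ˡ (ext-hasVar L-var) ; (suc i) → AnyP.++⁺ˡ (ext-hasVar L-var) }
        ; atFocus = λ { zero → trans (inst-++ (ext L) (map suc focus) zero) (cong (inst (ext L) zero ++_) (inst-suc focus zero))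
                      ; (suc i) → trans (inst-++ (ext L) (line i) zero) (cong (inst (ext L) zero ++_) (atFocus i)) }
        ; colour = colour′
        ; coloured = λ { zero a → trans (cong χ (trans (inst-++ (ext L) (map suc focus) (suc a)) (cong (inst (ext L) (suc a) ++_) (inst-suc focus (suc a))))) (const a focus)
                       ; (suc i) a → trans (cong χ (inst-++ (ext L) (line i) (suc a))) (trans (const a _) (coloured i a)) }
        ; distinct = dist
        }
        where
        line′ : Fin (suc j) → _
        line′ zero = ext L ++ map suc focus
        line′ (suc i) = ext L ++ line i
        colour′ : Fin (suc j) → Fin r
        colour′ zero = χ (u₀ ++ focus)
        colour′ (suc i) = colour i
        dist : ∀ i i′ → colour′ i ≡ colour′ i′ → i ≡ i′
        dist zero zero _ = refl
        dist zero (suc i) e = ⊥-elim (new (i , sym e))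
        dist (suc i) zero e = ⊥-elim (new (i , e))
        dist (suc i) (suc i′) e = cong suc (distinct i i′ e)

-- With `suc r` focused lines, two would share one of the `r` colours, so only the monochromatic
-- alternative of `focusing` remains.
hales-jewett : ∀ k → HJ (suc k)
hales-jewett zero r = 1 , λ χ → zero ∷ [] , here refl , λ { zero zero → refl }
hales-jewett (suc k) r with focusing (hales-jewett k) r (suc r)
... | N , focused = N , mono
  where
  mono : ∀ χ → Mono χ
  mono χ with focused χ
  ... | inj₁ m = m
  ... | inj₂ F with pigeonhole (n<1+n r) (Focused.colour F)
  ...   | i , i′ , i<i′ , e with Focused.distinct F i i′ e
  ...     | refl = ⊥-elim (<-irrefl refl i<i′)

-- Forests and rigid surjections between them

data Fo : Set where
  nil : Fo
  cons : (A B : Fo) → Fo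

variable
  A B S S1 S2 T U V V1 V2 W : Fo
  k l m n r N : ℕ

-- The rigid surjections from the forest V onto the forest S lying below a chain of n further nodes of
-- the target (the old letters), onto which nodes of V may also be sent. The first root of V is sent to
-- an old letter and either no tree of S occurs above it (skip) or exactly the first one does (pass), or
-- it is the first node sent to the first root of S (hit), which becomes the old letter zero above it.
data F (n : ℕ) : Fo → Fo → Set where
  done : F n nil nil
  skip : Fin n → F n A nil → F n B S → F n (cons A B) S
  pass : Fin n → F n A (cons S1 nil) → F n B S2 → F n (cons A B) (cons S1 S2)
  hit : F (suc n) A S1 → F n B S2 → F n (cons A B) (cons S1 S2)

finite-F : ∀ n V S → Finite (F n V S)
finite-F n nil nil = finite-retract finite-⊤ (λ _ → tt) (λ _ → done) λ { done → refl }
finite-F n nil (cons _ _) = finite-retract finite-⊥ (λ ()) (λ ()) λ ()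
finite-F n (cons A B) nil = finite-retract (finite-× (finite-Fin n) (finite-× (finite-F n A nil) (finite-F n B nil)))
  (λ { (skip a p q) → a , p , q }) (λ (a , p , q) → skip a p q) λ { (skip a p q) → refl }
finite-F n (cons A B) (cons S1 S2) = finite-retract
  (finite-⊎ (finite-× (finite-Fin n) (finite-× (finite-F n A nil) (finite-F n B (cons S1 S2))))
    (finite-⊎ (finite-× (finite-Fin n) (finite-× (finite-F n A (cons S1 nil)) (finite-F n B S2)))
      (finite-× (finite-F (suc n) A S1) (finite-F n B S2))))
  (λ { (skip a p q) → inj₁ (a , p , q) ; (pass a p q) → inj₂ (inj₁ (a , p , q)) ; (hit p q) → inj₂ (inj₂ (p , q)) })
  (λ { (inj₁ (a , p , q)) → skip a p q ; (inj₂ (inj₁ (a , p , q))) → pass a p q ; (inj₂ (inj₂ (p , q))) → hit p q })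
  λ { (skip a p q) → refl ; (pass a p q) → refl ; (hit p q) → refl }

lift : Subst n m → Subst (suc n) (suc m)
lift σ = zero ∷ map suc σ

-- `σ` translates the letters of `t` into those of `s`. If the root hit by `t` is then sent to `b`,
-- the newest letter above it has to be read as `b`, whence `b ∷ σ`; if it is hit again, it remains
-- the newest letter, whence `lift σ`. Under `pass`, only the part of `s` on the first tree of its
-- source belongs above the first root.
comp : Subst n m → F n V T → F m T S → F m V S
comp σ done done = done
comp σ (skip a p q) s = skip (lookup σ a) (comp σ p done) (comp σ q s)
comp σ (pass a p q) (skip b p′ q′) = skip (lookup σ a) (comp σ p (skip b p′ done)) (comp σ q q′)
comp σ (pass a p q) (pass b p′ q′) = pass (lookup σ a) (comp σ p (pass b p′ done)) (comp σ q q′)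
comp σ (pass a p q) (hit p′ q′) = pass (lookup σ a) (comp σ p (hit p′ done)) (comp σ q q′)
comp σ (hit p q) (skip b p′ q′) = skip b (comp (b ∷ σ) p p′) (comp σ q q′)
comp σ (hit p q) (pass b p′ q′) = pass b (comp (b ∷ σ) p p′) (comp σ q q′)
comp σ (hit p q) (hit p′ q′) = hit (comp (lift σ) p p′) (comp σ q q′)

infixr 9 _∙_
_∙_ : F n V T → F n T S → F n V S
t ∙ s = comp idS t s

lift-id : lift (idS {n}) ≡ idS
lift-id = cong (zero ∷_) (sym (tabulate-∘ suc id))

⟨⟩-lookup : (ψ : Subst m k) (σ : Subst n m) (a : Fin n) → lookup (ψ ⟨ σ ⟩) a ≡ lookup ψ (lookup σ a)
⟨⟩-lookup ψ σ a = lookup-map a (lookup ψ) σ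

∷-⟨lift⟩ : ∀ b (ψ : Subst m k) (σ : Subst n m) → (b ∷ ψ) ⟨ lift σ ⟩ ≡ b ∷ ψ ⟨ σ ⟩
∷-⟨lift⟩ b ψ σ = cong (b ∷_) (sym (map-∘ _ suc σ))

lift-⟨lift⟩ : (ψ : Subst m k) (σ : Subst n m) → lift ψ ⟨ lift σ ⟩ ≡ lift (ψ ⟨ σ ⟩)
lift-⟨lift⟩ ψ σ = cong (zero ∷_) (begin
  map (lookup (lift ψ)) (map suc σ)   ≡⟨ map-∘ _ suc σ ⟨
  map (lookup (map suc ψ)) σ          ≡⟨ map-cong (λ a → lookup-map a suc ψ) σ ⟩
  map (suc ∘ lookup ψ) σ              ≡⟨ map-∘ suc _ σ ⟩
  map suc (map (lookup ψ) σ)          ∎)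
  where open ≡-Reasoning

-- Stated for arbitrary substitutions, because they change in the recursion above a hit root.
comp-assoc : (ψ : Subst m k) (σ : Subst n m) (t : F n V T) (s : F m T S) (u : F k S U) →
  comp ψ (comp σ t s) u ≡ comp (ψ ⟨ σ ⟩) t (comp ψ s u)
comp-assoc ψ σ done done done = refl
comp-assoc ψ σ (skip a p q) s u rewrite ⟨⟩-lookup ψ σ a = cong₂ (skip _) (comp-assoc ψ σ p done done) (comp-assoc ψ σ q s u)
comp-assoc ψ σ (pass a p q) (skip b p′ q′) u rewrite ⟨⟩-lookup ψ σ a =
  cong₂ (skip _) (comp-assoc ψ σ p (skip b p′ done) done) (comp-assoc ψ σ q q′ u)
comp-assoc ψ σ (pass a p q) (pass b p′ q′) (skip c p″ q″) rewrite ⟨⟩-lookup ψ σ a =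
  cong₂ (skip _) (comp-assoc ψ σ p (pass b p′ done) (skip c p″ done)) (comp-assoc ψ σ q q′ q″)
comp-assoc ψ σ (pass a p q) (pass b p′ q′) (pass c p″ q″) rewrite ⟨⟩-lookup ψ σ a =
  cong₂ (pass _) (comp-assoc ψ σ p (pass b p′ done) (pass c p″ done)) (comp-assoc ψ σ q q′ q″)
comp-assoc ψ σ (pass a p q) (pass b p′ q′) (hit p″ q″) rewrite ⟨⟩-lookup ψ σ a =
  cong₂ (pass _) (comp-assoc ψ σ p (pass b p′ done) (hit p″ done)) (comp-assoc ψ σ q q′ q″)
comp-assoc ψ σ (pass a p q) (hit p′ q′) (skip c p″ q″) rewrite ⟨⟩-lookup ψ σ a =
  cong₂ (skip _) (comp-assoc ψ σ p (hit p′ done) (skip c p″ done)) (comp-assoc ψ σ q q′ q″)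
comp-assoc ψ σ (pass a p q) (hit p′ q′) (pass c p″ q″) rewrite ⟨⟩-lookup ψ σ a =
  cong₂ (pass _) (comp-assoc ψ σ p (hit p′ done) (pass c p″ done)) (comp-assoc ψ σ q q′ q″)
comp-assoc ψ σ (pass a p q) (hit p′ q′) (hit p″ q″) rewrite ⟨⟩-lookup ψ σ a =
  cong₂ (pass _) (comp-assoc ψ σ p (hit p′ done) (hit p″ done)) (comp-assoc ψ σ q q′ q″)
comp-assoc ψ σ (hit p q) (skip b p′ q′) u =
  cong₂ (skip _) (comp-assoc ψ (b ∷ σ) p p′ done) (comp-assoc ψ σ q q′ u)
comp-assoc ψ σ (hit p q) (pass b p′ q′) (skip c p″ q″) =
  cong₂ (skip _) (comp-assoc ψ (b ∷ σ) p p′ (skip c p″ done)) (comp-assoc ψ σ q q′ q″)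
comp-assoc ψ σ (hit p q) (pass b p′ q′) (pass c p″ q″) =
  cong₂ (pass _) (comp-assoc ψ (b ∷ σ) p p′ (pass c p″ done)) (comp-assoc ψ σ q q′ q″)
comp-assoc ψ σ (hit p q) (pass b p′ q′) (hit p″ q″) =
  cong₂ (pass _) (comp-assoc ψ (b ∷ σ) p p′ (hit p″ done)) (comp-assoc ψ σ q q′ q″)
comp-assoc ψ σ (hit p q) (hit p′ q′) (skip c p″ q″) =
  cong₂ (skip _) (trans (comp-assoc (c ∷ ψ) (lift σ) p p′ p″) (cong (λ θ → comp θ p (comp (c ∷ ψ) p′ p″)) (∷-⟨lift⟩ c ψ σ)))
    (comp-assoc ψ σ q q′ q″)
comp-assoc ψ σ (hit p q) (hit p′ q′) (pass c p″ q″) =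
  cong₂ (pass _) (trans (comp-assoc (c ∷ ψ) (lift σ) p p′ p″) (cong (λ θ → comp θ p (comp (c ∷ ψ) p′ p″)) (∷-⟨lift⟩ c ψ σ)))
    (comp-assoc ψ σ q q′ q″)
comp-assoc ψ σ (hit p q) (hit p′ q′) (hit p″ q″) =
  cong₂ hit (trans (comp-assoc (lift ψ) (lift σ) p p′ p″) (cong (λ θ → comp θ p (comp (lift ψ) p′ p″)) (lift-⟨lift⟩ ψ σ)))
    (comp-assoc ψ σ q q′ q″)

id-⟨⟩ : (σ : Subst n m) → idS ⟨ σ ⟩ ≡ σ
id-⟨⟩ σ = trans (map-cong lookup-allFin σ) (map-id σ)

⟨⟩-id : (σ : Subst n m) → σ ⟨ idS ⟩ ≡ σ
⟨⟩-id σ = map-lookup-allFin σ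

∙-assoc : (t : F n V T) (s : F n T S) (u : F n S U) → (t ∙ s) ∙ u ≡ t ∙ s ∙ u
∙-assoc t s u = trans (comp-assoc idS idS t s u) (cong (λ σ → comp σ t (s ∙ u)) (id-⟨⟩ idS))

idF : F n T T
idF {T = nil} = done
idF {T = cons A B} = hit idF idF

comp-idˡ : (σ : Subst n m) (s : F m T S) → comp σ idF s ≡ s
comp-idˡ σ done = refl
comp-idˡ σ (skip b p q) = cong₂ (skip b) (comp-idˡ (b ∷ σ) p) (comp-idˡ σ q)
comp-idˡ σ (pass b p q) = cong₂ (pass b) (comp-idˡ (b ∷ σ) p) (comp-idˡ σ q)
comp-idˡ σ (hit p q) = cong₂ hit (comp-idˡ (lift σ) p) (comp-idˡ σ q)

ren : Subst n m → F n V T → F m V T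
ren σ t = comp σ t idF

comp-ren : (ψ : Subst m k) (σ : Subst n m) (t : F n V T) (s : F k T S) → comp ψ (ren σ t) s ≡ comp (ψ ⟨ σ ⟩) t s
comp-ren ψ σ t s = trans (comp-assoc ψ σ t idF s) (cong (comp (ψ ⟨ σ ⟩) t) (comp-idˡ ψ s))

weaken : F n V T → F (suc n) V T
weaken = ren (map suc idS)

∷-⟨suc⟩ : ∀ b (ψ : Subst n m) → (b ∷ ψ) ⟨ map suc idS ⟩ ≡ ψ
∷-⟨suc⟩ b ψ = trans (sym (map-∘ _ suc idS)) (⟨⟩-id ψ)

comp-weaken : ∀ b (ψ : Subst n m) (t : F n V T) (s : F m T S) → comp (b ∷ ψ) (weaken t) s ≡ comp ψ t s
comp-weaken b ψ t s = trans (comp-ren (b ∷ ψ) (map suc idS) t s) (cong (λ σ → comp σ t s) (∷-⟨suc⟩ b ψ))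

consts : Fin n → F n T nil
consts {T = nil} a = done
consts {T = cons A B} a = skip a (consts a) (consts a)

zeros : F (suc n) T nil
zeros = consts zero

-- Vertices, labelled paths and the action of surjections on them

data Vx : Fo → Set where
  here : Vx (cons A B)
  dn : Vx A → Vx (cons A B)
  rt : Vx B → Vx (cons A B)

-- A vertex together with labels of its strict predecessors and of all their, and its own, earlier siblings.
data Path (n : ℕ) : Fo → Set where
  here : Path n (cons A B)
  dn : Fin n → Path n A → Path n (cons A B)
  rt : Fin n → Path n B → Path n (cons A B)

finite-Path : ∀ n T → Finite (Path n T)
finite-Path n nil = finite-retract finite-⊥ (λ ()) (λ ()) λ ()
finite-Path n (cons A B) = finite-retract (finite-⊎ finite-⊤ (finite-⊎ (finite-× (finite-Fin n) (finite-Path n A)) (finite-× (finite-Fin n) (finite-Path n B))))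
  (λ { here → inj₁ tt ; (dn a x) → inj₂ (inj₁ (a , x)) ; (rt a x) → inj₂ (inj₂ (a , x)) })
  (λ { (inj₁ _) → here ; (inj₂ (inj₁ (a , x))) → dn a x ; (inj₂ (inj₂ (a , x))) → rt a x })
  λ { here → refl ; (dn a x) → refl ; (rt a x) → refl }

vert : Path n T → Vx T
vert here = here
vert (dn _ x) = dn (vert x)
vert (rt _ x) = rt (vert x)

-- If `x` is the path of a surjection `s`, this is the path of the composite of `t` and `s`, by
-- `path-comp`; it depends on `s` through `x` alone.
actP : Subst n m → F n V T → Path m T → Path m V
actP σ (skip a p q) x = rt (lookup σ a) (actP σ q x)
actP σ (pass a p q) here = dn (lookup σ a) (actP σ p here)
actP σ (pass a p q) (dn b x) = dn (lookup σ a) (actP σ p (dn b x))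
actP σ (pass a p q) (rt b x) = rt (lookup σ a) (actP σ q x)
actP σ (hit p q) here = here
actP σ (hit p q) (dn b x) = dn b (actP (b ∷ σ) p x)
actP σ (hit p q) (rt b x) = rt b (actP σ q x)

gF : F n V T → Vx T → Vx V
gF (skip a p q) x = rt (gF q x)
gF (pass a p q) here = dn (gF p here)
gF (pass a p q) (dn x) = dn (gF p (dn x))
gF (pass a p q) (rt x) = rt (gF q x)
gF (hit p q) here = here
gF (hit p q) (dn x) = dn (gF p x)
gF (hit p q) (rt x) = rt (gF q x)

gF-comp : (σ : Subst n m) (t : F n V T) (s : F m T S) (x : Vx S) → gF (comp σ t s) x ≡ gF t (gF s x)
gF-comp σ done done ()
gF-comp σ (skip a p q) s x = cong rt (gF-comp σ q s x)
gF-comp σ (pass a p q) (skip b p′ q′) x = cong rt (gF-comp σ q q′ x)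
gF-comp σ (pass a p q) (pass b p′ q′) here = cong dn (gF-comp σ p (pass b p′ done) here)
gF-comp σ (pass a p q) (pass b p′ q′) (dn x) = cong dn (gF-comp σ p (pass b p′ done) (dn x))
gF-comp σ (pass a p q) (pass b p′ q′) (rt x) = cong rt (gF-comp σ q q′ x)
gF-comp σ (pass a p q) (hit p′ q′) here = cong dn (gF-comp σ p (hit p′ done) here)
gF-comp σ (pass a p q) (hit p′ q′) (dn x) = cong dn (gF-comp σ p (hit p′ done) (dn x))
gF-comp σ (pass a p q) (hit p′ q′) (rt x) = cong rt (gF-comp σ q q′ x)
gF-comp σ (hit p q) (skip b p′ q′) x = cong rt (gF-comp σ q q′ x)
gF-comp σ (hit p q) (pass b p′ q′) here = cong dn (gF-comp (b ∷ σ) p p′ here)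
gF-comp σ (hit p q) (pass b p′ q′) (dn x) = cong dn (gF-comp (b ∷ σ) p p′ (dn x))
gF-comp σ (hit p q) (pass b p′ q′) (rt x) = cong rt (gF-comp σ q q′ x)
gF-comp σ (hit p q) (hit p′ q′) here = refl
gF-comp σ (hit p q) (hit p′ q′) (dn x) = cong dn (gF-comp (lift σ) p p′ x)
gF-comp σ (hit p q) (hit p′ q′) (rt x) = cong rt (gF-comp σ q q′ x)

gF-id : (x : Vx T) → gF (idF {n}) x ≡ x
gF-id here = refl
gF-id (dn x) = cong dn (gF-id x)
gF-id (rt x) = cong rt (gF-id x)

gF-weaken : (t : F n V T) (x : Vx T) → gF (weaken t) x ≡ gF t x
gF-weaken t x = trans (gF-comp _ t idF x) (cong (gF t) (gF-id x))

vert-actP : (σ : Subst n m) (t : F n V T) (x : Path m T) → vert (actP σ t x) ≡ gF t (vert x)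
vert-actP σ (skip a p q) x = cong rt (vert-actP σ q x)
vert-actP σ (pass a p q) here = cong dn (vert-actP σ p here)
vert-actP σ (pass a p q) (dn b x) = cong dn (vert-actP σ p (dn b x))
vert-actP σ (pass a p q) (rt b x) = cong rt (vert-actP σ q x)
vert-actP σ (hit p q) here = refl
vert-actP σ (hit p q) (dn b x) = cong dn (vert-actP (b ∷ σ) p x)
vert-actP σ (hit p q) (rt b x) = cong rt (vert-actP σ q x)

actP-comp : (ψ : Subst m k) (σ : Subst n m) (t : F n V T) (s : F m T S) (x : Path k S) →
  actP ψ (comp σ t s) x ≡ actP (ψ ⟨ σ ⟩) t (actP ψ s x)
actP-comp ψ σ done done ()
actP-comp ψ σ (skip a p q) s x = cong₂ rt (sym (⟨⟩-lookup ψ σ a)) (actP-comp ψ σ q s x)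
actP-comp ψ σ (pass a p q) (skip b p′ q′) x = cong₂ rt (sym (⟨⟩-lookup ψ σ a)) (actP-comp ψ σ q q′ x)
actP-comp ψ σ (pass a p q) (pass b p′ q′) here = cong₂ dn (sym (⟨⟩-lookup ψ σ a)) (actP-comp ψ σ p (pass b p′ done) here)
actP-comp ψ σ (pass a p q) (pass b p′ q′) (dn c x) = cong₂ dn (sym (⟨⟩-lookup ψ σ a)) (actP-comp ψ σ p (pass b p′ done) (dn c x))
actP-comp ψ σ (pass a p q) (pass b p′ q′) (rt c x) = cong₂ rt (sym (⟨⟩-lookup ψ σ a)) (actP-comp ψ σ q q′ x)
actP-comp ψ σ (pass a p q) (hit p′ q′) here = cong₂ dn (sym (⟨⟩-lookup ψ σ a)) (actP-comp ψ σ p (hit p′ done) here)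
actP-comp ψ σ (pass a p q) (hit p′ q′) (dn c x) = cong₂ dn (sym (⟨⟩-lookup ψ σ a)) (actP-comp ψ σ p (hit p′ done) (dn c x))
actP-comp ψ σ (pass a p q) (hit p′ q′) (rt c x) = cong₂ rt (sym (⟨⟩-lookup ψ σ a)) (actP-comp ψ σ q q′ x)
actP-comp ψ σ (hit p q) (skip b p′ q′) x = cong (rt _) (actP-comp ψ σ q q′ x)
actP-comp ψ σ (hit p q) (pass b p′ q′) here = cong (dn _) (actP-comp ψ (b ∷ σ) p p′ here)
actP-comp ψ σ (hit p q) (pass b p′ q′) (dn c x) = cong (dn _) (actP-comp ψ (b ∷ σ) p p′ (dn c x))
actP-comp ψ σ (hit p q) (pass b p′ q′) (rt c x) = cong (rt _) (actP-comp ψ σ q q′ x)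
actP-comp ψ σ (hit p q) (hit p′ q′) here = refl
actP-comp ψ σ (hit p q) (hit p′ q′) (dn c x) = cong (dn c)
  (trans (actP-comp (c ∷ ψ) (lift σ) p p′ x) (cong (λ θ → actP θ p (actP (c ∷ ψ) p′ x)) (∷-⟨lift⟩ c ψ σ)))
actP-comp ψ σ (hit p q) (hit p′ q′) (rt c x) = cong (rt _) (actP-comp ψ σ q q′ x)

actP-id : (σ : Subst n m) (x : Path m T) → actP σ idF x ≡ x
actP-id σ here = refl
actP-id σ (dn b x) = cong (dn b) (actP-id (b ∷ σ) x)
actP-id σ (rt c x) = cong (rt c) (actP-id σ x)

actP-weaken : ∀ b (ψ : Subst n m) (t : F n V T) (x : Path m T) → actP (b ∷ ψ) (weaken t) x ≡ actP ψ t x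
actP-weaken b ψ t x = begin
  actP (b ∷ ψ) (weaken t) x                              ≡⟨ actP-comp (b ∷ ψ) (map suc idS) t idF x ⟩
  actP ((b ∷ ψ) ⟨ map suc idS ⟩) t (actP (b ∷ ψ) idF x)   ≡⟨ cong₂ (λ σ y → actP σ t y) (∷-⟨suc⟩ b ψ) (actP-id (b ∷ ψ) x) ⟩
  actP ψ t x                                             ∎
  where open ≡-Reasoning

path : F n T (cons S1 S2) → Path n T
path (skip a p q) = rt a (path q)
path (pass a p q) = dn a (path p)
path (hit p q) = here

path-comp : (σ : Subst n m) (t : F n V T) (s : F m T (cons S1 S2)) → path (comp σ t s) ≡ actP σ t (path s)
path-comp σ (skip a p q) s = cong (rt _) (path-comp σ q s)
path-comp σ (pass a p q) (skip b p′ q′) = cong (rt _) (path-comp σ q q′)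
path-comp σ (pass a p q) (pass b p′ q′) = cong (dn _) (path-comp σ p (pass b p′ done))
path-comp σ (pass a p q) (hit p′ q′) = cong (dn _) (path-comp σ p (hit p′ done))
path-comp σ (hit p q) (skip b p′ q′) = cong (rt _) (path-comp σ q q′)
path-comp σ (hit p q) (pass b p′ q′) = cong (dn b) (path-comp (b ∷ σ) p p′)
path-comp σ (hit p q) (hit p′ q′) = refl

-- Arrow relations, their products and sums

-- `E` tells which small elements must receive equal colours. Besides constancy, it can thus express
-- that a colour depends only on a path or only on a vertex.
record Sys : Set₁ where
  field
    Obj : Set
    Big Mor : Obj → Set
    Small : Set
    E : Small → Small → Set
    ev : ∀ {o} → Mor o → Small → Big o
    finBig : ∀ o → Finite (Big o)
    finSmall : Finite Small

Arrow : Sys → Set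
Arrow P = ∀ r → Σ Obj λ o → (χ : Big o → Fin r) → Σ (Mor o) λ m → ∀ x y → E x y → χ (ev m x) ≡ χ (ev m y)
  where open Sys P

-- The second factor is settled first, uniformly over the whole of the big first factor; then the
-- first is settled uniformly over the small elements of the second. There is no circularity: `o`
-- depends only on the size of `Q.Small`, and `o′` on `o`.
arrow-× : (P Q : Sys) → Arrow P → Arrow Q → let module P = Sys P; module Q = Sys Q in
  ∀ r → Σ P.Obj λ o → Σ Q.Obj λ o′ → (χ : P.Big o → Q.Big o′ → Fin r) →
  Σ (P.Mor o) λ m → Σ (Q.Mor o′) λ m′ → ∀ x y x′ y′ → P.E x y → Q.E x′ y′ →
  χ (P.ev m x) (Q.ev m′ x′) ≡ χ (P.ev m y) (Q.ev m′ y′)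
arrow-× P Q p q r = o , o′ , λ χ →
  let m′ , e′ = proj₂ (q _) λ y → code (P.finBig o) λ x → χ x y
      m , e = proj₂ (p _) λ x → code Q.finSmall λ s → χ x (Q.ev m′ s)
  in m , m′ , λ x y x′ y′ exy exy′ → trans
    (code-injective Q.finSmall (λ s → χ (P.ev m x) (Q.ev m′ s)) (λ s → χ (P.ev m y) (Q.ev m′ s)) (e x y exy) x′)
    (code-injective (P.finBig o) (λ z → χ z (Q.ev m′ x′)) (λ z → χ z (Q.ev m′ y′)) (e′ x′ y′ exy′) (P.ev m y))
  where
  module P = Sys P
  module Q = Sys Q
  o = proj₁ (p (funs Q.finSmall r))
  o′ = proj₁ (q (funs (P.finBig o) r))

record Fam (n : ℕ) : Set₁ where
  field
    X : Fo → Set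
    fin : ∀ T → Finite (X T)
    E : X T → X T → Set
    act : F n V T → X T → X V
    act-∙ : (t : F n V T) (s : F n T S) (x : X S) → act (t ∙ s) x ≡ act t (act s x)
    E-act : (t : F n V T) {x y : X T} → E x y → E (act t x) (act t y)

sys : Fam n → Fo → Sys
sys {n} P T = record
  { Obj = Fo ; Big = X ; Mor = λ V → F n V T ; Small = X T ; E = E ; ev = act ; finBig = fin ; finSmall = fin T }
  where open Fam P

Ram : Fam n → Set
Ram P = ∀ T → Arrow (sys P T)

_⊎F_ : Fam n → Fam n → Fam n
P ⊎F Q = record
  { X = λ T → P.X T ⊎ Q.X T
  ; fin = λ T → finite-⊎ (P.fin T) (Q.fin T)
  ; E = λ { (inj₁ x) (inj₁ y) → P.E x y ; (inj₂ x) (inj₂ y) → Q.E x y ; _ _ → ⊥ }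
  ; act = λ { t (inj₁ x) → inj₁ (P.act t x) ; t (inj₂ x) → inj₂ (Q.act t x) }
  ; act-∙ = λ { t s (inj₁ x) → cong inj₁ (P.act-∙ t s x) ; t s (inj₂ x) → cong inj₂ (Q.act-∙ t s x) }
  ; E-act = λ { t {inj₁ x} {inj₁ y} e → P.E-act t e ; t {inj₂ x} {inj₂ y} e → Q.E-act t e }
  }
  where
  module P = Fam P
  module Q = Fam Q

-- The summands are treated in succession: `t` settles `P` at the forest `T′` chosen for `Q`, and
-- `E-act` preserves this when restricting along `s`. The second summand is required at `T` only,
-- which is what a recursive call supplies.
arrow-⊎ : (P Q : Fam n) → Ram P → ∀ T → Arrow (sys Q T) → Arrow (sys (P ⊎F Q) T)
arrow-⊎ P Q p T q r = proj₁ (p T′ r) , λ χ →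
  let t , e = proj₂ (p T′ r) (χ ∘ inj₁)
      s , e′ = proj₂ (q r) (χ ∘ inj₂ ∘ Q.act t)
  in t ∙ s , λ
    { (inj₁ x) (inj₁ y) exy → trans (cong (χ ∘ inj₁) (P.act-∙ t s x))
        (trans (e _ _ (P.E-act s exy)) (cong (χ ∘ inj₁) (sym (P.act-∙ t s y))))
    ; (inj₂ x) (inj₂ y) exy → trans (cong (χ ∘ inj₂) (Q.act-∙ t s x))
        (trans (e′ _ _ exy) (cong (χ ∘ inj₂) (sym (Q.act-∙ t s y)))) }
  where
  module P = Fam P
  module Q = Fam Q
  T′ = proj₁ (q r)

homF : (n : ℕ) (S : Fo) → Fam n
homF n S = record
  { X = λ T → F n T S ; fin = λ T → finite-F n T S ; E = λ _ _ → ⊤ ; act = _∙_ ; act-∙ = ∙-assoc ; E-act = λ _ _ → tt }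

pathF : (n : ℕ) (S1 S2 : Fo) → Fam n
pathF n S1 S2 = record
  { X = λ T → F n T (cons S1 S2) ; fin = λ T → finite-F n T (cons S1 S2)
  ; E = λ x y → path x ≡ path y ; act = _∙_ ; act-∙ = ∙-assoc
  ; E-act = λ t {x} {y} e → trans (path-comp idS t x) (trans (cong (actP idS t) e) (sym (path-comp idS t y))) }

-- Substituting a for the newest letter is how t acts on the part above the root of hit t q when that root gets the label a.
specF : (n : ℕ) (S : Fo) (E : ∀ {T} → F n T S → F n T S → Set) →
  (∀ {V T} a (t : F (suc n) V T) {x y : F n T S} → E x y → E (comp (a ∷ idS) t x) (comp (a ∷ idS) t y)) → Fam (suc n)
specF n S E E-comp = record
  { X = λ T → Fin n × F n T S
  ; fin = λ T → finite-× (finite-Fin n) (finite-F n T S)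
  ; E = λ (a , x) (b , y) → a ≡ b × E x y
  ; act = λ t (a , x) → a , comp (a ∷ idS) t x
  ; act-∙ = λ t s (a , x) → cong (a ,_) (trans (comp-assoc (a ∷ idS) idS t s x)
      (cong (λ σ → comp σ t (comp (a ∷ idS) s x)) (⟨⟩-id (a ∷ idS))))
  ; E-act = λ { t {a , x} {.a , y} (refl , e) → refl , E-comp a t e }
  }

arrow-spec : ∀ n S (E : ∀ {T} → F n T S → F n T S → Set) (E-comp :
  ∀ {V T} a (t : F (suc n) V T) {x y : F n T S} → E x y → E (comp (a ∷ idS) t x) (comp (a ∷ idS) t y)) →
  (∀ r → Σ Fo λ V → (χ : F n V S → Fin r) → Σ (F n V T) λ t → ∀ x y → E x y → χ (t ∙ x) ≡ χ (t ∙ y)) →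
  Arrow (sys (specF n S E E-comp) T)
arrow-spec n S E E-comp ram r = proj₁ (ram r′) , λ χ →
  let t , e = proj₂ (ram r′) λ x → code (finite-Fin n) λ a → χ (a , x)
  in weaken t , λ { (a , x) (.a , y) (refl , exy) → begin
    χ (a , comp (a ∷ idS) (weaken t) x) ≡⟨ cong (λ z → χ (a , z)) (comp-weaken a idS t x) ⟩
    χ (a , t ∙ x)                       ≡⟨ code-injective (finite-Fin n) (λ b → χ (b , t ∙ x)) (λ b → χ (b , t ∙ y)) (e x y exy) a ⟩
    χ (a , t ∙ y)                       ≡⟨ cong (λ z → χ (a , z)) (comp-weaken a idS t y) ⟨
    χ (a , comp (a ∷ idS) (weaken t) y) ∎ }
  where
  open ≡-Reasoning
  r′ = funs (finite-Fin n) r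

-- The Ramsey theorem for labellings

-- Combs: a chain of N nodes, with a forest mapped onto T beside each of its nodes and above its last node.
data Comb (n : ℕ) (T : Fo) : ℕ → Fo → Set where
  tip : F n W T → Comb n T 0 W
  tooth : Comb n T N V → F n W T → Comb n T (suc N) (cons V W)

fill : Subst n m → Comb n T N V → Vec (Fin m) N → Vec (F m T nil) (suc N) → F m V nil
fill σ (tip t) [] (s ∷ []) = comp σ t s
fill σ (tooth c t) (a ∷ w) (s ∷ ss) = skip a (fill σ c w ss) (comp σ t s)

comp-fill : (ψ : Subst m k) (σ : Subst n m) (c : Comb n T N V) (w : Vec (Fin m) N) (ss : Vec (F m T nil) (suc N)) →
  comp ψ (fill σ c w ss) done ≡ fill (ψ ⟨ σ ⟩) c (ψ ⟨ w ⟩) (map (λ s → comp ψ s done) ss)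
comp-fill ψ σ (tip t) [] (s ∷ []) = comp-assoc ψ σ t s done
comp-fill ψ σ (tooth c t) (a ∷ w) (s ∷ ss) = cong₂ (skip _) (comp-fill ψ σ c w ss) (comp-assoc ψ σ t s done)

combSys : ℕ → Fo → ℕ → Sys
combSys n T N = record
  { Obj = Fo ; Big = λ V → F n V nil ; Mor = Comb n T N
  ; Small = Vec (Fin n) N × Vec (F n T nil) (suc N) ; E = λ (w , _) (w′ , _) → w ≡ w′
  ; ev = λ c (w , ss) → fill idS c w ss
  ; finBig = λ V → finite-F n V nil
  ; finSmall = finite-× (finite-Vec (finite-Fin n) N) (finite-Vec (finite-F n T nil) (suc N)) }

-- The labellings of the `suc N` copies of `T` are made irrelevant by iterating the product
-- argument, each time uniformly over the label of the chain node added.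
arrow-comb : ∀ n T N → Arrow (sys (homF n nil) T) → Arrow (combSys n T N)
arrow-comb n T zero p r = proj₁ (p r) , λ χ →
  let t , e = proj₂ (p r) χ in tip t , λ { ([] , s ∷ []) (.[] , s′ ∷ []) refl → e s s′ tt }
arrow-comb n T (suc N) p r = cons D W₁ , λ χ →
  let c , t , e = eq λ d w → code (finite-Fin n) λ a → χ (skip a d w)
  in tooth c t , λ { (a ∷ w , s ∷ ss) (.(a ∷ w) , s′ ∷ ss′) refl →
       code-injective (finite-Fin n) (λ a → χ (skip a (fill idS c w ss) (t ∙ s))) (λ a → χ (skip a (fill idS c w ss′) (t ∙ s′)))
         (e (w , ss) (w , ss′) s s′ refl tt) a }
  where
  prod = arrow-× (combSys n T N) (sys (homF n nil) T) (arrow-comb n T N p) p (funs (finite-Fin n) r)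
  D = proj₁ prod
  W₁ = proj₁ (proj₂ prod)
  eq = proj₂ (proj₂ prod)

module _ {n : ℕ} {T : Fo} where
  -- Above the hit node, `T` is found in the first forest available, beside the next chain node or
  -- at the tip. Later forests receive a fixed labelling.
  under : Comb (suc n) T N V → Vec (Fin (suc (suc n))) N → F (suc (suc n)) V T
  under (tip t) [] = weaken t
  under (tooth c t) (a ∷ w) = skip a (fill (map suc idS) c w (replicate _ zeros)) (weaken t)

  -- The chain node at the first variable is the one hit, so the later variables become its newest
  -- letter `zero`; constant letters of the word become labels.
  lineF : Comb (suc n) T N V → (w : Vec (Fin (suc (suc n))) N) → HasVar w → F (suc n) V (cons T nil)
  lineF (tooth c t) (zero ∷ w) _ = hit (under c w) (t ∙ zeros)
  lineF (tooth c t) (suc a ∷ w) (there h) = pass a (lineF c w h) (t ∙ zeros)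

  comp-under : (c : Comb (suc n) T N V) (w : Vec (Fin (suc (suc n))) N) (b : Fin (suc n)) (s : F (suc n) T nil) →
    ∃ λ ss → comp (b ∷ idS) (under c w) s ≡ fill idS c (inst w b) ss
  comp-under (tip t) [] b s = s ∷ [] , comp-weaken b idS t s
  comp-under (tooth c t) (a ∷ w) b s = s ∷ _ , cong₂ (skip _)
    (trans (comp-fill (b ∷ idS) (map suc idS) c w _) (cong (λ σ → fill σ c (inst w b) (map (λ s → comp (b ∷ idS) s done) (replicate _ zeros))) (∷-⟨suc⟩ b idS)))
    (comp-weaken b idS t s)

  -- A label `b` at the root is read at every variable of the chain. The labelling `ss` of the
  -- forests is left existential because `arrow-comb` removes the dependence on it.
  comp-lineF : (c : Comb (suc n) T N V) (w : Vec (Fin (suc (suc n))) N) (h : HasVar w) (b : Fin (suc n)) (s : F (suc n) T nil) →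
    ∃ λ ss → lineF c w h ∙ skip b s done ≡ fill idS c (inst w b) ss
  comp-lineF (tooth c t) (zero ∷ w) _ b s = let ss , e = comp-under c w b s in
    zeros ∙ done ∷ ss , cong₂ (skip b) e (∙-assoc t zeros done)
  comp-lineF (tooth c t) (suc a ∷ w) (there h) b s = let ss , e = comp-lineF c w h b s in
    zeros ∙ done ∷ ss , cong₂ (skip _) e (∙-assoc t zeros done)

-- Induction on the forest. Combs and the product argument remove the labels above and beside the
-- first root, so that the colour becomes a function of a word; a monochromatic variable word
-- removes the label of the root.
ram-nil : ∀ n → Ram (homF (suc n) nil)
ram-nil n nil r = nil , λ χ → done , λ { done done _ → refl }
ram-nil n (cons T1 T2) r = cons D W₁ , λ χ →
  let c , t , e = eq λ d w → χ (skip zero d w)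
      w , h , mono = proj₂ (hales-jewett n r) λ w → χ (skip zero (fill idS c w (replicate _ zeros)) (t ∙ zeros))
      at : ∀ b s1 s2 → χ (skip zero (lineF c w h ∙ skip b s1 done) (t ∙ s2)) ≡
                      χ (skip zero (fill idS c (inst w b) (replicate _ zeros)) (t ∙ zeros))
      at b s1 s2 = let ss , e′ = comp-lineF c w h b s1 in
        trans (cong (λ z → χ (skip zero z (t ∙ s2))) e′) (e (inst w b , ss) (inst w b , _) s2 zeros refl tt)
  -- The comb is a forest of possibly several trees, so it stands above an auxiliary root, always
  -- labelled `zero`.
  in pass zero (lineF c w h) t , λ { (skip b s1 s2) (skip b′ s1′ s2′) _ →
       trans (at b s1 s2) (trans (mono b b′) (sym (at b′ s1′ s2′))) }
  where
  N₁ = proj₁ (hales-jewett n r)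
  prod = arrow-× (combSys (suc n) T1 N₁) (sys (homF (suc n) nil) T2)
    (arrow-comb (suc n) T1 N₁ (ram-nil n T1)) (ram-nil n T2) r
  D = proj₁ prod
  W₁ = proj₁ (proj₂ prod)
  eq = proj₂ (proj₂ prod)

-- Making the colour depend only on the path to the node hit by the first root

-- Recursion on `T`, split by the fate of its first root. Above this root there is a labelling, a
-- surjection onto `S1` with one more letter, or one onto `cons S1 nil`; beside it, one onto `S2` or
-- onto `cons S1 S2`. Sums let a single `t1` and a single `t2` serve all three cases.
ram-path : ∀ n S1 S2 → Ram (homF (suc (suc n)) S1) → Ram (homF (suc n) S2) → Ram (pathF (suc n) S1 S2)
ram-path n S1 S2 p q nil r = nil , λ χ → done , λ ()
ram-path n S1 S2 p q (cons T1 T2) r = cons (proj₁ prod) (proj₁ (proj₂ prod)) , λ χ →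
  let t1 , t2 , e = proj₂ (proj₂ prod) (colour χ) in hit t1 t2 , λ
    { (skip a x1 x2) (skip b y1 y2) h → suc-injective
        (e (inj₁ (a , x1)) (inj₁ (b , y1)) (inj₂ x2) (inj₂ y2) (rt-label h , tt) (rt-rest h))
    ; (pass a x1 x2) (pass b y1 y2) h → suc-injective
        (e (inj₂ (inj₂ (a , x1))) (inj₂ (inj₂ (b , y1))) (inj₁ x2) (inj₁ y2) (dn-label h , dn-rest h) tt)
    ; (hit x1 x2) (hit y1 y2) h → trans (cong (λ σ → χ (hit (comp σ t1 x1) (t2 ∙ x2))) lift-id) (trans
        (suc-injective (e (inj₂ (inj₁ x1)) (inj₂ (inj₁ y1)) (inj₁ x2) (inj₁ y2) tt tt))
        (cong (λ σ → χ (hit (comp σ t1 y1) (t2 ∙ y2))) (sym lift-id)))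
    ; (skip _ _ _) (pass _ _ _) () ; (skip _ _ _) (hit _ _) () ; (pass _ _ _) (skip _ _ _) ()
    ; (pass _ _ _) (hit _ _) () ; (hit _ _) (skip _ _ _) () ; (hit _ _) (pass _ _ _) () }
  where
  rt-label : ∀ {a b} {x y : Path (suc n) B} → rt {A = A} a x ≡ rt b y → a ≡ b
  rt-label refl = refl
  rt-rest : ∀ {a b} {x y : Path (suc n) B} → rt {A = A} a x ≡ rt b y → x ≡ y
  rt-rest refl = refl
  dn-label : ∀ {a b} {x y : Path (suc n) A} → dn {B = B} a x ≡ dn b y → a ≡ b
  dn-label refl = refl
  dn-rest : ∀ {a b} {x y : Path (suc n) A} → dn {B = B} a x ≡ dn b y → x ≡ y
  dn-rest refl = refl
  PS PP : Fam (suc (suc n))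
  PS = specF (suc n) nil (λ _ _ → ⊤) (λ _ _ _ → tt)
  samePath : ∀ {V T} a (t : F (suc (suc n)) V T) {x y : F (suc n) T (cons S1 nil)} → path x ≡ path y →
    path (comp (a ∷ idS) t x) ≡ path (comp (a ∷ idS) t y)
  samePath a t {x} {y} e = trans (path-comp (a ∷ idS) t x) (trans (cong (actP (a ∷ idS) t) e) (sym (path-comp (a ∷ idS) t y)))
  H = homF (suc (suc n)) S1
  PP = specF (suc n) (cons S1 nil) (λ x y → path x ≡ path y) samePath
  P = PS ⊎F (H ⊎F PP)
  Q = homF (suc n) S2 ⊎F pathF (suc n) S1 S2
  prod = arrow-× (sys P T1) (sys Q T2)
    (arrow-⊎ PS (H ⊎F PP) (λ T → arrow-spec (suc n) nil _ _ (ram-nil n T)) T1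
      (arrow-⊎ H PP p T1 (arrow-spec (suc n) (cons S1 nil) (λ x y → path x ≡ path y) samePath (ram-path n S1 nil p (ram-nil n) T1))))
    (arrow-⊎ (homF (suc n) S2) (pathF (suc n) S1 S2) q T2 (ram-path n S1 S2 p q T2)) (suc r)
  colour : (F (suc n) (cons V1 V2) (cons S1 S2) → Fin r) → Fam.X P V1 → Fam.X Q V2 → Fin (suc r)
  colour χ (inj₁ (a , x)) (inj₂ y) = suc (χ (skip a x y))
  colour χ (inj₂ (inj₂ (a , x))) (inj₁ y) = suc (χ (pass a x y))
  colour χ (inj₂ (inj₁ x)) (inj₁ y) = suc (χ (hit x y))
  -- A dummy colour for pairs that do not form a surjection; the true colours are shifted by one.
  colour χ _ _ = zero

-- Making the colour of a path depend only on its vertex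

trees : Fo → ℕ
trees nil = 0
trees (cons A B) = suc (trees B)

kid : ∀ T → Fin (trees T) → Fo
kid (cons A B) zero = A
kid (cons A B) (suc d) = kid B d

-- Each direction is to see one tree of `T` only. Sending the others to the letter `zero` also
-- resets the labels of the earlier roots on a path.
proj : ∀ d → F (suc n) T (cons (kid T d) nil)
proj {T = cons A B} zero = hit idF zeros
proj {T = cons A B} (suc d) = skip zero zeros (proj d)

treeOf : Path n T → Fin (trees T)
treeOf here = zero
treeOf (dn a x) = zero
treeOf (rt a x) = suc (treeOf x)

own : (x : Path n T) → Path n (cons (kid T (treeOf x)) nil)
own here = here
own (dn a x) = dn a x
own (rt a x) = own x

gF-proj : (x : Path n T) → gF (proj {m} (treeOf x)) (vert (own x)) ≡ vert x
gF-proj here = refl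
gF-proj (dn a x) = cong dn (gF-id (vert x))
gF-proj (rt a x) = cong rt (gF-proj x)

copies : ℕ → Fo → Fo
copies zero A = nil
copies (suc m) A = cons A (copies m A)

-- The roots of the copies are dummies: giving all of them the same label makes the labels along a path
-- into a copy independent of what happens in the other copies.
block : ℕ → ℕ → Fo → Fo
block m zero V = V
block m (suc N) V = cons (copies m (block m N V)) nil

inject : Fin n → Fin m → Path n A → Path n (copies m A)
inject c zero x = dn c x
inject c (suc d) x = rt c (inject c d x)

place : Fin n → Fin m → F n V (cons S nil) → F n (copies m V) (cons S nil)
place c zero p = pass c p (consts c)
place c (suc d) p = skip c (consts c) (place c d p)

actP-pass : (σ : Subst n m) (a : Fin n) (p : F n V (cons S nil)) (q : F n W nil) (x : Path m (cons S nil)) →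
  actP σ (pass a p q) x ≡ dn (lookup σ a) (actP σ p x)
actP-pass σ a p q here = refl
actP-pass σ a p q (dn b x) = refl

actP-place : (σ : Subst n m) (c : Fin n) (d : Fin k) (p : F n V (cons S nil)) (x : Path m (cons S nil)) →
  actP σ (place c d p) x ≡ inject (lookup σ c) d (actP σ p x)
actP-place σ c zero p x = actP-pass σ c p (consts c) x
actP-place σ c (suc d) p x = cong (rt _) (actP-place σ c d p x)

-- The last copy receives no tree; it keeps the set of directions nonempty even when `T` is empty.
fan : Fin n → (∀ d → F n V (cons (kid T d) nil)) → F n (copies (suc (trees T)) V) T
fan {T = nil} c f = skip c (consts c) done
fan {T = cons A B} c f = pass c (f zero) (fan c (f ∘ suc))

actP-fan : (σ : Subst n m) (c : Fin n) (f : ∀ d → F n V (cons (kid T d) nil)) (x : Path m T) →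
  actP σ (fan c f) x ≡ inject (lookup σ c) (inject₁ (treeOf x)) (actP σ (f (treeOf x)) (own x))
actP-fan σ c f here = refl
actP-fan σ c f (dn a x) = refl
actP-fan σ c f (rt a x) = cong (rt _) (actP-fan σ c (f ∘ suc) x)

-- Words in pairs (label, direction) encode labelled branches of blocks.
module _ {n m : ℕ} where
  Alph : ℕ
  Alph = suc n * suc m

  letter : Fin Alph → Fin (suc n)
  letter i = proj₁ (remQuot (suc m) i)

  dir : Fin Alph → Fin (suc m)
  dir i = proj₂ (remQuot {suc n} (suc m) i)

  wordPath : Vec (Fin Alph) N → Path (suc n) V → Path (suc n) (block (suc m) N V)
  wordPath [] x = x
  wordPath (i ∷ w) x = dn (letter i) (inject zero (dir i) (wordPath w x))

  -- This lives above the hit node: a variable reads the newest letter `zero` and turns to `d`, and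
  -- the dummy roots get `suc zero`, which is the old letter `zero`.
  branch : Vec (Fin (suc Alph)) N → Fin (suc m) → F (suc n) V (cons S nil) → F (suc (suc n)) (block (suc m) N V) (cons S nil)
  branch [] d p = weaken p
  branch (zero ∷ w) d p = pass zero (place (suc zero) d (branch w d p)) done
  branch (suc i ∷ w) d p = pass (suc (letter i)) (place (suc zero) (dir i) (branch w d p)) done

  actP-branch : (w : Vec (Fin (suc Alph)) N) (d : Fin (suc m)) (p : F (suc n) V (cons S nil)) (b : Fin (suc n)) (x : Path (suc n) (cons S nil)) →
    actP (b ∷ idS) (branch w d p) x ≡ wordPath (inst w (combine b d)) (actP idS p x)
  actP-branch [] d p b x = actP-weaken b idS p x
  actP-branch (zero ∷ w) d p b x = begin
    actP (b ∷ idS) (branch (zero ∷ w) d p) x                                 ≡⟨ actP-pass (b ∷ idS) zero _ done x ⟩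
    dn b (actP (b ∷ idS) (place (suc zero) d (branch w d p)) x)              ≡⟨ cong (dn b) (actP-place (b ∷ idS) (suc zero) d _ x) ⟩
    dn b (inject zero d (actP (b ∷ idS) (branch w d p) x))                   ≡⟨ cong (λ y → dn b (inject zero d y)) (actP-branch w d p b x) ⟩
    dn b (inject zero d (wordPath (inst w (combine b d)) (actP idS p x)))    ≡⟨ cong (λ (a , e) → dn a (inject zero e (wordPath (inst w (combine b d)) (actP idS p x)))) (remQuot-combine b d) ⟨
    wordPath (inst (zero ∷ w) (combine b d)) (actP idS p x)                  ∎
    where open ≡-Reasoning
  actP-branch (suc i ∷ w) d p b x = begin
    actP (b ∷ idS) (branch (suc i ∷ w) d p) x                                ≡⟨ actP-pass (b ∷ idS) (suc (letter i)) _ done x ⟩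
    dn a (actP (b ∷ idS) (place (suc zero) (dir i) (branch w d p)) x)        ≡⟨ cong (dn a) (actP-place (b ∷ idS) (suc zero) (dir i) _ x) ⟩
    dn a (inject zero (dir i) (actP (b ∷ idS) (branch w d p) x))             ≡⟨ cong₂ (λ c y → dn c (inject zero (dir i) y)) (lookup-allFin (letter i)) (actP-branch w d p b x) ⟩
    wordPath (i ∷ inst w (combine b d)) (actP idS p x)                       ≡⟨ cong (λ j → wordPath (j ∷ inst w (combine b d)) (actP idS p x)) (lookup-allFin i) ⟨
    wordPath (inst (suc i ∷ w) (combine b d)) (actP idS p x)                 ∎
    where
    open ≡-Reasoning
    a = lookup idS (letter i)

-- At the first variable the node is hit and the trees of `T` leave in different directions, as
-- meets require. Towards the tree with index `d` every later variable turns to `d` again, so a path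
-- with root label `b` into that tree reads the word with the one letter `(b, d)` substituted.
lineU : (w : Vec (Fin (suc (suc n * suc (trees T)))) N) → HasVar w → F (suc n) V T → F (suc n) (block (suc (trees T)) N V) (cons T nil)
lineU {n} (zero ∷ w) _ t = hit (fan (suc zero) λ d → branch {n} w (inject₁ d) (t ∙ proj d)) done
lineU {n} (suc i ∷ w) (there h) t = pass (letter {n} i) (place zero (dir {n} i) (lineU w h t)) done

actP-lineU : (w : Vec (Fin (suc (suc n * suc (trees T)))) N) (h : HasVar w) (t : F (suc n) V T) (b : Fin (suc n)) (x : Path (suc n) T) →
  actP idS (lineU w h t) (dn b x) ≡
  wordPath {n} {trees T} (inst w (combine b (inject₁ (treeOf x)))) (actP idS t (actP idS (proj (treeOf x)) (own x)))
actP-lineU {n} {T = T} (zero ∷ w) h t b x = begin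
  dn b (actP (b ∷ idS) (fan (suc zero) _) x)
    ≡⟨ cong (dn b) (actP-fan (b ∷ idS) (suc zero) _ x) ⟩
  dn b (inject zero d (actP (b ∷ idS) (branch {n} w d (t ∙ proj (treeOf x))) (own x)))
    ≡⟨ cong (λ y → dn b (inject zero d y)) (actP-branch w d _ b (own x)) ⟩
  dn b (inject zero d (wordPath {n} (inst w (combine b d)) (actP idS (t ∙ proj (treeOf x)) (own x))))
    ≡⟨ cong (λ y → dn b (inject zero d (wordPath {n} (inst w (combine b d)) y)))
         (trans (actP-comp idS idS t (proj (treeOf x)) (own x)) (cong (λ σ → actP σ t (actP idS (proj (treeOf x)) (own x))) (id-⟨⟩ idS))) ⟩
  dn b (inject zero d (wordPath {n} (inst w (combine b d)) (actP idS t (actP idS (proj (treeOf x)) (own x)))))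
    ≡⟨ cong (λ (a , e) → dn a (inject zero e (wordPath {n} (inst w (combine b d)) (actP idS t (actP idS (proj (treeOf x)) (own x)))))) (remQuot-combine b d) ⟨
  _ ∎
  where
  open ≡-Reasoning
  d = inject₁ (treeOf x)
actP-lineU {n} {T = T} (suc i ∷ w) (there h) t b x = begin
  dn (lookup idS (letter {n} i)) (actP idS (place zero (dir {n} i) (lineU w h t)) (dn b x))
    ≡⟨ cong₂ dn (lookup-allFin (letter {n} i)) (actP-place idS zero (dir {n} i) (lineU w h t) (dn b x)) ⟩
  dn (letter {n} i) (inject zero (dir {n} i) (actP idS (lineU w h t) (dn b x)))
    ≡⟨ cong (λ y → dn (letter {n} i) (inject zero (dir {n} i) y)) (actP-lineU w h t b x) ⟩
  wordPath {n} (i ∷ inst w c) _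
    ≡⟨ cong (λ j → wordPath {n} {trees T} (j ∷ inst w c) (actP idS t (actP idS (proj (treeOf x)) (own x)))) (lookup-allFin i) ⟨
  _ ∎
  where
  open ≡-Reasoning
  c = combine b (inject₁ (treeOf x))

vertF : ∀ n → Fam n
vertF n = record
  { X = Path n ; fin = finite-Path n ; E = λ x y → vert x ≡ vert y ; act = actP idS
  ; act-∙ = λ t s x → trans (actP-comp idS idS t s x) (cong (λ σ → actP σ t (actP idS s x)) (id-⟨⟩ idS))
  ; E-act = λ t {x} {y} e → trans (vert-actP idS t x) (trans (cong (gF t) e) (sym (vert-actP idS t y))) }

-- Induction on the forest. Hales-Jewett, uniformly over the paths in `V₁`, makes the colour forget
-- the label of the first root and the tree entered above it. What remains is a path in `V₁`, where
-- the induction hypothesis for `T1` removes the labels.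
ram-vert : ∀ n → Ram (vertF (suc n))
ram-vert n nil r = nil , λ χ → done , λ ()
ram-vert n (cons T1 T2) r = cons (block (suc (trees T1)) N₁ V₁) (proj₁ (ram-vert n T2 r)) , λ χ →
  let w , h , mono = proj₂ hj λ w → code paths λ x → χ (dn zero (wordPath {n} w x))
      t1 , e1 = proj₂ (ram-vert n T1 r) λ x → χ (dn zero (wordPath {n} (inst w zero) x))
      t2 , e2 = proj₂ (ram-vert n T2 r) λ x → χ (rt zero x)
      straighten : ∀ b x → χ (dn zero (actP idS (lineU w h t1) (dn b x))) ≡
        χ (dn zero (wordPath {n} (inst w zero) (actP idS t1 (actP idS (proj (treeOf x)) (own x)))))
      straighten b x = trans (cong (λ y → χ (dn zero y)) (actP-lineU w h t1 b x))
        (code-injective paths (λ y → χ (dn zero (wordPath {n} (inst w (combine b (inject₁ (treeOf x)))) y)))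
          (λ y → χ (dn zero (wordPath {n} (inst w zero) y))) (mono _ zero) _)
      sameVert : ∀ x → vert (actP idS (proj (treeOf x)) (own x)) ≡ vert x
      sameVert x = trans (vert-actP idS (proj (treeOf x)) (own x)) (gF-proj x)
  in pass zero (lineU w h t1) t2 , λ
    { here here _ → refl
    ; (dn b x) (dn c y) e → trans (straighten b x) (trans
        (e1 _ _ (trans (sameVert x) (trans (dn-inj e) (sym (sameVert y))))) (sym (straighten c y)))
    ; (rt b x) (rt c y) e → e2 x y (rt-inj e)
    ; here (dn _ _) () ; here (rt _ _) () ; (dn _ _) here () ; (dn _ _) (rt _ _) () ; (rt _ _) here () ; (rt _ _) (dn _ _) () }
  where
  V₁ = proj₁ (ram-vert n T1 r)
  paths = finite-Path (suc n) V₁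
  -- The successor of this argument computes to `suc n * suc (trees T1)`, the number of pairs of a
  -- label and a direction.
  hj = hales-jewett (trees T1 + n * suc (trees T1)) (funs paths r)
  N₁ = proj₁ hj
  dn-inj : {x y : Vx A} → dn {B = B} x ≡ dn y → x ≡ y
  dn-inj refl = refl
  rt-inj : {x y : Vx B} → rt {A = A} x ≡ rt y → x ≡ y
  rt-inj refl = refl

-- Vertex colourings

infixr 5 _⧺_
_⧺_ : Fo → Fo → Fo
nil ⧺ W = W
cons A B ⧺ W = cons A (B ⧺ W)

extʳ : F (suc n) V T → F (suc n) (V ⧺ W) T
extʳ done = zeros
extʳ (skip a p q) = skip a p (extʳ q)
extʳ (pass a p q) = pass a p (extʳ q)
extʳ (hit p q) = hit p (extʳ q)

extˡ : F (suc n) W T → F (suc n) (V ⧺ W) T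
extˡ {V = nil} q = q
extˡ {V = cons A B} q = skip zero zeros (extˡ q)

inlV : Vx V → Vx (V ⧺ W)
inlV here = here
inlV (dn v) = dn v
inlV (rt v) = rt (inlV v)

inrV : Vx W → Vx (V ⧺ W)
inrV {V = nil} v = v
inrV {V = cons A B} v = rt (inrV v)

gF-extʳ : (t : F (suc n) V T) (v : Vx T) → gF (extʳ {W = W} t) v ≡ inlV (gF t v)
gF-extʳ done ()
gF-extʳ (skip a p q) v = cong rt (gF-extʳ q v)
gF-extʳ (pass a p q) here = refl
gF-extʳ (pass a p q) (dn v) = refl
gF-extʳ (pass a p q) (rt v) = cong rt (gF-extʳ q v)
gF-extʳ (hit p q) here = refl
gF-extʳ (hit p q) (dn v) = refl
gF-extʳ (hit p q) (rt v) = cong rt (gF-extʳ q v)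

gF-extˡ : (t : F (suc n) W T) (v : Vx T) → gF (extˡ {V = V} t) v ≡ inrV (gF t v)
gF-extˡ {V = nil} t v = refl
gF-extˡ {V = cons A B} t v = cong rt (gF-extˡ {V = B} t v)

_On_by_ : {C : Set} → C → (Vx V → C) → F n V T → Set
c On χ by t = ∀ v → χ (gF t v) ≡ c

TwoColours : ℕ → Fo → Fo → Set
TwoColours n A B = Σ Fo λ V → (χ : Vx V → Bool) →
  (Σ (F (suc n) V A) (true On χ by_)) ⊎ (Σ (F (suc n) V B) (false On χ by_))

module _ {n : ℕ} {X Y : Fo} (χ : Vx (cons X Y) → Bool) where
  data InTree (c : Bool) (S : Fo) : Set where
    atRoot : χ here ≡ c → (t : F (suc n) X S) → c On χ ∘ dn by t → InTree c S
    inside : (t : F (suc n) X (cons S nil)) → c On χ ∘ dn by t → InTree c S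

  join-tree : ∀ {c} → InTree c S1 → (q : F (suc n) Y S2) → c On χ ∘ rt by q →
    Σ (F (suc n) (cons X Y) (cons S1 S2)) (c On χ by_)
  join-tree (atRoot e t h) q h′ = hit (weaken t) q , λ
    { here → e ; (dn v) → trans (cong (χ ∘ dn) (gF-weaken t v)) (h v) ; (rt v) → h′ v }
  join-tree (inside t h) q h′ = pass zero t q , λ { here → h here ; (dn v) → h (dn v) ; (rt v) → h′ v }

-- If the first root is `true`, then above it lies either `A1` in `true`, which the root completes,
-- or `cons B1 nil` in `false`; symmetrically if it is `false`. So the first tree of one target is
-- found, and the rest of that target, or the whole of the other, lies beside it. As the outcomes
-- are not known in advance, the forests for both stand side by side.
twoColours-cons : ∀ A1 A2 → (∀ B → TwoColours n A1 B) → (∀ B → TwoColours n A2 B) → ∀ B → TwoColours n (cons A1 A2) B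
twoColours-cons A1 A2 p q nil = nil , λ χ → inj₂ (done , λ ())
twoColours-cons {n} A1 A2 p q (cons B1 B2) = cons X Y , colouring
  where
  X1 = p (cons B1 nil)
  X2 = twoColours-cons A1 nil p (λ B → nil , λ χ → inj₁ (done , λ ())) B1
  Y1 = q (cons B1 B2)
  Y2 = twoColours-cons A1 A2 p q B2
  X = proj₁ X1 ⧺ proj₁ X2
  Y = proj₁ Y1 ⧺ proj₁ Y2
  left : ∀ {C : Set} {c : C} (χ : Vx (V ⧺ W) → C) (t : F (suc n) V T) → c On χ ∘ inlV by t → c On χ by extʳ t
  left χ t h v = trans (cong χ (gF-extʳ t v)) (h v)
  right : ∀ {W T} V {C : Set} {c : C} (χ : Vx (V ⧺ W) → C) (t : F (suc n) W T) → c On χ ∘ inrV {V = V} by t → c On χ by extˡ t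
  right V χ t h v = trans (cong χ (gF-extˡ {V = V} t v)) (h v)
  colouring : (χ : Vx (cons X Y) → Bool) →
    (Σ (F (suc n) (cons X Y) (cons A1 A2)) (true On χ by_)) ⊎ (Σ (F (suc n) (cons X Y) (cons B1 B2)) (false On χ by_))
  colouring χ = finish (tree (χ here) refl)
    where
    tree : ∀ c → χ here ≡ c → InTree {n} χ true A1 ⊎ InTree {n} χ false B1
    tree true e with proj₂ X1 (χ ∘ dn ∘ inlV)
    ... | inj₁ (t , h) = inj₁ (atRoot e (extʳ t) (left (χ ∘ dn) t h))
    ... | inj₂ (t , h) = inj₂ (inside (extʳ t) (left (χ ∘ dn) t h))
    tree false e with proj₂ X2 (λ v → χ (dn (inrV {V = proj₁ X1} v)))
    ... | inj₁ (t , h) = inj₁ (inside (extˡ t) (right (proj₁ X1) (λ v → χ (dn v)) t h))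
    ... | inj₂ (t , h) = inj₂ (atRoot e (extˡ t) (right (proj₁ X1) (λ v → χ (dn v)) t h))
    finish : InTree {n} χ true A1 ⊎ InTree {n} χ false B1 → _
    finish (inj₁ k) with proj₂ Y1 (χ ∘ rt ∘ inlV)
    ... | inj₁ (t , h) = inj₁ (join-tree χ k (extʳ t) (left (χ ∘ rt) t h))
    ... | inj₂ (t , h) = inj₂ (skip zero zeros (extʳ t) , left (χ ∘ rt) t h)
    finish (inj₂ k) with proj₂ Y2 (λ v → χ (rt (inrV {V = proj₁ Y1} v)))
    ... | inj₁ (t , h) = inj₁ (skip zero zeros (extˡ t) , right (proj₁ Y1) (λ v → χ (rt v)) t h)
    ... | inj₂ (t , h) = inj₂ (join-tree χ k (extˡ t) (right (proj₁ Y1) (λ v → χ (rt v)) t h))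

twoColours : ∀ A B → TwoColours n A B
twoColours nil B = nil , λ χ → inj₁ (done , λ ())
twoColours (cons A1 A2) B = twoColours-cons A1 A2 (twoColours A1) (twoColours A2) B

-- The nonzero colours are merged: either `T` occurs in colour `zero`, or the forest that works for
-- `r` colours occurs without it.
vertex-pigeonhole : ∀ n T r → Σ Fo λ V → (χ : Vx V → Fin r) → Σ (F (suc n) V T) λ t → ∀ v w → χ (gF t v) ≡ χ (gF t w)
vertex-pigeonhole n T zero = T , λ χ → idF , λ v _ → ⊥-elim (absurd (χ v))
  where
  absurd : Fin 0 → ⊥
  absurd ()
vertex-pigeonhole n T (suc r) = proj₁ two , colouring
  where
  smaller = vertex-pigeonhole n T r
  two = twoColours {n} T (proj₁ smaller)
  isZero : Fin (suc r) → Bool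
  isZero zero = true
  isZero (suc _) = false
  zero! : ∀ {c} → isZero c ≡ true → c ≡ zero
  zero! {zero} _ = refl
  nonzero : ∀ {c} → isZero c ≡ false → zero ≢ c
  nonzero {zero} () _
  nonzero {suc _} _ ()
  colouring : (χ : Vx (proj₁ two) → Fin (suc r)) → Σ (F (suc n) (proj₁ two) T) λ t → ∀ v w → χ (gF t v) ≡ χ (gF t w)
  colouring χ with proj₂ two (isZero ∘ χ)
  ... | inj₁ (t , h) = t , λ v w → trans (zero! (h v)) (sym (zero! (h w)))
  ... | inj₂ (t , h) with proj₂ smaller (λ v → punchOut (nonzero (h v)))
  ...   | s , e = t ∙ s , λ v w → trans (cong χ (gF-comp idS t s v))
    (trans (punchOut-injective (nonzero (h _)) (nonzero (h _)) (e v w)) (cong χ (sym (gF-comp idS t s w))))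

zeroPath : Vx T → Path (suc n) T
zeroPath here = here
zeroPath (dn v) = dn zero (zeroPath v)
zeroPath (rt v) = rt zero (zeroPath v)

vert-zeroPath : (v : Vx T) → vert (zeroPath {n = n} v) ≡ v
vert-zeroPath here = refl
vert-zeroPath (dn v) = cong dn (vert-zeroPath v)
vert-zeroPath (rt v) = cong rt (vert-zeroPath v)

-- The forests are chosen in the order opposite to that in which the colour is simplified: for
-- vertices, then for paths, then for surjections. Paths have `suc r` colours, the extra one for
-- paths of no surjection.
ramsey : ∀ S n → Ram (homF (suc n) S)
ramsey nil n = ram-nil n
ramsey (cons S1 S2) n T r = V₀ , λ χ →
  let t0 , e0 = proj₂ rp χ
      t1 , e1 = proj₂ rv (pathColour χ t0)
      t2 , e2 = proj₂ ph (λ v → pathColour χ t0 (actP idS t1 (zeroPath v)))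
      colour-vertex : ∀ x → suc (χ ((t0 ∙ t1 ∙ t2) ∙ x)) ≡ pathColour χ t0 (actP idS t1 (zeroPath (gF t2 (vert (path x)))))
      colour-vertex x = begin
        suc (χ ((t0 ∙ t1 ∙ t2) ∙ x))
          ≡⟨ cong (suc ∘ χ) (trans (∙-assoc t0 (t1 ∙ t2) x) (cong (t0 ∙_) (∙-assoc t1 t2 x))) ⟩
        suc (χ (t0 ∙ t1 ∙ t2 ∙ x))
          ≡⟨ pathColour-path χ t0 e0 (t1 ∙ t2 ∙ x) ⟨
        pathColour χ t0 (path (t1 ∙ t2 ∙ x))
          ≡⟨ cong (pathColour χ t0) (trans (path-comp idS t1 (t2 ∙ x)) (cong (actP idS t1) (path-comp idS t2 x))) ⟩
        pathColour χ t0 (actP idS t1 (actP idS t2 (path x)))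
          ≡⟨ e1 _ _ (trans (vert-actP idS t2 (path x)) (sym (vert-zeroPath _))) ⟩
        pathColour χ t0 (actP idS t1 (zeroPath (gF t2 (vert (path x))))) ∎
  in t0 ∙ t1 ∙ t2 , λ x y _ → suc-injective (trans (colour-vertex x) (trans (e2 _ _) (sym (colour-vertex y))))
  where
  open ≡-Reasoning
  ph = vertex-pigeonhole n T (suc r)
  rv = ram-vert n (proj₁ ph) (suc r)
  T₁ = proj₁ rv
  rp = ram-path n S1 S2 (ramsey S1 (suc n)) (ramsey S2 n) T₁ r
  V₀ = proj₁ rp
  module H = Finite (finite-F (suc n) T₁ (cons S1 S2))
  module P = Finite (finite-Path (suc n) T₁)
  -- The colour of the surjections with a given path, and zero if there are none.
  pathColour : (F (suc n) V₀ (cons S1 S2) → Fin r) → F (suc n) V₀ T₁ → Path (suc n) T₁ → Fin (suc r)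
  pathColour χ t0 x with H.search (λ s → path s P.≟ x)
  ... | yes (s , _) = suc (χ (t0 ∙ s))
  ... | no _ = zero
  pathColour-path : ∀ χ t0 → (∀ s s′ → path s ≡ path s′ → χ (t0 ∙ s) ≡ χ (t0 ∙ s′)) →
    ∀ s → pathColour χ t0 (path s) ≡ suc (χ (t0 ∙ s))
  pathColour-path χ t0 e s with H.search (λ s′ → path s′ P.≟ path s)
  ... | yes (s′ , h) = cong suc (e s′ s h)
  ... | no none = ⊥-elim (none (s , refl))

-- The tree order, meets and the linear order on vertices

data _⊑_ : Vx A → Vx A → Set where
  ⊑-here : here {A} {B} ⊑ here
  ⊑-root : {w : Vx A} → here {A} {B} ⊑ dn w
  ⊑-dn : {v w : Vx A} → v ⊑ w → dn {B = B} v ⊑ dn w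
  ⊑-rt : {v w : Vx B} → v ⊑ w → rt {A = A} v ⊑ rt w

-- Depth-first order, the strict form of the linear order of an ordered tree.
data _≺_ : Vx A → Vx A → Set where
  here≺dn : {w : Vx A} → here {A} {B} ≺ dn w
  here≺rt : {w : Vx B} → here {A} {B} ≺ rt w
  ≺-dn : {v w : Vx A} → v ≺ w → dn {B = B} v ≺ dn w
  dn≺rt : {v : Vx A} {w : Vx B} → dn v ≺ rt w
  ≺-rt : {v w : Vx B} → v ≺ w → rt {A = A} v ≺ rt w

-- Vertices of different trees have no meet in the forest.
meet : Vx A → Vx A → Maybe (Vx A)
meet here here = just here
meet here (dn w) = just here
meet here (rt w) = nothing
meet (dn v) here = just here
meet (dn v) (dn w) = just (maybe dn here (meet v w))
meet (dn v) (rt w) = nothing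
meet (rt v) here = nothing
meet (rt v) (dn w) = nothing
meet (rt v) (rt w) = Maybe.map rt (meet v w)

dn-injective : {x y : Vx A} → dn {B = B} x ≡ dn y → x ≡ y
dn-injective refl = refl

rt-injective : {x y : Vx B} → rt {A = A} x ≡ rt y → x ≡ y
rt-injective refl = refl

map-rt-injective : {p q : Maybe (Vx B)} → Maybe.map {B = Vx (cons A B)} rt p ≡ Maybe.map rt q → p ≡ q
map-rt-injective {p = just x} {just .x} refl = refl
map-rt-injective {p = nothing} {nothing} _ = refl

⊑-refl : {v : Vx A} → v ⊑ v
⊑-refl {v = here} = ⊑-here
⊑-refl {v = dn v} = ⊑-dn ⊑-refl
⊑-refl {v = rt v} = ⊑-rt ⊑-refl

⊑-reflexive : {v w : Vx A} → v ≡ w → v ⊑ w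
⊑-reflexive refl = ⊑-refl

⊑-trans : {u v w : Vx A} → u ⊑ v → v ⊑ w → u ⊑ w
⊑-trans ⊑-here q = q
⊑-trans ⊑-root (⊑-dn q) = ⊑-root
⊑-trans (⊑-dn p) (⊑-dn q) = ⊑-dn (⊑-trans p q)
⊑-trans (⊑-rt p) (⊑-rt q) = ⊑-rt (⊑-trans p q)

⊑-antisym : {v w : Vx A} → v ⊑ w → w ⊑ v → v ≡ w
⊑-antisym ⊑-here _ = refl
⊑-antisym (⊑-dn p) (⊑-dn q) = cong dn (⊑-antisym p q)
⊑-antisym (⊑-rt p) (⊑-rt q) = cong rt (⊑-antisym p q)

⊑-chain : {u v w : Vx A} → u ⊑ w → v ⊑ w → u ⊑ v ⊎ v ⊑ u
⊑-chain ⊑-here q = inj₂ q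
⊑-chain ⊑-root ⊑-root = inj₁ ⊑-here
⊑-chain ⊑-root (⊑-dn q) = inj₁ ⊑-root
⊑-chain (⊑-dn p) ⊑-root = inj₂ ⊑-root
⊑-chain (⊑-dn p) (⊑-dn q) = Sum.map ⊑-dn ⊑-dn (⊑-chain p q)
⊑-chain (⊑-rt p) (⊑-rt q) = Sum.map ⊑-rt ⊑-rt (⊑-chain p q)

_⊑?_ : (v w : Vx A) → Dec (v ⊑ w)
here ⊑? here = yes ⊑-here
here ⊑? dn w = yes ⊑-root
here ⊑? rt w = no λ ()
dn v ⊑? here = no λ ()
dn v ⊑? dn w = Dec.map′ ⊑-dn (λ { (⊑-dn p) → p }) (v ⊑? w)
dn v ⊑? rt w = no λ ()
rt v ⊑? here = no λ ()
rt v ⊑? dn w = no λ ()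
rt v ⊑? rt w = Dec.map′ ⊑-rt (λ { (⊑-rt p) → p }) (v ⊑? w)

⊑⇒meet : {v w : Vx A} → v ⊑ w → meet v w ≡ just v
⊑⇒meet ⊑-here = refl
⊑⇒meet ⊑-root = refl
⊑⇒meet (⊑-dn p) rewrite ⊑⇒meet p = refl
⊑⇒meet (⊑-rt p) rewrite ⊑⇒meet p = refl

meet-comm : (v w : Vx A) → meet v w ≡ meet w v
meet-comm here here = refl
meet-comm here (dn w) = refl
meet-comm here (rt w) = refl
meet-comm (dn v) here = refl
meet-comm (dn v) (dn w) = cong (just ∘ maybe dn here) (meet-comm v w)
meet-comm (dn v) (rt w) = refl
meet-comm (rt v) here = refl
meet-comm (rt v) (dn w) = refl
meet-comm (rt v) (rt w) = cong (Maybe.map rt) (meet-comm v w)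

meet-⊑ˡ : (v w : Vx A) {z : Vx A} → meet v w ≡ just z → z ⊑ v
meet-⊑ˡ here here refl = ⊑-here
meet-⊑ˡ here (dn w) refl = ⊑-here
meet-⊑ˡ (dn v) here refl = ⊑-root
meet-⊑ˡ (dn v) (dn w) e with meet v w in eq
meet-⊑ˡ (dn v) (dn w) refl | just z = ⊑-dn (meet-⊑ˡ v w eq)
meet-⊑ˡ (dn v) (dn w) refl | nothing = ⊑-root
meet-⊑ˡ (rt v) (rt w) e with meet v w in eq
meet-⊑ˡ (rt v) (rt w) refl | just z = ⊑-rt (meet-⊑ˡ v w eq)

meet-⊑ʳ : (v w : Vx A) {z : Vx A} → meet v w ≡ just z → z ⊑ w
meet-⊑ʳ v w e = meet-⊑ˡ w v (trans (meet-comm w v) e)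

meet-greatest : {u v w : Vx A} → u ⊑ v → u ⊑ w → ∃ λ z → meet v w ≡ just z × u ⊑ z
meet-greatest ⊑-here ⊑-here = here , refl , ⊑-here
meet-greatest ⊑-here ⊑-root = here , refl , ⊑-here
meet-greatest ⊑-root ⊑-here = here , refl , ⊑-here
meet-greatest {v = dn v} {dn w} ⊑-root ⊑-root with meet v w
... | just z = dn z , refl , ⊑-root
... | nothing = here , refl , ⊑-here
meet-greatest (⊑-dn p) (⊑-dn q) with meet-greatest p q
... | z , e , h = dn z , cong (just ∘ maybe dn here) e , ⊑-dn h
meet-greatest (⊑-rt p) (⊑-rt q) with meet-greatest p q
... | z , e , h = rt z , cong (Maybe.map rt) e , ⊑-rt h

⊑⇒≡⊎≺ : {v w : Vx A} → v ⊑ w → v ≡ w ⊎ v ≺ w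
⊑⇒≡⊎≺ ⊑-here = inj₁ refl
⊑⇒≡⊎≺ ⊑-root = inj₂ here≺dn
⊑⇒≡⊎≺ (⊑-dn p) = Sum.map (cong dn) ≺-dn (⊑⇒≡⊎≺ p)
⊑⇒≡⊎≺ (⊑-rt p) = Sum.map (cong rt) ≺-rt (⊑⇒≡⊎≺ p)

≺-irrefl : {v : Vx A} → ¬ (v ≺ v)
≺-irrefl (≺-dn p) = ≺-irrefl p
≺-irrefl (≺-rt p) = ≺-irrefl p

≺-trans : {u v w : Vx A} → u ≺ v → v ≺ w → u ≺ w
≺-trans here≺dn (≺-dn q) = here≺dn
≺-trans here≺dn dn≺rt = here≺rt
≺-trans here≺rt (≺-rt q) = here≺rt
≺-trans (≺-dn p) (≺-dn q) = ≺-dn (≺-trans p q)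
≺-trans (≺-dn p) dn≺rt = dn≺rt
≺-trans dn≺rt (≺-rt q) = dn≺rt
≺-trans (≺-rt p) (≺-rt q) = ≺-rt (≺-trans p q)

≺-total : (v w : Vx A) → v ≡ w ⊎ v ≺ w ⊎ w ≺ v
≺-total here here = inj₁ refl
≺-total here (dn w) = inj₂ (inj₁ here≺dn)
≺-total here (rt w) = inj₂ (inj₁ here≺rt)
≺-total (dn v) here = inj₂ (inj₂ here≺dn)
≺-total (dn v) (dn w) = Sum.map (cong dn) (Sum.map ≺-dn ≺-dn) (≺-total v w)
≺-total (dn v) (rt w) = inj₂ (inj₁ dn≺rt)
≺-total (rt v) here = inj₂ (inj₂ here≺rt)
≺-total (rt v) (dn w) = inj₂ (inj₂ dn≺rt)
≺-total (rt v) (rt w) = Sum.map (cong rt) (Sum.map ≺-rt ≺-rt) (≺-total v w)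

⊑-≺-trans : {u v w : Vx A} → u ⊑ v → v ≺ w → u ≺ w
⊑-≺-trans p q with ⊑⇒≡⊎≺ p
... | inj₁ refl = q
... | inj₂ r = ≺-trans r q

≺-⊑-trans : {u v w : Vx A} → u ≺ v → v ⊑ w → u ≺ w
≺-⊑-trans p q with ⊑⇒≡⊎≺ q
... | inj₁ refl = p
... | inj₂ r = ≺-trans p r

_⪯_ : Vx A → Vx A → Set
v ⪯ w = v ≡ w ⊎ v ≺ w

-- Equality in `Maybe` also demands that vertices of different trees go to different trees.
record IsEmb (g : Vx S → Vx T) : Set where
  field
    meets : ∀ x y → meet (g x) (g y) ≡ Maybe.map g (meet x y)
    mono : ∀ {x y} → x ≺ y → g x ≺ g y

  mono-⊑ : ∀ {x y} → x ⊑ y → g x ⊑ g y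
  mono-⊑ {x} {y} p = meet-⊑ʳ (g x) (g y) (trans (meets x y) (cong (Maybe.map g) (⊑⇒meet p)))

  injective : ∀ {x y} → g x ≡ g y → x ≡ y
  injective {x} {y} e with ≺-total x y
  ... | inj₁ e′ = e′
  ... | inj₂ (inj₁ p) = ⊥-elim (≺-irrefl (subst (_≺ g y) e (mono p)))
  ... | inj₂ (inj₂ p) = ⊥-elim (≺-irrefl (subst (g y ≺_) e (mono p)))

-- Rigid surjections as pairs of functions

record IsRigid (f : Vx T → Fin n ⊎ Vx S) (g : Vx S → Vx T) : Set where
  field
    emb : IsEmb g
    section : ∀ x → f (g x) ≡ inj₂ x
    least : ∀ y {x} → f y ≡ inj₂ x → g x ⊑ y

  open IsEmb emb public

lab : F n V nil → Vx V → Fin n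
lab (skip a p q) here = a
lab (skip a p q) (dn y) = lab p y
lab (skip a p q) (rt y) = lab q y

inFirst : Vx (cons S1 nil) → Vx (cons S1 S2)
inFirst here = here
inFirst (dn x) = dn x

-- The view from outside the part above a hit root: its newest letter is that root, and the older
-- letters lose one index.
ageLetters : Fin (suc n) ⊎ Vx S1 → Fin n ⊎ Vx (cons S1 S2)
ageLetters (inj₁ zero) = inj₂ here
ageLetters (inj₁ (suc a)) = inj₁ a
ageLetters (inj₂ x) = inj₂ (dn x)

fF : F n V S → Vx V → Fin n ⊎ Vx S
fF (skip a p q) here = inj₁ a
fF (skip a p q) (dn y) = inj₁ (lab p y)
fF (skip a p q) (rt y) = fF q y
fF (pass a p q) here = inj₁ a
fF (pass a p q) (dn y) = Sum.map₂ inFirst (fF p y)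
fF (pass a p q) (rt y) = Sum.map₂ rt (fF q y)
fF (hit p q) here = inj₂ here
fF (hit p q) (dn y) = ageLetters (fF p y)
fF (hit p q) (rt y) = Sum.map₂ rt (fF q y)

fF-section : (t : F n V S) (x : Vx S) → fF t (gF t x) ≡ inj₂ x
fF-section (skip a p q) x = fF-section q x
fF-section (pass a p q) here rewrite fF-section p here = refl
fF-section (pass a p q) (dn x) rewrite fF-section p (dn x) = refl
fF-section (pass a p q) (rt x) rewrite fF-section q x = refl
fF-section (hit p q) here = refl
fF-section (hit p q) (dn x) rewrite fF-section p x = refl
fF-section (hit p q) (rt x) rewrite fF-section q x = refl

fF-least : (t : F n V S) (y : Vx V) {x : Vx S} → fF t y ≡ inj₂ x → gF t x ⊑ y
fF-least (skip a p q) (rt y) e = ⊑-rt (fF-least q y e)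
fF-least (pass a p q) (dn y) e with fF p y in eq
fF-least (pass a p q) (dn y) refl | inj₂ here = ⊑-dn (fF-least p y eq)
fF-least (pass a p q) (dn y) refl | inj₂ (dn x) = ⊑-dn (fF-least p y eq)
fF-least (pass a p q) (rt y) e with fF q y in eq
fF-least (pass a p q) (rt y) refl | inj₂ x = ⊑-rt (fF-least q y eq)
fF-least (hit p q) here refl = ⊑-here
fF-least (hit p q) (dn y) e with fF p y in eq
fF-least (hit p q) (dn y) refl | inj₁ zero = ⊑-root
fF-least (hit p q) (dn y) refl | inj₂ x = ⊑-dn (fF-least p y eq)
fF-least (hit p q) (rt y) e with fF q y in eq
fF-least (hit p q) (rt y) refl | inj₂ x = ⊑-rt (fF-least q y eq)

gF-mono : (t : F n V S) {x y : Vx S} → x ≺ y → gF t x ≺ gF t y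
gF-mono (skip a p q) r = ≺-rt (gF-mono q r)
gF-mono (pass a p q) here≺dn = ≺-dn (gF-mono p here≺dn)
gF-mono (pass a p q) here≺rt = dn≺rt
gF-mono (pass a p q) (≺-dn r) = ≺-dn (gF-mono p (≺-dn r))
gF-mono (pass a p q) dn≺rt = dn≺rt
gF-mono (pass a p q) (≺-rt r) = ≺-rt (gF-mono q r)
gF-mono (hit p q) here≺dn = here≺dn
gF-mono (hit p q) here≺rt = here≺rt
gF-mono (hit p q) (≺-dn r) = ≺-dn (gF-mono p r)
gF-mono (hit p q) dn≺rt = dn≺rt
gF-mono (hit p q) (≺-rt r) = ≺-rt (gF-mono q r)

gF-meets : (t : F n V S) (x y : Vx S) → meet (gF t x) (gF t y) ≡ Maybe.map (gF t) (meet x y)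
gF-meets done ()
gF-meets (skip a p q) x y rewrite gF-meets q x y with meet x y
... | just _ = refl
... | nothing = refl
gF-meets (pass a p q) here here rewrite gF-meets p here here = refl
gF-meets (pass a p q) here (dn y) rewrite gF-meets p here (dn y) = refl
gF-meets (pass a p q) here (rt y) = refl
gF-meets (pass a p q) (dn x) here rewrite gF-meets p (dn x) here = refl
gF-meets (pass a p q) (dn x) (dn y) rewrite gF-meets p (dn x) (dn y) with meet x y
... | just _ = refl
... | nothing = refl
gF-meets (pass a p q) (dn x) (rt y) = refl
gF-meets (pass a p q) (rt x) here = refl
gF-meets (pass a p q) (rt x) (dn y) = refl
gF-meets (pass a p q) (rt x) (rt y) rewrite gF-meets q x y with meet x y
... | just _ = refl
... | nothing = refl
gF-meets (hit p q) here here = refl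
gF-meets (hit p q) here (dn y) = refl
gF-meets (hit p q) here (rt y) = refl
gF-meets (hit p q) (dn x) here = refl
gF-meets (hit p q) (dn x) (dn y) rewrite gF-meets p x y with meet x y
... | just _ = refl
... | nothing = refl
gF-meets (hit p q) (dn x) (rt y) = refl
gF-meets (hit p q) (rt x) here = refl
gF-meets (hit p q) (rt x) (dn y) = refl
gF-meets (hit p q) (rt x) (rt y) rewrite gF-meets q x y with meet x y
... | just _ = refl
... | nothing = refl

rigid : (t : F n V S) → IsRigid (fF t) (gF t)
rigid t = record { emb = record { meets = gF-meets t ; mono = gF-mono t } ; section = fF-section t ; least = fF-least t }

rename : Subst n m → (Vx T → Fin m ⊎ Vx S) → Fin n ⊎ Vx T → Fin m ⊎ Vx S
rename σ f (inj₁ a) = inj₁ (lookup σ a)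
rename σ f (inj₂ x) = f x

fF-lab : (t : F n V nil) (y : Vx V) → fF t y ≡ inj₁ (lab t y)
fF-lab (skip a p q) here = refl
fF-lab (skip a p q) (dn y) = refl
fF-lab (skip a p q) (rt y) = fF-lab q y

lab-comp : (σ : Subst n m) (t : F n V nil) (y : Vx V) → lookup σ (lab t y) ≡ lab (comp σ t done) y
lab-comp σ (skip a p q) here = refl
lab-comp σ (skip a p q) (dn y) = lab-comp σ p y
lab-comp σ (skip a p q) (rt y) = lab-comp σ q y

inFirst² : (l : Fin n ⊎ Vx (cons S1 nil)) → Sum.map₂ (inFirst {S2 = S2}) l ≡ Sum.map₂ inFirst (Sum.map₂ (inFirst {S2 = nil}) l)
inFirst² (inj₁ a) = refl
inFirst² (inj₂ here) = refl
inFirst² (inj₂ (dn x)) = refl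

inFirst-age : (l : Fin (suc n) ⊎ Vx S1) → ageLetters {S2 = S2} l ≡ Sum.map₂ inFirst (ageLetters {S2 = nil} l)
inFirst-age (inj₁ zero) = refl
inFirst-age (inj₁ (suc a)) = refl
inFirst-age (inj₂ x) = refl

fF-comp : (σ : Subst n m) (t : F n V T) (s : F m T S) (y : Vx V) → rename σ (fF s) (fF t y) ≡ fF (comp σ t s) y
fF-comp σ done done ()
fF-comp σ (skip a p q) s here = refl
fF-comp σ (skip a p q) s (dn y) = cong inj₁ (lab-comp σ p y)
fF-comp σ (skip a p q) s (rt y) = fF-comp σ q s y
fF-comp σ (pass a p q) (skip b p′ q′) here = refl
fF-comp σ (pass a p q) (skip b p′ q′) (dn y)
  with fF p y | trans (fF-comp σ p (skip b p′ done) y) (fF-lab (comp σ p (skip b p′ done)) y)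
... | inj₁ _ | h = cong inj₁ (inj₁-injective h)
... | inj₂ here | h = cong inj₁ (inj₁-injective h)
... | inj₂ (dn x) | h = cong inj₁ (inj₁-injective h)
fF-comp σ (pass a p q) (skip b p′ q′) (rt y) with fF q y | fF-comp σ q q′ y
... | inj₁ _ | h = h
... | inj₂ _ | h = h
fF-comp σ (pass a p q) (pass b p′ q′) here = refl
fF-comp σ (pass a p q) (pass b p′ q′) (dn y) with fF p y | fF-comp σ p (pass b p′ done) y
... | inj₁ _ | h = cong (Sum.map₂ inFirst) h
... | inj₂ here | h = cong (Sum.map₂ inFirst) h
... | inj₂ (dn x) | h = trans (inFirst² (fF p′ x)) (cong (Sum.map₂ inFirst) h)
fF-comp σ (pass a p q) (pass b p′ q′) (rt y) with fF q y | fF-comp σ q q′ y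
... | inj₁ _ | h = cong (Sum.map₂ rt) h
... | inj₂ _ | h = cong (Sum.map₂ rt) h
fF-comp σ (pass a p q) (hit p′ q′) here = refl
fF-comp σ (pass a p q) (hit p′ q′) (dn y) with fF p y | fF-comp σ p (hit p′ done) y
... | inj₁ _ | h = cong (Sum.map₂ inFirst) h
... | inj₂ here | h = cong (Sum.map₂ inFirst) h
... | inj₂ (dn x) | h = trans (inFirst-age (fF p′ x)) (cong (Sum.map₂ inFirst) h)
fF-comp σ (pass a p q) (hit p′ q′) (rt y) with fF q y | fF-comp σ q q′ y
... | inj₁ _ | h = cong (Sum.map₂ rt) h
... | inj₂ _ | h = cong (Sum.map₂ rt) h
fF-comp σ (hit p q) (skip b p′ q′) here = refl
fF-comp σ (hit p q) (skip b p′ q′) (dn y)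
  with fF p y | trans (fF-comp (b ∷ σ) p p′ y) (fF-lab (comp (b ∷ σ) p p′) y)
... | inj₁ zero | h = cong inj₁ (inj₁-injective h)
... | inj₁ (suc _) | h = cong inj₁ (inj₁-injective h)
... | inj₂ x | h = cong inj₁ (inj₁-injective (trans (sym (fF-lab p′ x)) h))
fF-comp σ (hit p q) (skip b p′ q′) (rt y) with fF q y | fF-comp σ q q′ y
... | inj₁ _ | h = h
... | inj₂ _ | h = h
fF-comp σ (hit p q) (pass b p′ q′) here = refl
fF-comp σ (hit p q) (pass b p′ q′) (dn y) with fF p y | fF-comp (b ∷ σ) p p′ y
... | inj₁ zero | h = cong (Sum.map₂ inFirst) h
... | inj₁ (suc _) | h = cong (Sum.map₂ inFirst) h
... | inj₂ x | h = cong (Sum.map₂ inFirst) h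
fF-comp σ (hit p q) (pass b p′ q′) (rt y) with fF q y | fF-comp σ q q′ y
... | inj₁ _ | h = cong (Sum.map₂ rt) h
... | inj₂ _ | h = cong (Sum.map₂ rt) h
fF-comp σ (hit p q) (hit p′ q′) here = refl
fF-comp σ (hit p q) (hit p′ q′) (dn y) with fF p y | fF-comp (lift σ) p p′ y
... | inj₁ zero | h = cong ageLetters h
... | inj₁ (suc a) | h = cong ageLetters (trans (cong inj₁ (sym (lookup-map a suc σ))) h)
... | inj₂ x | h = cong ageLetters h
fF-comp σ (hit p q) (hit p′ q′) (rt y) with fF q y | fF-comp σ q q′ y
... | inj₁ _ | h = cong (Sum.map₂ rt) h
... | inj₂ _ | h = cong (Sum.map₂ rt) h

labels : (ℓ : Vx V → Fin n) → Σ (F n V nil) λ t → ∀ y → lab t y ≡ ℓ y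
labels {nil} ℓ = done , λ ()
labels {cons A B} ℓ =
  let p , hp = labels (ℓ ∘ dn)
      q , hq = labels (ℓ ∘ rt)
  in skip (ℓ here) p q , λ { here → refl ; (dn y) → hp y ; (rt y) → hq y }

Decoded : (f : Vx T → Fin n ⊎ Vx S) (g : Vx S → Vx T) → Set
Decoded {T} {n} {S} f g = Σ (F n T S) λ t → (∀ y → fF t y ≡ f y) × (∀ x → gF t x ≡ g x)

module Decode {A B S1 S2 n} (f : Vx (cons A B) → Fin n ⊎ Vx (cons S1 S2)) (g : Vx (cons S1 S2) → Vx (cons A B))
  (R : IsRigid f g) where
  open IsRigid R

  isOld : ∀ y → (∀ x → ¬ (g x ⊑ y)) → ∃ λ a → f y ≡ inj₁ a
  isOld y none with f y in e
  ... | inj₁ a = a , refl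
  ... | inj₂ x = ⊥-elim (none x (least y e))

  -- Every case of decoding cuts out a part of the source by `i` and of the target by `j`, with `c`
  -- translating labels. The condition on meets is left to the caller, since two vertices above a
  -- root may lose their meet when the root is removed.
  restrict : ∀ {C S′ k} (i : Vx C → Vx (cons A B)) (j : Vx S′ → Vx (cons S1 S2))
    (c : Fin k ⊎ Vx S′ → Fin n ⊎ Vx (cons S1 S2)) (f′ : Vx C → Fin k ⊎ Vx S′) (g′ : Vx S′ → Vx C) →
    (∀ {v w} → i v ⊑ i w → v ⊑ w) → (∀ {v w} → i v ≺ i w → v ≺ w) → (∀ {x y} → x ≺ y → j x ≺ j y) →
    (∀ {l x} → c l ≡ inj₂ (j x) → l ≡ inj₂ x) → (∀ x → c (inj₂ x) ≡ inj₂ (j x)) →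
    (∀ y → f (i y) ≡ c (f′ y)) → (∀ x → g (j x) ≡ i (g′ x)) →
    (∀ x y → meet (i (g′ x)) (i (g′ y)) ≡ Maybe.map g (meet (j x) (j y)) → meet (g′ x) (g′ y) ≡ Maybe.map g′ (meet x y)) →
    IsRigid f′ g′
  restrict i j c f′ g′ i⊑ i≺ j≺ c-inj c₂ ef eg m = record
    { emb = record
      { meets = λ x y → m x y (trans (cong₂ meet (sym (eg x)) (sym (eg y))) (meets (j x) (j y)))
      ; mono = λ {x} {y} p → i≺ (subst (_≺ i (g′ y)) (eg x) (subst (g (j x) ≺_) (eg y) (mono (j≺ p)))) }
    ; section = λ x → c-inj (trans (sym (ef (g′ x))) (trans (cong f (sym (eg x))) (section (j x))))
    ; least = λ y {x} e → i⊑ (subst (_⊑ i y) (eg x) (least (i y) (trans (ef y) (trans (cong c e) (c₂ x)))))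
    }

  dn⊑ : ∀ {v w : Vx A} → dn {B = B} v ⊑ dn w → v ⊑ w
  dn⊑ (⊑-dn p) = p
  rt⊑ : ∀ {v w : Vx B} → rt {A = A} v ⊑ rt w → v ⊑ w
  rt⊑ (⊑-rt p) = p
  dn≺ : ∀ {v w : Vx A} → dn {B = B} v ≺ dn w → v ≺ w
  dn≺ (≺-dn p) = p
  rt≺ : ∀ {v w : Vx B} → rt {A = A} v ≺ rt w → v ≺ w
  rt≺ (≺-rt p) = p

  rt-meet : ∀ {S′} (j : Vx S′ → Vx (cons S1 S2)) (g′ : Vx S′ → Vx B) → (∀ x → g (j x) ≡ rt (g′ x)) → ∀ p q →
    Maybe.map rt p ≡ Maybe.map g (Maybe.map j q) → p ≡ Maybe.map g′ q
  rt-meet j g′ eg p nothing e = map-rt-injective e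
  rt-meet j g′ eg p (just x) e = map-rt-injective (trans e (cong just (eg x)))

  map-id′ : ∀ {X : Set} (p : Maybe X) → p ≡ Maybe.map (λ x → x) p
  map-id′ (just _) = refl
  map-id′ nothing = refl

  -- `here` comes first in the depth-first order and `g` is increasing.
  firstIsRt : ∀ {v} → g here ≡ rt v → ∀ x → ∃ λ w → g x ≡ rt w
  firstIsRt {v} e here = v , e
  firstIsRt e (dn x) with g (dn x) | subst (_≺ g (dn x)) e (mono here≺dn)
  ... | rt w | _ = w , refl
  firstIsRt e (rt x) with g (rt x) | subst (_≺ g (rt x)) e (mono here≺rt)
  ... | rt w | _ = w , refl

  skipCase : ∀ {v} → g here ≡ rt v → (∀ {f′ : Vx B → Fin n ⊎ Vx (cons S1 S2)} {g′} → IsRigid f′ g′ → Decoded f′ g′) → Decoded f g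
  skipCase e ih =
    let a , ea = isOld here λ x p → notHere (subst (_⊑ here) (proj₂ (rts x)) p)
        ℓ y = isOld (dn y) λ x p → notDn (subst (_⊑ dn y) (proj₂ (rts x)) p)
        p , hp = labels (proj₁ ∘ ℓ)
        q , hf , hg = ih (restrict rt (λ x → x) (λ l → l) (f ∘ rt) (proj₁ ∘ rts) rt⊑ rt≺ (λ p → p) (λ e → e) (λ _ → refl)
          (λ _ → refl) (proj₂ ∘ rts) λ x y h → rt-meet (λ x → x) (proj₁ ∘ rts) (proj₂ ∘ rts) _ (meet x y) (trans h (cong (Maybe.map g) (map-id′ (meet x y)))))
    in skip a p q , (λ { here → sym ea ; (dn y) → trans (cong inj₁ (hp y)) (sym (proj₂ (ℓ y))) ; (rt y) → hf y })
      , λ x → trans (cong rt (hg x)) (sym (proj₂ (rts x)))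
    where
    rts = firstIsRt e
    notHere : ∀ {w : Vx B} → ¬ (rt {A = A} w ⊑ here)
    notHere ()
    notDn : ∀ {w : Vx B} {y : Vx A} → ¬ (rt w ⊑ dn y)
    notDn ()

  -- `here` and `rt x` have no meet, whereas any two vertices of the first tree of the source have
  -- one.
  restIsRt : (∀ v → g here ≢ rt v) → ∀ x → ∃ λ w → g (rt x) ≡ rt w
  restIsRt notRt x with g here | g (rt x) | meets here (rt x)
  ... | rt v | _ | _ = ⊥-elim (notRt v refl)
  ... | here | rt w | _ = w , refl
  ... | dn _ | rt w | _ = w , refl

  restLabels : (∀ v → g here ≢ rt v) → (∀ x → ∃ λ w → g (dn x) ≡ dn w) →
    ∀ y → ∃ λ l → f (rt y) ≡ Sum.map₂ rt l
  restLabels notRt dns y with f (rt y) in e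
  ... | inj₁ a = inj₁ a , refl
  ... | inj₂ (rt x) = inj₂ x , refl
  ... | inj₂ here with g here | least (rt y) e | notRt
  ...   | rt v | _ | h = ⊥-elim (h v refl)
  restLabels notRt dns y | inj₂ (dn x) with g (dn x) | least (rt y) e | dns x
  ... | .(dn w) | () | w , refl

  restRigid : (rts : ∀ x → ∃ λ w → g (rt x) ≡ rt w) (ls : ∀ y → ∃ λ l → f (rt y) ≡ Sum.map₂ rt l) →
    IsRigid {n = n} (proj₁ ∘ ls) (proj₁ ∘ rts)
  restRigid rts ls = restrict rt rt (Sum.map₂ rt) (proj₁ ∘ ls) (proj₁ ∘ rts) rt⊑ rt≺ ≺-rt rt-label (λ _ → refl) (proj₂ ∘ ls) (proj₂ ∘ rts)
    λ x y → rt-meet rt (proj₁ ∘ rts) (proj₂ ∘ rts) _ (meet x y)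
    where
    rt-label : ∀ {l : Fin n ⊎ Vx S2} {x} → Sum.map₂ rt l ≡ inj₂ (rt x) → l ≡ inj₂ x
    rt-label {inj₂ x} e = cong inj₂ (rt-injective (inj₂-injective e))

  passCase : ∀ {v} → g here ≡ dn v →
    (∀ {f′ : Vx A → Fin n ⊎ Vx (cons S1 nil)} {g′} → IsRigid f′ g′ → Decoded f′ g′) →
    (∀ {f′ : Vx B → Fin n ⊎ Vx S2} {g′} → IsRigid f′ g′ → Decoded f′ g′) → Decoded f g
  passCase {v} e ih₁ ih₂ =
    let a , ea = isOld here notHere
        p , pf , pg = ih₁ (restrict dn inFirst (Sum.map₂ inFirst) (proj₁ ∘ firstLabels) (proj₁ ∘ dns) dn⊑ dn≺ first≺ first-label
          (λ _ → refl) (proj₂ ∘ firstLabels) (proj₂ ∘ dns) first-meets)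
        q , qf , qg = ih₂ (restRigid rts ls)
    in pass a p q
      , (λ { here → sym ea ; (dn y) → trans (cong (Sum.map₂ inFirst) (pf y)) (sym (proj₂ (firstLabels y)))
           ; (rt y) → trans (cong (Sum.map₂ rt) (qf y)) (sym (proj₂ (ls y))) })
      , λ { here → trans (cong dn (pg here)) (sym (proj₂ (dns here))) ; (dn x) → trans (cong dn (pg (dn x))) (sym (proj₂ (dns (dn x))))
          ; (rt x) → trans (cong rt (qg x)) (sym (proj₂ (rts x))) }
    where
    notRt : ∀ w → g here ≢ rt w
    notRt w e′ with trans (sym e) e′
    ... | ()
    dns : (x : Vx (cons S1 nil)) → ∃ λ w → g (inFirst x) ≡ dn w
    dns here = v , e
    dns (dn x) with g (dn x) | subst (_⊑ g (dn x)) e (mono-⊑ ⊑-root)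
    ... | dn w | _ = w , refl
    rts = restIsRt notRt
    ls = restLabels notRt (dns ∘ dn)
    notHere : ∀ x → ¬ (g x ⊑ here)
    notHere here p with subst (_⊑ here) e p
    ... | ()
    notHere (dn x) p with subst (_⊑ here) (proj₂ (dns (dn x))) p
    ... | ()
    notHere (rt x) p with subst (_⊑ here) (proj₂ (rts x)) p
    ... | ()
    firstLabels : ∀ y → Σ (Fin n ⊎ Vx (cons S1 nil)) λ l → f (dn y) ≡ Sum.map₂ inFirst l
    firstLabels y with f (dn y) in e′
    ... | inj₁ a = inj₁ a , refl
    ... | inj₂ here = inj₂ here , refl
    ... | inj₂ (dn x) = inj₂ (dn x) , refl
    ... | inj₂ (rt x) with subst (_⊑ dn y) (proj₂ (rts x)) (least (dn y) e′)
    ...   | ()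
    first≺ : {x y : Vx (cons S1 nil)} → x ≺ y → inFirst x ≺ inFirst y
    first≺ here≺dn = here≺dn
    first≺ (≺-dn p) = ≺-dn p
    first-label : ∀ {l : Fin n ⊎ Vx (cons S1 nil)} {x} → Sum.map₂ inFirst l ≡ inj₂ (inFirst x) → l ≡ inj₂ x
    first-label {inj₂ here} {here} _ = refl
    first-label {inj₂ (dn _)} {dn _} refl = refl
    first-meet : (x y : Vx (cons S1 nil)) → ∃ λ z → meet x y ≡ just z × meet (inFirst x) (inFirst y) ≡ just (inFirst z)
    first-meet here here = here , refl , refl
    first-meet here (dn y) = here , refl , refl
    first-meet (dn x) here = here , refl , refl
    first-meet (dn x) (dn y) with meet x y
    ... | just z = dn z , refl , refl
    ... | nothing = here , refl , refl
    undn : ∀ {p : Maybe (Vx A)} {w} → just (maybe dn here p) ≡ just (dn {B = B} w) → p ≡ just w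
    undn {just _} refl = refl
    first-meets : ∀ x y → meet (dn {B = B} (proj₁ (dns x))) (dn (proj₁ (dns y))) ≡ Maybe.map g (meet (inFirst x) (inFirst y)) →
      meet (proj₁ (dns x)) (proj₁ (dns y)) ≡ Maybe.map (proj₁ ∘ dns) (meet x y)
    first-meets x y h with first-meet x y
    ... | z , e₁ , e₂ = trans (undn (trans h (trans (cong (Maybe.map g) e₂) (cong just (proj₂ (dns z)))))) (cong (Maybe.map (proj₁ ∘ dns)) (sym e₁))

  hitCase : g here ≡ here →
    (∀ {f′ : Vx A → Fin (suc n) ⊎ Vx S1} {g′} → IsRigid f′ g′ → Decoded f′ g′) →
    (∀ {f′ : Vx B → Fin n ⊎ Vx S2} {g′} → IsRigid f′ g′ → Decoded f′ g′) → Decoded f g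
  hitCase e ih₁ ih₂ =
    let p , pf , pg = ih₁ (restrict dn dn ageLetters (proj₁ ∘ aboveLabels) (proj₁ ∘ dns) dn⊑ dn≺ ≺-dn above-label
          (λ _ → refl) (proj₂ ∘ aboveLabels) (proj₂ ∘ dns) above-meets)
        q , qf , qg = ih₂ (restRigid rts ls)
    in hit p q
      , (λ { here → sym (trans (cong f (sym e)) (section here)) ; (dn y) → trans (cong ageLetters (pf y)) (sym (proj₂ (aboveLabels y)))
           ; (rt y) → trans (cong (Sum.map₂ rt) (qf y)) (sym (proj₂ (ls y))) })
      , λ { here → sym e ; (dn x) → trans (cong dn (pg x)) (sym (proj₂ (dns x))) ; (rt x) → trans (cong rt (qg x)) (sym (proj₂ (rts x))) }
    where
    notRt : ∀ w → g here ≢ rt w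
    notRt w e′ with trans (sym e) e′
    ... | ()
    dns : (x : Vx S1) → ∃ λ w → g (dn x) ≡ dn w
    dns x with g (dn x) | subst (_⊑ g (dn x)) e (mono-⊑ ⊑-root) | subst (_≺ g (dn x)) e (mono here≺dn)
    ... | dn w | _ | _ = w , refl
    rts = restIsRt notRt
    ls = restLabels notRt dns
    aboveLabels : ∀ y → Σ (Fin (suc n) ⊎ Vx S1) λ l → f (dn y) ≡ ageLetters l
    aboveLabels y with f (dn y) in e′
    ... | inj₁ a = inj₁ (suc a) , refl
    ... | inj₂ here = inj₁ zero , refl
    ... | inj₂ (dn x) = inj₂ x , refl
    ... | inj₂ (rt x) with subst (_⊑ dn y) (proj₂ (rts x)) (least (dn y) e′)
    ...   | ()
    above-label : ∀ {l : Fin (suc n) ⊎ Vx S1} {x} → ageLetters {S2 = S2} l ≡ inj₂ (dn x) → l ≡ inj₂ x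
    above-label {inj₁ zero} ()
    above-label {inj₁ (suc _)} ()
    above-label {inj₂ x} e = cong inj₂ (dn-injective (inj₂-injective e))
    above-meets : ∀ x y → meet (dn {B = B} (proj₁ (dns x))) (dn (proj₁ (dns y))) ≡ Maybe.map g (meet (dn x) (dn y)) →
      meet (proj₁ (dns x)) (proj₁ (dns y)) ≡ Maybe.map (proj₁ ∘ dns) (meet x y)
    above-meets x y h with meet (proj₁ (dns x)) (proj₁ (dns y)) | meet x y
    ... | p | just z = undn (trans h (cong just (proj₂ (dns z))))
      where
      undn : ∀ {p : Maybe (Vx A)} {w} → just (maybe dn here p) ≡ just (dn {B = B} w) → p ≡ just w
      undn {just _} refl = refl
    ... | p | nothing = unhere (trans h (cong just e))
      where
      unhere : ∀ {p : Maybe (Vx A)} → just (maybe dn here p) ≡ just (here {A} {B}) → p ≡ nothing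
      unhere {just _} ()
      unhere {nothing} _ = refl

-- The image of the first root is the first root of the source, above it, or in a later tree; this
-- dictates `hit`, `pass` or `skip`.
decode : (f : Vx T → Fin n ⊎ Vx S) (g : Vx S → Vx T) → IsRigid f g → Decoded f g
decode {S = nil} f g R = let t , h = labels (old ∘ f) in
  t , (λ y → trans (fF-lab t y) (trans (cong inj₁ (h y)) (old-eq (f y)))) , λ ()
  where
  old : Fin n ⊎ Vx nil → Fin n
  old (inj₁ a) = a
  old-eq : (l : Fin n ⊎ Vx nil) → inj₁ (old l) ≡ l
  old-eq (inj₁ a) = refl
decode {nil} {S = cons S1 S2} f g R with g here
... | ()
decode {cons A B} {S = cons S1 S2} f g R with g here in e
... | here = Decode.hitCase f g R e (decode _ _) (decode _ _)
... | dn v = Decode.passCase f g R e (decode _ _) (decode _ _)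
... | rt v = Decode.skipCase f g R e (decode _ _)

-- Connections as rigid surjections onto a tree with doubled nodes

-- A vertex below both `a` and `c` is comparable with `b`; it cannot be above `b`, hence lies below
-- it.
incomparable-meet : {a b c : Vx A} → ¬ (a ⊑ b) → ¬ (b ⊑ a) → b ⊑ c → meet a c ≡ meet a b
incomparable-meet {a = a} {b} {c} a⋢b b⋢a b⊑c with meet a c in ac | meet a b in ab
... | nothing | nothing = refl
... | nothing | just z with meet-greatest (meet-⊑ˡ a b ab) (⊑-trans (meet-⊑ʳ a b ab) b⊑c)
...   | _ , e , _ with trans (sym ac) e
...     | ()
incomparable-meet {a = a} {b} {c} a⋢b b⋢a b⊑c | just z | q with ⊑-chain (meet-⊑ʳ a c ac) b⊑c
... | inj₂ b⊑z = ⊥-elim (b⋢a (⊑-trans b⊑z (meet-⊑ˡ a c ac)))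
... | inj₁ z⊑b with meet-greatest (meet-⊑ˡ a c ac) z⊑b
...   | z₁ , e₁ , z⊑z₁ with meet-greatest (meet-⊑ˡ a b e₁) (⊑-trans (meet-⊑ʳ a b e₁) b⊑c)
...     | z₂ , e₂ , z₁⊑z₂ with trans (sym ac) e₂
...       | refl = trans (cong just (⊑-antisym z⊑z₁ z₁⊑z₂)) (trans (sym e₁) ab)

≺-asym : {v w : Vx A} → v ≺ w → ¬ (w ≺ v)
≺-asym p q = ≺-irrefl (≺-trans p q)

≺⇒≢ : {v w : Vx A} → v ≺ w → v ≢ w
≺⇒≢ p refl = ≺-irrefl p

⊑⇒⋡ : {v w : Vx A} → v ⊑ w → ¬ (w ≺ v)
⊑⇒⋡ p q = ≺-irrefl (⊑-≺-trans p q)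

⪯-≺-contra : {v w : Vx A} → v ⪯ w → ¬ (w ≺ v)
⪯-≺-contra (inj₁ refl) q = ≺-irrefl q
⪯-≺-contra (inj₂ p) q = ≺-asym p q

module _ {g : Vx S → Vx T} (E : IsEmb g) where
  open IsEmb E

  reflect-⊑ : ∀ {x y} → g x ⊑ g y → x ⊑ y
  reflect-⊑ {x} {y} p with meet x y in e | trans (sym (⊑⇒meet p)) (meets x y)
  ... | just z | h with injective (just-injective h)
  ...   | refl = meet-⊑ʳ x y e

  reflect-≺ : ∀ {x y} → g x ≺ g y → x ≺ y
  reflect-≺ {x} {y} p with ≺-total x y
  ... | inj₁ refl = ⊥-elim (≺-irrefl p)
  ... | inj₂ (inj₁ q) = q
  ... | inj₂ (inj₂ q) = ⊥-elim (≺-asym p (mono q))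

record IsConn (f : Vx T → Vx S) (g h : Vx S → Vx T) : Set where
  field
    rigid-g : IsRigid {n = 0} (inj₂ ∘ f) g
    emb-h : IsEmb h
    section-h : ∀ x → f (h x) ≡ x
    before : ∀ x y → y ≺ h x → f y ⪯ x

  module G = IsRigid rigid-g
  module H = IsEmb emb-h

  section-g : ∀ x → f (g x) ≡ x
  section-g x = inj₂-injective (G.section x)

  g⊑h : ∀ x → g x ⊑ h x
  g⊑h x = G.least (h x) (cong inj₂ (section-h x))

  g≺h : ∀ {x} → g x ≢ h x → g x ≺ h x
  g≺h {x} ne with ⊑⇒≡⊎≺ (g⊑h x)
  ... | inj₁ e = ⊥-elim (ne e)
  ... | inj₂ p = p

  -- If `g y` came before `h x`, then `before` would place `y`, which is `f (g y)`, at or before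
  -- `x`.
  h≺g : ∀ {x y} → x ≺ y → h x ≺ g y
  h≺g {x} {y} p with ≺-total (h x) (g y)
  ... | inj₁ e = ⊥-elim (≺⇒≢ p (trans (sym (section-h x)) (trans (cong f e) (section-g y))))
  ... | inj₂ (inj₁ q) = q
  ... | inj₂ (inj₂ q) = ⊥-elim (⪯-≺-contra (subst (_⪯ x) (section-g y) (before x (g y) q)) p)

  -- Both nodes lie below `h y` and are therefore comparable; `h≺g` tells which is lower.
  h⊑g : ∀ {x y} → x ⊑ y → x ≢ y → h x ⊑ g y
  h⊑g {x} {y} p ne with ⊑⇒≡⊎≺ p
  ... | inj₁ e = ⊥-elim (ne e)
  ... | inj₂ q with ⊑-chain (H.mono-⊑ p) (g⊑h y)
  ...   | inj₁ r = r
  ...   | inj₂ r = ⊥-elim (⊑⇒⋡ r (h≺g q))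

  -- This is why only nodes with at most one immediate successor can be marked.
  branching : ∀ {x c d} → meet c d ≡ just x → ¬ (c ⊑ d) → ¬ (d ⊑ c) → g x ≡ h x
  branching {x} {c} {d} e c⋢d d⋢c = just-injective (begin
    just (g x)        ≡⟨ cong (Maybe.map g) e ⟨
    Maybe.map g (meet c d) ≡⟨ G.meets c d ⟨
    meet (g c) (g d)  ≡⟨ incomparable-meet gc⋢gd gd⋢gc (g⊑h d) ⟨
    meet (g c) (h d)  ≡⟨ meet-comm (g c) (h d) ⟩
    meet (h d) (g c)  ≡⟨ incomparable-meet hd⋢gc gc⋢hd (g⊑h c) ⟨
    meet (h d) (h c)  ≡⟨ meet-comm (h d) (h c) ⟩
    meet (h c) (h d)  ≡⟨ H.meets c d ⟩
    Maybe.map h (meet c d) ≡⟨ cong (Maybe.map h) e ⟩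
    just (h x)        ∎)
    where
    open ≡-Reasoning
    gc⋢gd : ¬ (g c ⊑ g d)
    gc⋢gd p = c⋢d (reflect-⊑ G.emb p)
    gd⋢gc : ¬ (g d ⊑ g c)
    gd⋢gc p = d⋢c (reflect-⊑ G.emb p)
    gc⋢hd : ¬ (g c ⊑ h d)
    gc⋢hd p with ⊑-chain p (g⊑h d)
    ... | inj₁ q = gc⋢gd q
    ... | inj₂ q = gd⋢gc q
    hd⋢gc : ¬ (h d ⊑ g c)
    hd⋢gc p = gd⋢gc (⊑-trans (g⊑h d) p)

-- Doubling the marked nodes of a forest

data AtMost1 : Fo → Set where
  none : AtMost1 nil
  one : AtMost1 (cons A nil)

atMost1? : ∀ A → Dec (AtMost1 A)
atMost1? nil = yes none
atMost1? (cons A nil) = yes one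
atMost1? (cons A (cons B C)) = no λ ()

meet-just : AtMost1 A → (x y : Vx A) → ∃ λ z → meet x y ≡ just z
meet-just one here here = here , refl
meet-just one here (dn y) = here , refl
meet-just one (dn x) here = here , refl
meet-just one (dn x) (dn y) = maybe dn here (meet x y) , refl

data Marks : Fo → Set where
  nil : Marks nil
  off : Marks A → Marks B → Marks (cons A B)
  on : AtMost1 A → Marks A → Marks B → Marks (cons A B)

marked : Marks S → Vx S → Bool
marked (off L M) here = false
marked (on _ L M) here = true
marked (off L M) (dn x) = marked L x
marked (on _ L M) (dn x) = marked L x
marked (off L M) (rt x) = marked M x
marked (on _ L M) (rt x) = marked M x

above : Vx S → Fo
above {cons A B} here = A
above (dn x) = above x
above (rt x) = above x

-- A request to mark a branching node is dropped; the hypothesis of `marked-mark` excludes such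
-- requests.
mark : (Vx S → Bool) → Marks S
mark {nil} P = nil
mark {cons A B} P with P here | atMost1? A
... | true | yes a = on a (mark (P ∘ dn)) (mark (P ∘ rt))
... | _ | _ = off (mark (P ∘ dn)) (mark (P ∘ rt))

marked-mark : (P : Vx S → Bool) → (∀ x → P x ≡ true → AtMost1 (above x)) → ∀ x → marked (mark P) x ≡ P x
marked-mark {cons A B} P h x with P here in e | atMost1? A
marked-mark {cons A B} P h here | true | yes a = sym e
marked-mark {cons A B} P h (dn x) | true | yes a = marked-mark (P ∘ dn) (h ∘ dn) x
marked-mark {cons A B} P h (rt x) | true | yes a = marked-mark (P ∘ rt) (h ∘ rt) x
marked-mark {cons A B} P h x | true | no na = ⊥-elim (na (h here e))
marked-mark {cons A B} P h here | false | _ = sym e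
marked-mark {cons A B} P h (dn x) | false | _ = marked-mark (P ∘ dn) (h ∘ dn) x
marked-mark {cons A B} P h (rt x) | false | _ = marked-mark (P ∘ rt) (h ∘ rt) x

-- Each marked node x is doubled: it is replaced by the chain ι x, ι′ x.
double : Marks S → Fo
double nil = nil
double (off L M) = cons (double L) (double M)
double (on _ L M) = cons (cons (double L) nil) (double M)

ι ι′ : (M : Marks S) → Vx S → Vx (double M)
ι (off L M) here = here
ι (off L M) (dn x) = dn (ι L x)
ι (off L M) (rt x) = rt (ι M x)
ι (on _ L M) here = here
ι (on _ L M) (dn x) = dn (dn (ι L x))
ι (on _ L M) (rt x) = rt (ι M x)
ι′ (off L M) here = here
ι′ (off L M) (dn x) = dn (ι′ L x)
ι′ (off L M) (rt x) = rt (ι′ M x)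
ι′ (on _ L M) here = dn here
ι′ (on _ L M) (dn x) = dn (dn (ι′ L x))
ι′ (on _ L M) (rt x) = rt (ι′ M x)

π : (M : Marks S) → Vx (double M) → Vx S
π (off L M) here = here
π (off L M) (dn z) = dn (π L z)
π (off L M) (rt z) = rt (π M z)
π (on _ L M) here = here
π (on _ L M) (dn here) = here
π (on _ L M) (dn (dn z)) = dn (π L z)
π (on _ L M) (rt z) = rt (π M z)

π-ι : (M : Marks S) (x : Vx S) → π M (ι M x) ≡ x
π-ι (off L M) here = refl
π-ι (off L M) (dn x) = cong dn (π-ι L x)
π-ι (off L M) (rt x) = cong rt (π-ι M x)
π-ι (on _ L M) here = refl
π-ι (on _ L M) (dn x) = cong dn (π-ι L x)
π-ι (on _ L M) (rt x) = cong rt (π-ι M x)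

π-ι′ : (M : Marks S) (x : Vx S) → π M (ι′ M x) ≡ x
π-ι′ (off L M) here = refl
π-ι′ (off L M) (dn x) = cong dn (π-ι′ L x)
π-ι′ (off L M) (rt x) = cong rt (π-ι′ M x)
π-ι′ (on _ L M) here = refl
π-ι′ (on _ L M) (dn x) = cong dn (π-ι′ L x)
π-ι′ (on _ L M) (rt x) = cong rt (π-ι′ M x)

ι-π : (M : Marks S) (z : Vx (double M)) → ι M (π M z) ⊑ z
ι-π (off L M) here = ⊑-here
ι-π (off L M) (dn z) = ⊑-dn (ι-π L z)
ι-π (off L M) (rt z) = ⊑-rt (ι-π M z)
ι-π (on _ L M) here = ⊑-here
ι-π (on _ L M) (dn here) = ⊑-root
ι-π (on _ L M) (dn (dn z)) = ⊑-dn (⊑-dn (ι-π L z))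
ι-π (on _ L M) (rt z) = ⊑-rt (ι-π M z)

ι⊑ι′ : (M : Marks S) (x : Vx S) → ι M x ⊑ ι′ M x
ι⊑ι′ M x = subst (λ y → ι M y ⊑ ι′ M x) (π-ι′ M x) (ι-π M (ι′ M x))

⪯-dn : {v w : Vx A} → v ⪯ w → dn {B = B} v ⪯ dn w
⪯-dn = Sum.map (cong dn) ≺-dn

⪯-rt : {v w : Vx B} → v ⪯ w → rt {A = A} v ⪯ rt w
⪯-rt = Sum.map (cong rt) ≺-rt

π-mono : (M : Marks S) {z w : Vx (double M)} → z ≺ w → π M z ⪯ π M w
π-mono (off L M) here≺dn = inj₂ here≺dn
π-mono (off L M) here≺rt = inj₂ here≺rt
π-mono (off L M) (≺-dn p) = ⪯-dn (π-mono L p)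
π-mono (off L M) dn≺rt = inj₂ dn≺rt
π-mono (off L M) (≺-rt p) = ⪯-rt (π-mono M p)
π-mono (on _ L M) {w = dn here} here≺dn = inj₁ refl
π-mono (on _ L M) {w = dn (dn _)} here≺dn = inj₂ here≺dn
π-mono (on _ L M) here≺rt = inj₂ here≺rt
π-mono (on _ L M) (≺-dn here≺dn) = inj₂ here≺dn
π-mono (on _ L M) (≺-dn (≺-dn p)) = ⪯-dn (π-mono L p)
π-mono (on _ L M) {z = dn here} dn≺rt = inj₂ here≺rt
π-mono (on _ L M) {z = dn (dn _)} dn≺rt = inj₂ dn≺rt
π-mono (on _ L M) (≺-rt p) = ⪯-rt (π-mono M p)

ι-mono : (M : Marks S) {x y : Vx S} → x ≺ y → ι M x ≺ ι M y
ι-mono (off L M) here≺dn = here≺dn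
ι-mono (off L M) here≺rt = here≺rt
ι-mono (off L M) (≺-dn p) = ≺-dn (ι-mono L p)
ι-mono (off L M) dn≺rt = dn≺rt
ι-mono (off L M) (≺-rt p) = ≺-rt (ι-mono M p)
ι-mono (on _ L M) here≺dn = here≺dn
ι-mono (on _ L M) here≺rt = here≺rt
ι-mono (on _ L M) (≺-dn p) = ≺-dn (≺-dn (ι-mono L p))
ι-mono (on _ L M) dn≺rt = dn≺rt
ι-mono (on _ L M) (≺-rt p) = ≺-rt (ι-mono M p)

ι′-mono : (M : Marks S) {x y : Vx S} → x ≺ y → ι′ M x ≺ ι′ M y
ι′-mono (off L M) here≺dn = here≺dn
ι′-mono (off L M) here≺rt = here≺rt
ι′-mono (off L M) (≺-dn p) = ≺-dn (ι′-mono L p)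
ι′-mono (off L M) dn≺rt = dn≺rt
ι′-mono (off L M) (≺-rt p) = ≺-rt (ι′-mono M p)
ι′-mono (on _ L M) here≺dn = ≺-dn here≺dn
ι′-mono (on _ L M) here≺rt = dn≺rt
ι′-mono (on _ L M) (≺-dn p) = ≺-dn (≺-dn (ι′-mono L p))
ι′-mono (on _ L M) dn≺rt = dn≺rt
ι′-mono (on _ L M) (≺-rt p) = ≺-rt (ι′-mono M p)

-- At a marked node `AtMost1` gives two vertices above it a meet that is also above it. If they had
-- none there, their images would meet in the second copy of the node, while `ι` picks the first.
ι-meets : (M : Marks S) (x y : Vx S) → meet (ι M x) (ι M y) ≡ Maybe.map (ι M) (meet x y)
ι-meets (off L M) here here = refl
ι-meets (off L M) here (dn y) = refl
ι-meets (off L M) here (rt y) = refl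
ι-meets (off L M) (dn x) here = refl
ι-meets (off L M) (dn x) (dn y) rewrite ι-meets L x y with meet x y
... | just _ = refl
... | nothing = refl
ι-meets (off L M) (dn x) (rt y) = refl
ι-meets (off L M) (rt x) here = refl
ι-meets (off L M) (rt x) (dn y) = refl
ι-meets (off L M) (rt x) (rt y) rewrite ι-meets M x y with meet x y
... | just _ = refl
... | nothing = refl
ι-meets (on _ L M) here here = refl
ι-meets (on _ L M) here (dn y) = refl
ι-meets (on _ L M) here (rt y) = refl
ι-meets (on _ L M) (dn x) here = refl
ι-meets (on a L M) (dn x) (dn y) rewrite ι-meets L x y with meet x y | meet-just a x y
... | .(just z) | z , refl = refl
ι-meets (on _ L M) (dn x) (rt y) = refl
ι-meets (on _ L M) (rt x) here = refl
ι-meets (on _ L M) (rt x) (dn y) = refl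
ι-meets (on _ L M) (rt x) (rt y) rewrite ι-meets M x y with meet x y
... | just _ = refl
... | nothing = refl

ι′-meets : (M : Marks S) (x y : Vx S) → meet (ι′ M x) (ι′ M y) ≡ Maybe.map (ι′ M) (meet x y)
ι′-meets (off L M) here here = refl
ι′-meets (off L M) here (dn y) = refl
ι′-meets (off L M) here (rt y) = refl
ι′-meets (off L M) (dn x) here = refl
ι′-meets (off L M) (dn x) (dn y) rewrite ι′-meets L x y with meet x y
... | just _ = refl
... | nothing = refl
ι′-meets (off L M) (dn x) (rt y) = refl
ι′-meets (off L M) (rt x) here = refl
ι′-meets (off L M) (rt x) (dn y) = refl
ι′-meets (off L M) (rt x) (rt y) rewrite ι′-meets M x y with meet x y
... | just _ = refl
... | nothing = refl
ι′-meets (on _ L M) here here = refl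
ι′-meets (on _ L M) here (dn y) = refl
ι′-meets (on _ L M) here (rt y) = refl
ι′-meets (on _ L M) (dn x) here = refl
ι′-meets (on a L M) (dn x) (dn y) rewrite ι′-meets L x y with meet x y | meet-just a x y
... | .(just z) | z , refl = refl
ι′-meets (on _ L M) (dn x) (rt y) = refl
ι′-meets (on _ L M) (rt x) here = refl
ι′-meets (on _ L M) (rt x) (dn y) = refl
ι′-meets (on _ L M) (rt x) (rt y) rewrite ι′-meets M x y with meet x y
... | just _ = refl
... | nothing = refl

emb-ι : (M : Marks S) → IsEmb (ι M)
emb-ι M = record { meets = ι-meets M ; mono = ι-mono M }

emb-ι′ : (M : Marks S) → IsEmb (ι′ M)
emb-ι′ M = record { meets = ι′-meets M ; mono = ι′-mono M }

emb-∘ : {g : Vx T → Vx V} {h : Vx S → Vx T} → IsEmb g → IsEmb h → IsEmb (g ∘ h)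
emb-∘ {g = g} {h} G H = record
  { meets = λ x y → trans (IsEmb.meets G (h x) (h y)) (trans (cong (Maybe.map g) (IsEmb.meets H x y)) (sym (map-∘M (meet x y))))
  ; mono = IsEmb.mono G ∘ IsEmb.mono H }
  where
  map-∘M : ∀ p → Maybe.map (g ∘ h) p ≡ Maybe.map g (Maybe.map h p)
  map-∘M (just _) = refl
  map-∘M nothing = refl

unmarked : (M : Marks S) (x : Vx S) → marked M x ≡ false → ι M x ≡ ι′ M x
unmarked (off L M) here e = refl
unmarked (off L M) (dn x) e = cong dn (unmarked L x e)
unmarked (off L M) (rt x) e = cong rt (unmarked M x e)
unmarked (on _ L M) (dn x) e = cong (λ z → dn (dn z)) (unmarked L x e)
unmarked (on _ L M) (rt x) e = cong rt (unmarked M x e)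

isNew : (M : Marks S) → Vx (double M) → Bool
isNew (off L M) here = false
isNew (off L M) (dn z) = isNew L z
isNew (off L M) (rt z) = isNew M z
isNew (on _ L M) here = false
isNew (on _ L M) (dn here) = true
isNew (on _ L M) (dn (dn z)) = isNew L z
isNew (on _ L M) (rt z) = isNew M z

isNew-ι : (M : Marks S) (x : Vx S) → isNew M (ι M x) ≡ false
isNew-ι (off L M) here = refl
isNew-ι (off L M) (dn x) = isNew-ι L x
isNew-ι (off L M) (rt x) = isNew-ι M x
isNew-ι (on _ L M) here = refl
isNew-ι (on _ L M) (dn x) = isNew-ι L x
isNew-ι (on _ L M) (rt x) = isNew-ι M x

isNew-ι′ : (M : Marks S) (x : Vx S) → isNew M (ι′ M x) ≡ marked M x
isNew-ι′ (off L M) here = refl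
isNew-ι′ (off L M) (dn x) = isNew-ι′ L x
isNew-ι′ (off L M) (rt x) = isNew-ι′ M x
isNew-ι′ (on _ L M) here = refl
isNew-ι′ (on _ L M) (dn x) = isNew-ι′ L x
isNew-ι′ (on _ L M) (rt x) = isNew-ι′ M x

data View (M : Marks S) : Vx (double M) → Set where
  old : ∀ x → View M (ι M x)
  new : ∀ x → marked M x ≡ true → View M (ι′ M x)

view : (M : Marks S) (z : Vx (double M)) → View M z
view (off L M) here = old here
view (off L M) (dn z) with view L z
... | old x = old (dn x)
... | new x e = new (dn x) e
view (off L M) (rt z) with view M z
... | old x = old (rt x)
... | new x e = new (rt x) e
view (on _ L M) here = old here
view (on _ L M) (dn here) = new here refl
view (on _ L M) (dn (dn z)) with view L z
... | old x = old (dn x)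
... | new x e = new (dn x) e
view (on _ L M) (rt z) with view M z
... | old x = old (rt x)
... | new x e = new (rt x) e

ι′⊑ι : (M : Marks S) {x y : Vx S} → x ⊑ y → x ≢ y → ι′ M x ⊑ ι M y
ι′⊑ι (off L M) ⊑-here ne = ⊥-elim (ne refl)
ι′⊑ι (off L M) ⊑-root ne = ⊑-root
ι′⊑ι (off L M) (⊑-dn p) ne = ⊑-dn (ι′⊑ι L p (ne ∘ cong dn))
ι′⊑ι (off L M) (⊑-rt p) ne = ⊑-rt (ι′⊑ι M p (ne ∘ cong rt))
ι′⊑ι (on _ L M) ⊑-here ne = ⊥-elim (ne refl)
ι′⊑ι (on _ L M) ⊑-root ne = ⊑-dn ⊑-root
ι′⊑ι (on _ L M) (⊑-dn p) ne = ⊑-dn (⊑-dn (ι′⊑ι L p (ne ∘ cong dn)))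
ι′⊑ι (on _ L M) (⊑-rt p) ne = ⊑-rt (ι′⊑ι M p (ne ∘ cong rt))

target : Fin 0 ⊎ Vx S → Vx S
target (inj₂ x) = x

inj₂-target : (l : Fin 0 ⊎ Vx S) → inj₂ (target l) ≡ l
inj₂-target (inj₂ x) = refl

encode-conn : (M : Marks S) (t : F 0 T (double M)) → IsConn (π M ∘ target ∘ fF t) (gF t ∘ ι M) (gF t ∘ ι′ M)
encode-conn M t = record
  { rigid-g = record
    { emb = emb-∘ R.emb (emb-ι M)
    ; section = λ x → cong inj₂ (trans (cong (π M ∘ target) (R.section (ι M x))) (π-ι M x))
    ; least = λ { y refl → ⊑-trans (R.mono-⊑ (ι-π M _)) (least′ y) } }
  ; emb-h = emb-∘ R.emb (emb-ι′ M)
  ; section-h = λ x → trans (cong (π M ∘ target) (R.section (ι′ M x))) (π-ι′ M x)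
  ; before = before
  }
  where
  module R = IsRigid (rigid t)
  least′ : ∀ y → gF t (target (fF t y)) ⊑ y
  least′ y = R.least y (sym (inj₂-target (fF t y)))
  before : ∀ x y → y ≺ gF t (ι′ M x) → π M (target (fF t y)) ⪯ x
  before x y p with ≺-total (target (fF t y)) (ι′ M x)
  ... | inj₁ e = inj₁ (trans (cong (π M) e) (π-ι′ M x))
  ... | inj₂ (inj₁ q) = subst (π M (target (fF t y)) ⪯_) (π-ι′ M x) (π-mono M q)
  -- Here `y` would come before the least node sent to its own image.
  ... | inj₂ (inj₂ q) = ⊥-elim (⊑⇒⋡ (least′ y) (≺-trans p (R.mono q)))

module _ {f : Vx T → Vx S} {g h : Vx S → Vx T} (C : IsConn f g h) (M : Marks S)
  (on≢ : ∀ x → marked M x ≡ true → g x ≢ h x) (off≡ : ∀ x → marked M x ≡ false → g x ≡ h x) where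
  open IsConn C

  private
    select : Bool → Vx S → Vx T
    select true = h
    select false = g

    -- Among the nodes sent to a marked `x`, exactly those at or above `h x` go to the second copy,
    -- which makes `h x` the least of them.
    f′ : Vx T → Vx (double M)
    f′ y with h (f y) ⊑? y
    ... | yes _ = ι′ M (f y)
    ... | no _ = ι M (f y)

    g′ : Vx (double M) → Vx T
    g′ z = select (isNew M z) (π M z)

    g′-ι : ∀ x → g′ (ι M x) ≡ g x
    g′-ι x = cong₂ select (isNew-ι M x) (π-ι M x)

    g′-ι′ : ∀ x → g′ (ι′ M x) ≡ h x
    g′-ι′ x with marked M x in e
    ... | true = cong₂ select (trans (isNew-ι′ M x) e) (π-ι′ M x)
    ... | false = trans (cong₂ select (trans (isNew-ι′ M x) e) (π-ι′ M x)) (off≡ x e)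

    section′ : ∀ z → f′ (g′ z) ≡ z
    section′ z with view M z
    section′ .(ι M x) | old x rewrite g′-ι x with h (f (g x)) ⊑? g x
    ... | no _ = cong (ι M) (section-g x)
    ... | yes p rewrite section-g x with marked M x in e
    ...   | true = ⊥-elim (on≢ x e (⊑-antisym (g⊑h x) p))
    ...   | false = sym (unmarked M x e)
    section′ .(ι′ M x) | new x e rewrite g′-ι′ x with h (f (h x)) ⊑? h x
    ... | yes _ = cong (ι′ M) (section-h x)
    ... | no np = ⊥-elim (np (⊑-reflexive (cong h (section-h x))))

    least′ : ∀ y {z} → f′ y ≡ z → g′ z ⊑ y
    least′ y refl with h (f y) ⊑? y
    ... | yes p = subst (_⊑ y) (sym (g′-ι′ (f y))) p
    ... | no _ = subst (_⊑ y) (sym (g′-ι (f y))) (G.least y refl)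

    mono′ : ∀ {z w} → z ≺ w → g′ z ≺ g′ w
    mono′ {z} {w} p with view M z | view M w
    ... | old x | old y rewrite g′-ι x | g′-ι y = G.mono (reflect-≺ (emb-ι M) p)
    ... | new x _ | new y _ rewrite g′-ι′ x | g′-ι′ y = H.mono (reflect-≺ (emb-ι′ M) p)
    ... | old x | new y e rewrite g′-ι x | g′-ι′ y with π-mono M p
    ...   | q rewrite π-ι M x | π-ι′ M y with q
    ...     | inj₁ refl = g≺h (on≢ y e)
    ...     | inj₂ r = ≺-⊑-trans (G.mono r) (g⊑h y)
    mono′ {z} {w} p | new x e | old y rewrite g′-ι′ x | g′-ι y with π-mono M p
    ...   | q rewrite π-ι′ M x | π-ι M y with q
    ...     | inj₁ refl = ⊥-elim (⊑⇒⋡ (ι⊑ι′ M x) p)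
    ...     | inj₂ r = h≺g r

    map-cong′ : ∀ {X Y Z : Set} {a : Y → Z} {b : X → Y} {c : X → Z} → (∀ x → a (b x) ≡ c x) →
      ∀ p → Maybe.map c p ≡ Maybe.map a (Maybe.map b p)
    map-cong′ e (just x) = cong just (sym (e x))
    map-cong′ e nothing = refl

    -- If `x` and `y` are comparable, so are their images, by `h⊑g` in the case where `y` is
    -- strictly below `x`. If not, replacing `h y` by `g y` leaves the meet unchanged, and likewise
    -- for the two copies of `y`.
    mixed : ∀ x y → marked M y ≡ true → meet (g x) (h y) ≡ Maybe.map g′ (meet (ι M x) (ι′ M y))
    mixed x y e with x ⊑? y | y ⊑? x
    ... | yes p | _ = trans (⊑⇒meet (⊑-trans (G.mono-⊑ p) (g⊑h y)))
      (trans (cong just (sym (g′-ι x))) (cong (Maybe.map g′) (sym (⊑⇒meet (⊑-trans (IsEmb.mono-⊑ (emb-ι M) p) (ι⊑ι′ M y))))))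
    ... | no np | yes q = trans (trans (meet-comm (g x) (h y)) (⊑⇒meet (h⊑g q ne)))
      (trans (cong just (sym (g′-ι′ y))) (cong (Maybe.map g′) (sym (trans (meet-comm (ι M x) (ι′ M y)) (⊑⇒meet (ι′⊑ι M q ne))))))
      where
      ne : y ≢ x
      ne refl = np ⊑-refl
    ... | no np | no nq = begin
      meet (g x) (h y)                          ≡⟨ incomparable-meet (np ∘ reflect-⊑ G.emb) (nq ∘ reflect-⊑ G.emb) (g⊑h y) ⟩
      meet (g x) (g y)                          ≡⟨ G.meets x y ⟩
      Maybe.map g (meet x y)                    ≡⟨ map-cong′ g′-ι (meet x y) ⟩
      Maybe.map g′ (Maybe.map (ι M) (meet x y)) ≡⟨ cong (Maybe.map g′) (ι-meets M x y) ⟨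
      Maybe.map g′ (meet (ι M x) (ι M y))       ≡⟨ cong (Maybe.map g′) (incomparable-meet (np ∘ reflect-⊑ (emb-ι M)) (nq ∘ reflect-⊑ (emb-ι M)) (ι⊑ι′ M y)) ⟨
      Maybe.map g′ (meet (ι M x) (ι′ M y))      ∎
      where open ≡-Reasoning

    meets′ : ∀ z w → meet (g′ z) (g′ w) ≡ Maybe.map g′ (meet z w)
    meets′ z w with view M z | view M w
    ... | old x | old y rewrite g′-ι x | g′-ι y = trans (G.meets x y)
      (trans (map-cong′ g′-ι (meet x y)) (cong (Maybe.map g′) (sym (ι-meets M x y))))
    ... | new x _ | new y _ rewrite g′-ι′ x | g′-ι′ y = trans (H.meets x y)
      (trans (map-cong′ g′-ι′ (meet x y)) (cong (Maybe.map g′) (sym (ι′-meets M x y))))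
    ... | old x | new y e rewrite g′-ι x | g′-ι′ y = mixed x y e
    ... | new x e | old y rewrite g′-ι′ x | g′-ι y = trans (meet-comm (h x) (g y))
      (trans (mixed y x e) (cong (Maybe.map g′) (meet-comm (ι M y) (ι′ M x))))

  -- The inverse of `encode-conn`, with marks exactly where `g` and `h` differ.
  decode-conn : Σ (F 0 T (double M)) λ t →
    (∀ y → π M (target (fF t y)) ≡ f y) × (∀ x → gF t (ι M x) ≡ g x) × (∀ x → gF t (ι′ M x) ≡ h x)
  decode-conn =
    let t , hf , hg = decode (inj₂ ∘ f′) g′ record
          { emb = record { meets = meets′ ; mono = mono′ }
          ; section = λ z → cong inj₂ (section′ z)
          ; least = λ y e → least′ y (inj₂-injective e) }
    in t , (λ y → trans (cong (π M ∘ target) (hf y)) (π-f′ y))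
      , (λ x → trans (hg (ι M x)) (g′-ι x)) , (λ x → trans (hg (ι′ M x)) (g′-ι′ x))
    where
    π-f′ : ∀ y → π M (f′ y) ≡ f y
    π-f′ y with h (f y) ⊑? y
    ... | yes _ = π-ι′ M (f y)
    ... | no _ = π-ι M (f y)

-- Finite ordered trees and forests

data Top : Vx A → Set where
  here : Top (here {A} {B})
  rt : {v : Vx B} → Top v → Top (rt {A = A} v)

data Child : Vx A → Vx A → Set where
  c-here : {v : Vx A} → Top v → Child here (dn {B = B} v)
  c-dn : {v w : Vx A} → Child v w → Child (dn {B = B} v) (dn w)
  c-rt : {v w : Vx B} → Child v w → Child (rt {A = A} v) (rt w)

child-⊑ : {v w : Vx A} → Child v w → v ⊑ w
child-⊑ (c-here _) = ⊑-root
child-⊑ (c-dn c) = ⊑-dn (child-⊑ c)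
child-⊑ (c-rt c) = ⊑-rt (child-⊑ c)

child-≺ : {v w : Vx A} → Child v w → v ≺ w
child-≺ (c-here _) = here≺dn
child-≺ (c-dn c) = ≺-dn (child-≺ c)
child-≺ (c-rt c) = ≺-rt (child-≺ c)

top-minimal : {u w : Vx A} → Top w → u ⊑ w → u ≡ w
top-minimal here ⊑-here = refl
top-minimal (rt t) (⊑-rt p) = cong rt (top-minimal t p)

child-below : {u v w : Vx A} → Child v w → u ⊑ w → u ≡ w ⊎ u ⊑ v
child-below (c-here t) ⊑-root = inj₂ ⊑-here
child-below (c-here t) (⊑-dn p) = inj₁ (cong dn (top-minimal t p))
child-below (c-dn c) ⊑-root = inj₂ ⊑-root
child-below (c-dn c) (⊑-dn p) = Sum.map (cong dn) ⊑-dn (child-below c p)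
child-below (c-rt c) (⊑-rt p) = Sum.map (cong rt) ⊑-rt (child-below c p)

child-unique : {v v′ w : Vx A} → Child v w → Child v′ w → v ≡ v′
child-unique c c′ with child-below c (child-⊑ c′) | child-below c′ (child-⊑ c)
... | inj₁ e | _ = ⊥-elim (≺⇒≢ (child-≺ c′) e)
... | inj₂ _ | inj₁ e = ⊥-elim (≺⇒≢ (child-≺ c) e)
... | inj₂ p | inj₂ q = ⊑-antisym q p

top-below : (w : Vx A) → ∃ λ v → Top v × v ⊑ w
top-below here = here , here , ⊑-here
top-below (dn w) = here , here , ⊑-root
top-below (rt w) with top-below w
... | v , t , p = rt v , rt t , ⊑-rt p

child-toward : {z v : Vx A} → z ⊑ v → z ≢ v → ∃ λ c → Child z c × c ⊑ v
child-toward ⊑-here ne = ⊥-elim (ne refl)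
child-toward {v = dn w} ⊑-root ne with top-below w
... | v , t , p = dn v , c-here t , ⊑-dn p
child-toward (⊑-dn p) ne with child-toward p (ne ∘ cong dn)
... | c , h , q = dn c , c-dn h , ⊑-dn q
child-toward (⊑-rt p) ne with child-toward p (ne ∘ cong rt)
... | c , h , q = rt c , c-rt h , ⊑-rt q

-- The vertices above `a` form an interval of the depth-first order that starts at `a`.
≺-subtree : {a b v : Vx A} → a ≺ b → ¬ (a ⊑ b) → a ⊑ v → v ≺ b
≺-subtree here≺dn n q = ⊥-elim (n ⊑-root)
≺-subtree here≺rt n ⊑-here = here≺rt
≺-subtree here≺rt n ⊑-root = dn≺rt
≺-subtree (≺-dn p) n (⊑-dn q) = ≺-dn (≺-subtree p (n ∘ ⊑-dn) q)
≺-subtree dn≺rt n (⊑-dn q) = dn≺rt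
≺-subtree (≺-rt p) n (⊑-rt q) = ≺-rt (≺-subtree p (n ∘ ⊑-rt) q)

siblings-⋢ : {z a b : Vx A} → Child z a → Child z b → a ≢ b → ¬ (a ⊑ b)
siblings-⋢ ca cb ne p with child-below cb p
... | inj₁ e = ne e
... | inj₂ q = ⊑⇒⋡ q (child-≺ ca)

siblings-≺ : {z a b v w : Vx A} → Child z a → Child z b → a ≺ b → a ⊑ v → b ⊑ w → v ≺ w
siblings-≺ ca cb a≺b p q = ≺-⊑-trans (≺-subtree a≺b (siblings-⋢ ca cb (≺⇒≢ a≺b)) p) q

-- Trees on Fin (suc n) are built by repeatedly adding the node fromℕ n, a leaf and the last immediate
-- successor of its parent.
snoc : Fo → Fo
snoc nil = cons nil nil
snoc (cons A B) = cons A (snoc B)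

oldS : Vx A → Vx (snoc A)
oldS here = here
oldS (dn v) = dn v
oldS (rt v) = rt (oldS v)

newS : ∀ A → Vx (snoc A)
newS nil = here
newS (cons A B) = rt (newS B)

ins : (A : Fo) → Vx A → Fo
ins (cons A B) here = cons (snoc A) B
ins (cons A B) (dn p) = cons (ins A p) B
ins (cons A B) (rt p) = cons A (ins B p)

old-in : (p : Vx A) → Vx A → Vx (ins A p)
old-in here here = here
old-in here (dn v) = dn (oldS v)
old-in here (rt v) = rt v
old-in (dn p) here = here
old-in (dn p) (dn v) = dn (old-in p v)
old-in (dn p) (rt v) = rt v
old-in (rt p) here = here
old-in (rt p) (dn v) = dn v
old-in (rt p) (rt v) = rt (old-in p v)

new-in : (p : Vx A) → Vx (ins A p)
new-in {cons A B} here = dn (newS A)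
new-in (dn p) = dn (new-in p)
new-in (rt p) = rt (new-in p)

unoldS : Vx (snoc A) → Maybe (Vx A)
unoldS {nil} _ = nothing
unoldS {cons A B} here = just here
unoldS {cons A B} (dn w) = just (dn w)
unoldS {cons A B} (rt w) = Maybe.map rt (unoldS w)

unold : (p : Vx A) → Vx (ins A p) → Maybe (Vx A)
unold here here = just here
unold here (dn w) = Maybe.map dn (unoldS w)
unold here (rt w) = just (rt w)
unold (dn p) here = just here
unold (dn p) (dn w) = Maybe.map dn (unold p w)
unold (dn p) (rt w) = just (rt w)
unold (rt p) here = just here
unold (rt p) (dn w) = just (dn w)
unold (rt p) (rt w) = Maybe.map rt (unold p w)

unoldS-old : (v : Vx A) → unoldS (oldS v) ≡ just v
unoldS-old here = refl
unoldS-old (dn v) = refl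
unoldS-old (rt v) = cong (Maybe.map rt) (unoldS-old v)

unoldS-new : ∀ A → unoldS (newS A) ≡ nothing
unoldS-new nil = refl
unoldS-new (cons A B) = cong (Maybe.map rt) (unoldS-new B)

unold-old : (p v : Vx A) → unold p (old-in p v) ≡ just v
unold-old here here = refl
unold-old here (dn v) = cong (Maybe.map dn) (unoldS-old v)
unold-old here (rt v) = refl
unold-old (dn p) here = refl
unold-old (dn p) (dn v) = cong (Maybe.map dn) (unold-old p v)
unold-old (dn p) (rt v) = refl
unold-old (rt p) here = refl
unold-old (rt p) (dn v) = refl
unold-old (rt p) (rt v) = cong (Maybe.map rt) (unold-old p v)

unold-new : (p : Vx A) → unold p (new-in p) ≡ nothing
unold-new {cons A B} here = cong (Maybe.map dn) (unoldS-new A)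
unold-new (dn p) = cong (Maybe.map dn) (unold-new p)
unold-new (rt p) = cong (Maybe.map rt) (unold-new p)

reoldS : (w : Vx (snoc A)) → maybe oldS (newS A) (unoldS w) ≡ w
reoldS {nil} here = refl
reoldS {cons A B} here = refl
reoldS {cons A B} (dn w) = refl
reoldS {cons A B} (rt w) with unoldS w | reoldS w
... | just v | e = cong rt e
... | nothing | e = cong rt e

reold : (p : Vx A) (w : Vx (ins A p)) → maybe (old-in p) (new-in p) (unold p w) ≡ w
reold here here = refl
reold here (dn w) with unoldS w | reoldS w
... | just v | e = cong dn e
... | nothing | e = cong dn e
reold here (rt w) = refl
reold (dn p) here = refl
reold (dn p) (dn w) with unold p w | reold p w
... | just v | e = cong dn e
... | nothing | e = cong dn e
reold (dn p) (rt w) = refl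
reold (rt p) here = refl
reold (rt p) (dn w) = refl
reold (rt p) (rt w) with unold p w | reold p w
... | just v | e = cong rt e
... | nothing | e = cong rt e

oldS-⊑ : {v w : Vx A} → v ⊑ w → oldS v ⊑ oldS w
oldS-⊑ ⊑-here = ⊑-here
oldS-⊑ ⊑-root = ⊑-root
oldS-⊑ (⊑-dn p) = ⊑-dn p
oldS-⊑ (⊑-rt p) = ⊑-rt (oldS-⊑ p)

old-⊑ : (p : Vx A) {v w : Vx A} → v ⊑ w → old-in p v ⊑ old-in p w
old-⊑ here ⊑-here = ⊑-here
old-⊑ here ⊑-root = ⊑-root
old-⊑ here (⊑-dn q) = ⊑-dn (oldS-⊑ q)
old-⊑ here (⊑-rt q) = ⊑-rt q
old-⊑ (dn p) ⊑-here = ⊑-here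
old-⊑ (dn p) ⊑-root = ⊑-root
old-⊑ (dn p) (⊑-dn q) = ⊑-dn (old-⊑ p q)
old-⊑ (dn p) (⊑-rt q) = ⊑-rt q
old-⊑ (rt p) ⊑-here = ⊑-here
old-⊑ (rt p) ⊑-root = ⊑-root
old-⊑ (rt p) (⊑-dn q) = ⊑-dn q
old-⊑ (rt p) (⊑-rt q) = ⊑-rt (old-⊑ p q)

oldS-≺ : {v w : Vx A} → v ≺ w → oldS v ≺ oldS w
oldS-≺ here≺dn = here≺dn
oldS-≺ here≺rt = here≺rt
oldS-≺ (≺-dn p) = ≺-dn p
oldS-≺ dn≺rt = dn≺rt
oldS-≺ (≺-rt p) = ≺-rt (oldS-≺ p)

oldS≺newS : (v : Vx A) → oldS v ≺ newS A
oldS≺newS here = here≺rt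
oldS≺newS (dn v) = dn≺rt
oldS≺newS (rt v) = ≺-rt (oldS≺newS v)

old-≺ : (p : Vx A) {v w : Vx A} → v ≺ w → old-in p v ≺ old-in p w
old-≺ here here≺dn = here≺dn
old-≺ here here≺rt = here≺rt
old-≺ here (≺-dn q) = ≺-dn (oldS-≺ q)
old-≺ here dn≺rt = dn≺rt
old-≺ here (≺-rt q) = ≺-rt q
old-≺ (dn p) here≺dn = here≺dn
old-≺ (dn p) here≺rt = here≺rt
old-≺ (dn p) (≺-dn q) = ≺-dn (old-≺ p q)
old-≺ (dn p) dn≺rt = dn≺rt
old-≺ (dn p) (≺-rt q) = ≺-rt q
old-≺ (rt p) here≺dn = here≺dn
old-≺ (rt p) here≺rt = here≺rt
old-≺ (rt p) (≺-dn q) = ≺-dn q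
old-≺ (rt p) dn≺rt = dn≺rt
old-≺ (rt p) (≺-rt q) = ≺-rt (old-≺ p q)

old-top : (p : Vx A) {v : Vx A} → Top v → Top (old-in p v)
old-top here here = here
old-top here (rt t) = rt t
old-top (dn p) here = here
old-top (dn p) (rt t) = rt t
old-top (rt p) here = here
old-top (rt p) (rt t) = rt (old-top p t)

oldS-top : {v : Vx A} → Top v → Top (oldS v)
oldS-top here = here
oldS-top (rt t) = rt (oldS-top t)

newS-top : ∀ A → Top (newS A)
newS-top nil = here
newS-top (cons A B) = rt (newS-top B)

oldS-child : {v w : Vx A} → Child v w → Child (oldS v) (oldS w)
oldS-child (c-here t) = c-here t
oldS-child (c-dn c) = c-dn c
oldS-child (c-rt c) = c-rt (oldS-child c)

old-child : (p : Vx A) {v w : Vx A} → Child v w → Child (old-in p v) (old-in p w)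
old-child here (c-here t) = c-here (oldS-top t)
old-child here (c-dn c) = c-dn (oldS-child c)
old-child here (c-rt c) = c-rt c
old-child (dn p) (c-here t) = c-here (old-top p t)
old-child (dn p) (c-dn c) = c-dn (old-child p c)
old-child (dn p) (c-rt c) = c-rt c
old-child (rt p) (c-here t) = c-here t
old-child (rt p) (c-dn c) = c-dn c
old-child (rt p) (c-rt c) = c-rt (old-child p c)

new-child : (p : Vx A) → Child (old-in p p) (new-in p)
new-child {cons A B} here = c-here (newS-top A)
new-child (dn p) = c-dn (new-child p)
new-child (rt p) = c-rt (new-child p)

sibling≺new : {p v : Vx A} → Child p v → old-in p v ≺ new-in p
sibling≺new (c-here {v = v} t) = ≺-dn (oldS≺newS v)
sibling≺new (c-dn c) = ≺-dn (sibling≺new c)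
sibling≺new (c-rt c) = ≺-rt (sibling≺new c)

topCase : {X : Set} → X → (Fin n → X) → Fin (suc n) → X
topCase {zero} x f zero = x
topCase {suc n} x f zero = f zero
topCase {suc n} x f (suc i) = topCase x (f ∘ suc) i

topCase-fromℕ : ∀ n {X : Set} (x : X) (f : Fin n → X) → topCase x f (fromℕ n) ≡ x
topCase-fromℕ zero x f = refl
topCase-fromℕ (suc n) x f = topCase-fromℕ n x (f ∘ suc)

topCase-inject₁ : {X : Set} (x : X) (f : Fin n → X) (i : Fin n) → topCase x f (inject₁ i) ≡ f i
topCase-inject₁ x f zero = refl
topCase-inject₁ x f (suc i) = topCase-inject₁ x (f ∘ suc) i

-- The root, the parents and the order among siblings determine all orders and meets. The indices
-- need not follow the depth-first order.
record Repr (n : ℕ) (pr : Fin n → Fin (suc n)) (A : Fo) : Set where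
  field
    to : Fin (suc n) → Vx A
    from : Vx A → Fin (suc n)
    to-from : ∀ v → to (from v) ≡ v
    from-to : ∀ i → from (to i) ≡ i
    root⊑ : ∀ v → to zero ⊑ v
    child : ∀ k → Child (to (pr k)) (to (suc k))
    sibs : ∀ k l → toℕ k < toℕ l → pr k ≡ pr l → to (suc k) ≺ to (suc l)

-- The new node has the largest index, so it comes last among its siblings, as `ins` places it.
extend : ∀ {pr} (R : Repr n pr A) (p : Fin (suc n)) (pr′ : Fin (suc n) → Fin (suc (suc n))) →
  (∀ k → pr′ (inject₁ k) ≡ inject₁ (pr k)) → pr′ (fromℕ n) ≡ inject₁ p → Repr (suc n) pr′ (ins A (Repr.to R p))
extend {n} {A} {pr} R p pr′ eo en = record
  { to = to′
  ; from = from′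
  ; to-from = λ w → trans (to-from′ (unold q w)) (reold q w)
  ; from-to = from-to′
  ; root⊑ = λ w → subst (to′ zero ⊑_) (reold q w) (root⊑′ (unold q w))
  ; child = child′
  ; sibs = sibs′
  }
  where
  open Repr R
  q = to p
  to′ : Fin (suc (suc n)) → Vx (ins A q)
  to′ = topCase (new-in q) (old-in q ∘ to)
  from″ : Maybe (Vx A) → Fin (suc (suc n))
  from″ = maybe (inject₁ ∘ from) (fromℕ (suc n))
  from′ : Vx (ins A q) → Fin (suc (suc n))
  from′ w = from″ (unold q w)
  to-new : to′ (fromℕ (suc n)) ≡ new-in q
  to-new = topCase-fromℕ (suc n) (new-in q) (old-in q ∘ to)
  to-old : ∀ i → to′ (inject₁ i) ≡ old-in q (to i)
  to-old = topCase-inject₁ (new-in q) (old-in q ∘ to)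
  to-from′ : ∀ m → to′ (from″ m) ≡ maybe (old-in q) (new-in q) m
  to-from′ (just v) = trans (to-old (from v)) (cong (old-in q) (to-from v))
  to-from′ nothing = to-new
  from-to′ : ∀ i → from′ (to′ i) ≡ i
  from-to′ i with topView i
  ... | ‵fromℕ = cong from″ (trans (cong (unold q) to-new) (unold-new q))
  ... | ‵inject₁ j = trans (cong from″ (trans (cong (unold q) (to-old j)) (unold-old q (to j)))) (cong inject₁ (from-to j))
  root⊑′ : ∀ m → to′ zero ⊑ maybe (old-in q) (new-in q) m
  root⊑′ (just v) = old-⊑ q (root⊑ v)
  root⊑′ nothing = ⊑-trans (old-⊑ q (root⊑ q)) (child-⊑ (new-child q))
  child′ : ∀ k → Child (to′ (pr′ k)) (to′ (suc k))
  child′ k with topView k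
  ... | ‵fromℕ rewrite en | to-old p | to-new = new-child q
  ... | ‵inject₁ j rewrite eo j | to-old (pr j) | to-old (suc j) = old-child q (child j)
  sibs′ : ∀ k l → toℕ k < toℕ l → pr′ k ≡ pr′ l → to′ (suc k) ≺ to′ (suc l)
  sibs′ k l k<l e with topView k | topView l
  ... | ‵fromℕ | _ = ⊥-elim (<⇒≱ k<l (subst (toℕ l ≤_) (sym (toℕ-fromℕ n)) (≤-pred (toℕ<n l))))
  ... | ‵inject₁ i | ‵inject₁ j rewrite to-old (suc i) | to-old (suc j) =
    old-≺ q (sibs i j (subst₂ _<_ (toℕ-inject₁ i) (toℕ-inject₁ j) k<l) (inject₁-injective (trans (sym (eo i)) (trans e (eo j)))))
  ... | ‵inject₁ i | ‵fromℕ rewrite to-old (suc i) | to-new =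
    sibling≺new (subst (λ x → Child (to x) (to (suc i))) (inject₁-injective (trans (sym (eo i)) (trans e en))) (child i))

insRoot : ∀ A → Vx (cons A nil) → Fo
insRoot A here = snoc A
insRoot A (dn p) = ins A p

insRoot-eq : (p : Vx (cons A nil)) → ins (cons A nil) p ≡ cons (insRoot A p) nil
insRoot-eq here = refl
insRoot-eq (dn p) = refl

-- Parents have smaller indices, so the node with the largest index is a leaf, and removing it
-- leaves a tree.
represent : ∀ n (pr : Fin n → Fin (suc n)) → (∀ k → toℕ (pr k) ≤ toℕ k) → Σ Fo λ A → Repr n pr (cons A nil)
represent zero pr _ = nil , record
  { to = λ _ → here ; from = λ _ → zero ; to-from = λ { here → refl } ; from-to = λ { zero → refl }
  ; root⊑ = λ { here → ⊑-here } ; child = λ () ; sibs = λ () }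
represent (suc n) pr pr≤ =
  let A , R = represent n small small≤
  in insRoot A (Repr.to R p) , subst (Repr (suc n) pr) (insRoot-eq (Repr.to R p)) (extend R p pr small-eq p-eq)
  where
  small< : ∀ k → toℕ (pr (inject₁ k)) < suc n
  small< k = s≤s (≤-trans (pr≤ (inject₁ k)) (≤-trans (≤-reflexive (toℕ-inject₁ k)) (<⇒≤ (toℕ<n k))))
  small : Fin n → Fin (suc n)
  small k = fromℕ< (small< k)
  small≤ : ∀ k → toℕ (small k) ≤ toℕ k
  small≤ k = ≤-trans (≤-reflexive (toℕ-fromℕ< (small< k))) (≤-trans (pr≤ (inject₁ k)) (≤-reflexive (toℕ-inject₁ k)))
  small-eq : ∀ k → pr (inject₁ k) ≡ inject₁ (small k)
  small-eq k = toℕ-injective (sym (trans (toℕ-inject₁ (small k)) (toℕ-fromℕ< (small< k))))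
  p< : toℕ (pr (fromℕ n)) < suc n
  p< = s≤s (≤-trans (pr≤ (fromℕ n)) (≤-reflexive (toℕ-fromℕ n)))
  p : Fin (suc n)
  p = fromℕ< p<
  p-eq : pr (fromℕ n) ≡ inject₁ p
  p-eq = toℕ-injective (sym (trans (toℕ-inject₁ p) (toℕ-fromℕ< p<)))

-- From forests back to indexed trees

count : Fo → ℕ
count nil = 0
count (cons A B) = suc (count A + count B)

-- The vertex removed is the last in the depth-first order, hence a leaf and the last of its
-- siblings.
unsnoc : ∀ A → A ≡ nil ⊎ (Σ Fo λ A′ → Σ (Vx (cons A′ nil)) λ p → insRoot A′ p ≡ A × count A ≡ suc (count A′))
unsnoc nil = inj₁ refl
unsnoc (cons A B) with unsnoc B
... | inj₂ (B′ , here , e , c) = inj₂ (cons A B′ , here , cong (cons A) e , cong suc (trans (cong (count A +_) c) (+-suc (count A) (count B′))))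
... | inj₂ (B′ , dn q , e , c) = inj₂ (cons A B′ , dn (rt q) , cong (cons A) e , cong suc (trans (cong (count A +_) c) (+-suc (count A) (count B′))))
... | inj₁ refl with unsnoc A
...   | inj₁ refl = inj₂ (nil , here , refl , refl)
...   | inj₂ (A′ , here , e , c) = inj₂ (cons A′ nil , dn here , cong (λ X → cons X nil) e , cong (λ k → suc (k + 0)) c)
...   | inj₂ (A′ , dn q , e , c) = inj₂ (cons A′ nil , dn (dn q) , cong (λ X → cons X nil) e , cong (λ k → suc (k + 0)) c)

realize′ : ∀ m A → count A ≡ m → Σ (Fin m → Fin (suc m)) λ pr → (∀ k → toℕ (pr k) ≤ toℕ k) × Repr m pr (cons A nil)
realize′ zero nil _ = (λ ()) , (λ ()) , record
  { to = λ _ → here ; from = λ _ → zero ; to-from = λ { here → refl } ; from-to = λ { zero → refl }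
  ; root⊑ = λ { here → ⊑-here } ; child = λ () ; sibs = λ () }
realize′ (suc m) A e with unsnoc A
... | inj₁ refl = ⊥-elim (0≢1+n e)
... | inj₂ (A′ , p , refl , c) with realize′ m A′ (suc-injectiveℕ (trans (sym c) e))
...   | pr , pr≤ , R = pr′ , pr′≤ , subst (Repr (suc m) pr′) eq (extend R i pr′ (topCase-inject₁ _ _) (topCase-fromℕ m _ _))
  where
  i = Repr.from R p
  pr′ : Fin (suc m) → Fin (suc (suc m))
  pr′ = topCase (inject₁ i) (inject₁ ∘ pr)
  eq : ins (cons A′ nil) (Repr.to R i) ≡ cons (insRoot A′ p) nil
  eq = trans (cong (ins (cons A′ nil)) (Repr.to-from R p)) (insRoot-eq p)
  pr′≤ : ∀ k → toℕ (pr′ k) ≤ toℕ k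
  pr′≤ k with topView k
  ... | ‵fromℕ rewrite topCase-fromℕ m (inject₁ i) (inject₁ ∘ pr) | toℕ-inject₁ i | toℕ-fromℕ m = ≤-pred (toℕ<n i)
  ... | ‵inject₁ j rewrite topCase-inject₁ (inject₁ i) (inject₁ ∘ pr) j | toℕ-inject₁ (pr j) | toℕ-inject₁ j = pr≤ j

RootedRepr : Tree → Fo → Set
RootedRepr T A = Repr (size T) (par T) (cons A nil)

toForest : (T : Tree) → Σ Fo (RootedRepr T)
toForest T = represent (size T) (par T) (par< T)

toTree : ∀ A → Σ Tree λ T → RootedRepr T A
toTree A = let pr , pr≤ , R = realize′ (count A) A refl in record { size = count A ; par = pr ; par< = pr≤ } , R

-- Comparison of orders and meets in indexed trees and in forests

module Orders (T : Tree) {A : Fo} (R : RootedRepr T A) where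
  open Repr R public

  to-injective : ∀ {v w} → to v ≡ to w → v ≡ w
  to-injective {v} {w} e = trans (sym (from-to v)) (trans (cong from e) (from-to w))

  to-root : to (root T) ≡ here
  to-root = ⊑-antisym (root⊑ here) (least (to zero))
    where
    least : (v : Vx (cons A nil)) → here ⊑ v
    least here = ⊑-here
    least (dn v) = ⊑-root

  parent-⊑ : ∀ w → to (parent T w) ⊑ to w
  parent-⊑ zero = ⊑-refl
  parent-⊑ (suc k) = child-⊑ (child k)

  ⊑-to : ∀ {v w} → T ∋ v ⊑ w → to v ⊑ to w
  ⊑-to {w = w} (m , refl) = go m
    where
    go : ∀ m → to (iter (parent T) m w) ⊑ to w
    go zero = ⊑-refl
    go (suc m) = ⊑-trans (parent-⊑ (iter (parent T) m w)) (go m)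

  iter-parent : ∀ m w → iter (parent T) m (parent T w) ≡ iter (parent T) (suc m) w
  iter-parent zero w = refl
  iter-parent (suc m) w = cong (parent T) (iter-parent m w)

  ⊑-from : ∀ {v w} → to v ⊑ to w → T ∋ v ⊑ w
  ⊑-from {v} {w} = go (toℕ w) w ≤-refl
    where
    -- The bound `b` on the index serves as the recursion measure: passing to the parent is not a
    -- structural descent.
    go : ∀ b w → toℕ w ≤ b → to v ⊑ to w → T ∋ v ⊑ w
    go b zero _ p = 0 , to-injective (⊑-antisym (root⊑ (to v)) p)
    go (suc b) (suc k) (s≤s k≤b) p with child-below (child k) p
    ... | inj₁ e = 0 , to-injective (sym e)
    ... | inj₂ q with go b (par T k) (≤-trans (par< T k) k≤b) q
    ...   | m , e = suc m , trans (sym (iter-parent m (suc k))) e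

  meet-from : ∀ {x y z} → meet (to x) (to y) ≡ just (to z) → IsMeet T x y z
  meet-from {x} {y} {z} e = ⊑-from (meet-⊑ˡ (to x) (to y) e) , ⊑-from (meet-⊑ʳ (to x) (to y) e) , λ u p q →
    let z′ , e′ , r = meet-greatest (⊑-to p) (⊑-to q)
    in ⊑-from (subst (to u ⊑_) (just-injective (trans (sym e′) e)) r)

  meet-to : ∀ {x y z} → IsMeet T x y z → meet (to x) (to y) ≡ just (to z)
  meet-to {x} {y} {z} (p , q , g) with meet-greatest (⊑-to p) (⊑-to q)
  ... | z′ , e , r = trans e (cong just (⊑-antisym
    (subst (_⊑ to z) (to-from z′) (⊑-to (g (from z′) (below (meet-⊑ˡ (to x) (to y) e)) (below (meet-⊑ʳ (to x) (to y) e))))) r))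
    where
    below : ∀ {w} → z′ ⊑ to w → T ∋ from z′ ⊑ w
    below {w} h = ⊑-from (subst (_⊑ to w) (sym (to-from z′)) h)

  ≤-to : ∀ {v w} → T ∋ v ≤T w → to v ⪯ to w
  ≤-to (inj₁ p) = ⊑⇒≡⊎≺ (⊑-to p)
  ≤-to (inj₂ (_ , z , _ , .(suc k) , .(suc l) , (k , refl , refl) , (l , refl , e) , p , q , s≤s k<l)) =
    inj₂ (siblings-≺ (child k) (subst (λ x → Child (to x) (to (suc l))) e (child l)) (sibs k l k<l (sym e)) (⊑-to p) (⊑-to q))

  immSucc : ∀ {z c} → Child z c → ImmSucc T (from z) (from c)
  immSucc {z} {c} h with from c in e
  ... | zero = ⊥-elim (⊑⇒⋡ (subst (_⊑ z) (trans (cong to (sym e)) (to-from c)) (root⊑ z)) (child-≺ h))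
  ... | suc k = k , refl , to-injective (trans (child-unique (child k) (subst (Child z) (trans (sym (to-from c)) (cong to e)) h)) (sym (to-from z)))

  ≤-from : ∀ {v w} → to v ⪯ to w → T ∋ v ≤T w
  ≤-from {v} {w} p with to v ⊑? to w
  ... | yes q = inj₁ (⊑-from q)
  ... | no v⋢w = inj₂ (w⋢v ∘ ⊑-to , from z , meet-from (trans ez (cong just (sym (to-from z))))
      , from a , from b , immSucc za , immSucc zb
      , ⊑-from (subst (_⊑ to v) (sym (to-from a)) av) , ⊑-from (subst (_⊑ to w) (sym (to-from b)) bw) , a<b)
    where
    w⋢v : ¬ (to w ⊑ to v)
    w⋢v q = exclude p
      where
      exclude : ¬ (to v ⪯ to w)
      exclude (inj₁ e) = v⋢w (⊑-reflexive e)
      exclude (inj₂ r) = ⊑⇒⋡ q r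
    mz = meet-just one (to v) (to w)
    z = proj₁ mz
    ez = proj₂ mz
    zv = meet-⊑ˡ (to v) (to w) ez
    zw = meet-⊑ʳ (to v) (to w) ez
    ca = child-toward zv λ e → v⋢w (subst (_⊑ to w) e zw)
    a = proj₁ ca
    za = proj₁ (proj₂ ca)
    av = proj₂ (proj₂ ca)
    cb = child-toward zw λ e → w⋢v (subst (_⊑ to v) e zv)
    b = proj₁ cb
    zb = proj₁ (proj₂ cb)
    bw = proj₂ (proj₂ cb)
    a≢b : a ≢ b
    a≢b e with meet-greatest av (subst (_⊑ to w) (sym e) bw)
    ... | z′ , e′ , r with trans (sym ez) e′
    ...   | refl = ⊑⇒⋡ r (child-≺ za)
    a<b : toℕ (from a) < toℕ (from b)
    a<b with <-cmp (toℕ (from a)) (toℕ (from b))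
    ... | tri< r _ _ = r
    ... | tri≈ _ e _ = ⊥-elim (a≢b (trans (sym (to-from a)) (trans (cong to (toℕ-injective e)) (to-from b))))
    ... | tri> _ _ r = ⊥-elim (contra p)
      where
      w≺v : to w ≺ to v
      w≺v with immSucc za | immSucc zb
      ... | k , ek , ek′ | l , el , el′ = siblings-≺ zb za
        (subst₂ _≺_ (trans (cong to (sym el)) (to-from b)) (trans (cong to (sym ek)) (to-from a))
          (sibs l k (≤-pred (subst₂ _<_ (cong toℕ el) (cong toℕ ek) r)) (trans el′ (sym ek′)))) bw av
      contra : ¬ (to v ⪯ to w)
      contra q = ⪯-≺-contra q w≺v

  <-to : ∀ {v w} → T ∋ v <T w → to v ≺ to w
  <-to (p , ne) with ≤-to p
  ... | inj₁ e = ⊥-elim (ne (to-injective e))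
  ... | inj₂ q = q

  <-from : ∀ {v w} → to v ≺ to w → T ∋ v <T w
  <-from q = ≤-from (inj₂ q) , λ { refl → ≺-irrefl q }

-- Colourings of connections

rigid-root : {f : Vx (cons A nil) → Vx (cons S nil)} {g : Vx (cons S nil) → Vx (cons A nil)} →
  IsRigid {n = 0} (inj₂ ∘ f) g → g here ≡ here
rigid-root {f = f} {g} R = ⊑-antisym (⊑-trans (R.mono-⊑ (least (f here))) (R.least here refl)) (least (g here))
  where
  module R = IsRigid R
  least : (v : Vx (cons B nil)) → here ⊑ v
  least here = ⊑-here
  least (dn v) = ⊑-root

two-children : (x : Vx S) → ¬ AtMost1 (above x) → ∃ λ c → ∃ λ d → meet c d ≡ just x × ¬ (c ⊑ d) × ¬ (d ⊑ c)
two-children {cons nil B} here n = ⊥-elim (n none)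
two-children {cons (cons A nil) B} here n = ⊥-elim (n one)
two-children {cons (cons A (cons _ _)) B} here n = dn here , dn (rt here) , refl , (λ { (⊑-dn ()) }) , λ { (⊑-dn ()) }
two-children (dn x) n with two-children x n
... | c , d , e , p , q = dn c , dn d , cong (just ∘ maybe dn here) e , (λ { (⊑-dn r) → p r }) , λ { (⊑-dn r) → q r }
two-children (rt x) n with two-children x n
... | c , d , e , p , q = rt c , rt d , cong (Maybe.map rt) e , (λ { (⊑-rt r) → p r }) , λ { (⊑-rt r) → q r }

meet-children : {z a b : Vx A} → Child z a → Child z b → a ≢ b → meet a b ≡ just z
meet-children {a = a} {b} ca cb ne with meet-greatest (child-⊑ ca) (child-⊑ cb)
... | z′ , e , p with child-below ca (meet-⊑ˡ a b e)
...   | inj₁ refl = ⊥-elim (siblings-⋢ ca cb ne (meet-⊑ʳ a b e))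
...   | inj₂ q = trans e (cong just (⊑-antisym q p))

-- Translation between connections of trees and of forests

module Translate (S T : Tree) {A B : Fo} (RS : RootedRepr S A) (RT : RootedRepr T B) where
  private
    module S = Orders S RS
    module T = Orders T RT

  emb-to : ∀ {i} → IsEmbedding S T i → IsEmb (T.to ∘ i ∘ S.from)
  emb-to {i} (_ , i-mono , i-meet) = record { meets = meets ; mono = λ {x} {y} p →
      T.<-to (i-mono _ _ (S.<-from (subst₂ _≺_ (sym (S.to-from x)) (sym (S.to-from y)) p))) }
    where
    meets : ∀ x y → meet (T.to (i (S.from x))) (T.to (i (S.from y))) ≡ Maybe.map (T.to ∘ i ∘ S.from) (meet x y)
    meets x y with meet-just one x y
    ... | z , e = trans (T.meet-to (i-meet _ _ _ (S.meet-from
        (trans (cong₂ meet (S.to-from x) (S.to-from y)) (trans e (cong just (sym (S.to-from z))))))))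
      (cong (Maybe.map (T.to ∘ i ∘ S.from)) (sym e))

  emb-from : ∀ {g} → IsEmb g → g here ≡ here → IsEmbedding S T (T.from ∘ g ∘ S.to)
  emb-from {g} G e =
      trans (cong (T.from ∘ g) S.to-root) (trans (cong T.from (trans e (sym T.to-root))) (T.from-to (root T)))
    , (λ x y p → T.<-from (subst₂ _≺_ (sym (T.to-from _)) (sym (T.to-from _)) (G.mono (S.<-to p))))
    , λ x y z m → T.meet-from (trans (cong₂ meet (T.to-from _) (T.to-from _)) (trans (G.meets _ _)
        (trans (cong (Maybe.map g) (S.meet-to m)) (cong just (sym (T.to-from _))))))
    where module G = IsEmb G

  conn-from : ∀ {f g h} → IsConn f g h → h here ≡ here → Hom S T
  conn-from {f} {g} {h} C e = conn (S.from ∘ f ∘ T.to) (T.from ∘ h ∘ S.to)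
    ( (T.from ∘ g ∘ S.to , emb-from C.G.emb (rigid-root C.rigid-g) , fix {g} C.section-g
      , λ y → T.⊑-from (subst (_⊑ T.to y) (sym (trans (T.to-from _) (cong g (S.to-from _)))) (C.G.least (T.to y) refl)))
    , emb-from C.emb-h e , fix {h} C.section-h
    , λ x y p → S.≤-from (subst (_⪯ S.to x) (sym (S.to-from _)) (C.before (S.to x) (T.to y) (subst (T.to y ≺_) (T.to-from _) (T.<-to p)))))
    where
    module C = IsConn C
    fix : ∀ {k : Vx (cons A nil) → Vx (cons B nil)} → (∀ x → f (k x) ≡ x) → ∀ x → S.from (f (T.to (T.from (k (S.to x))))) ≡ x
    fix {k} h x = trans (cong (S.from ∘ f) (T.to-from (k (S.to x)))) (trans (cong S.from (h (S.to x))) (S.from-to x))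

  module _ (c : Hom S T) where
    least-emb : Node S → Node T
    least-emb = proj₁ (proj₁ (isConn c))

    conn-to : IsConn (S.to ∘ sm c ∘ T.from) (T.to ∘ least-emb ∘ S.from) (T.to ∘ im c ∘ S.from)
    conn-to with isConn c
    ... | (i , i-emb , si , is) , h-emb , sh , before = record
      { rigid-g = record
        { emb = emb-to i-emb
        ; section = λ x → cong inj₂ (fix si x)
        ; least = λ { y refl → subst₂ _⊑_ (cong (T.to ∘ i) (sym (S.from-to _))) (T.to-from y) (T.⊑-to (is (T.from y))) } }
      ; emb-h = emb-to h-emb
      ; section-h = fix sh
      ; before = λ x y p → subst (_ ⪯_) (S.to-from x) (S.≤-to (before (S.from x) (T.from y) (T.<-from (subst (_≺ _) (sym (T.to-from y)) p)))) }
      where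
      fix : ∀ {k : Node S → Node T} → (∀ x → sm c (k x) ≡ x) → ∀ x → S.to (sm c (T.from (T.to (k (S.from x))))) ≡ x
      fix h x = trans (cong (S.to ∘ sm c) (T.from-to _)) (trans (cong S.to (h (S.from x))) (S.to-from x))

    private module C = IsConn conn-to

    least-emb-⊑ : ∀ {x y} → sm c y ≡ x → T ∋ least-emb x ⊑ y
    least-emb-⊑ refl = proj₂ (proj₂ (proj₂ (proj₁ (isConn c)))) _

    -- `least-emb x` belongs to the fibre over `x` and lies below all of it, so it is the meet of
    -- the fibre. Membership in B thus compares two nodes and is decidable.
    isMeet⇒≡ : ∀ x → IsMeetOf T (λ y → sm c y ≡ x) (im c x) → least-emb x ≡ im c x
    isMeet⇒≡ x (lower , greatest) = T.to-injective (⊑-antisym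
      (T.⊑-to (greatest (least-emb x) λ y → least-emb-⊑))
      (T.⊑-to (lower (least-emb x) (proj₁ (proj₂ (proj₂ (proj₁ (isConn c)))) x))))

    ≡⇒isMeet : ∀ x → least-emb x ≡ im c x → IsMeetOf T (λ y → sm c y ≡ x) (im c x)
    ≡⇒isMeet x e = subst (IsMeetOf T (λ y → sm c y ≡ x)) e
      ((λ y → least-emb-⊑) , λ u lower → lower _ (proj₁ (proj₂ (proj₂ (proj₁ (isConn c)))) x))

    inB⇒≢ : ∀ x → InB c x → least-emb x ≢ im c x
    inB⇒≢ x b e = b (≡⇒isMeet x e)

    inB? : ∀ x → Dec (InB c x)
    inB? x with least-emb x ≟F im c x
    ... | yes e = no λ b → inB⇒≢ x b e
    ... | no ne = yes (ne ∘ isMeet⇒≡ x)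

    ¬inB⇒≡ : ∀ x → ¬ InB c x → least-emb x ≡ im c x
    ¬inB⇒≡ x nb with least-emb x ≟F im c x
    ... | yes e = e
    ... | no ne = ⊥-elim (nb (ne ∘ isMeet⇒≡ x))

    inB⇒atMost1 : ∀ x → InB c (S.from x) → AtMost1 (above x)
    inB⇒atMost1 x b with atMost1? (above x)
    ... | yes a = a
    ... | no na with two-children x na
    ...   | _ , _ , e , p , q = ⊥-elim (inB⇒≢ (S.from x) b (T.to-injective (C.branching e p q)))

    -- This is the inclusion of B in A. Both embeddings preserve the root, and two immediate
    -- successors of `x` would be incomparable with meet `x`, so that `branching` applies.
    inB⇒isA : ∀ x → InB c x → IsA S x
    inB⇒isA x b = notRoot , fewChildren
      where
      notRoot : x ≢ root S
      notRoot refl = inB⇒≢ x b (trans (proj₁ (proj₁ (proj₂ (proj₁ (isConn c))))) (sym (proj₁ (proj₁ (proj₂ (isConn c))))))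
      branch-contra : ∀ {k l} → k ≢ l → par S k ≡ x → par S l ≡ x → ⊥
      branch-contra {k} {l} ne ek el = inB⇒≢ x b (subst (λ v → least-emb v ≡ im c v) (S.from-to x) (T.to-injective
        (C.branching (meet-children ck cl (λ e → ne′ e)) (siblings-⋢ ck cl ne′) (siblings-⋢ cl ck (ne′ ∘ sym)))))
        where
        ck : Child (S.to x) (S.to (suc k))
        ck = subst (λ v → Child (S.to v) (S.to (suc k))) ek (S.child k)
        cl : Child (S.to x) (S.to (suc l))
        cl = subst (λ v → Child (S.to v) (S.to (suc l))) el (S.child l)
        ne′ : S.to (suc k) ≢ S.to (suc l)
        ne′ e = ne (suc-injective (S.to-injective e))
      fewChildren : childCount S x ≤ 1
      fewChildren with List.filter (λ k → par S k ≟F x) (List.allFin (size S))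
        | all-filter (λ k → par S k ≟F x) (List.allFin (size S))
        | Unique.filter⁺ (λ k → par S k ≟F x) (Unique.allFin⁺ (size S))
      ... | [] | _ | _ = z≤n
      ... | _ ∷ [] | _ | _ = s≤s z≤n
      ... | k ∷ l ∷ _ | ek ∷ el ∷ _ | (ne ∷ _) ∷ _ = ⊥-elim (branch-contra ne ek el)

-- The indices are treated one by one; constancy achieved for one target survives restriction along
-- a further surjection.
ramsey-list : {I : Set} (S : I → Fo) (is : List I) (n : ℕ) (T : Fo) (r : ℕ) → Σ Fo λ V →
  (χ : ∀ i → F (suc n) V (S i) → Fin r) → Σ (F (suc n) V T) λ t →
  ∀ {i} → i ∈ is → (x y : F (suc n) T (S i)) → χ i (t ∙ x) ≡ χ i (t ∙ y)
ramsey-list S [] n T r = T , λ χ → idF , λ ()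
ramsey-list S (i ∷ is) n T r = proj₁ (ramsey (S i) n (proj₁ rest) r) , λ χ →
  let t , e = proj₂ (ramsey (S i) n (proj₁ rest) r) (χ i)
      s , e′ = proj₂ rest λ j x → χ j (t ∙ x)
  in t ∙ s , λ
    { (here refl) x y → trans (cong (χ i) (∙-assoc t s x)) (trans (e _ _ tt) (cong (χ i) (sym (∙-assoc t s y))))
    ; (there m) x y → trans (cong (χ _) (∙-assoc t s x)) (trans (e′ m x y) (cong (χ _) (sym (∙-assoc t s y)))) }
  where rest = ramsey-list S is n T r

-- Subsets are kept as lists in the order of the given list, so that equal subsets of A are equal
-- lists.
sublists : {X : Set} → List X → List (List X)
sublists [] = [] ∷ []
sublists (x ∷ xs) = List.map (x ∷_) (sublists xs) List.++ sublists xs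

length-sublists : {X : Set} (xs : List X) → length (sublists xs) ≡ 2 ^ length xs
length-sublists [] = refl
length-sublists (x ∷ xs) = begin
  length (List.map (x ∷_) (sublists xs) List.++ sublists xs)      ≡⟨ length-++ (List.map (x ∷_) (sublists xs)) ⟩
  length (List.map (x ∷_) (sublists xs)) + length (sublists xs)   ≡⟨ cong₂ _+_ (trans (length-map (x ∷_) (sublists xs)) (length-sublists xs)) (length-sublists xs) ⟩
  2 ^ length xs + 2 ^ length xs                                   ≡⟨ cong (2 ^ length xs +_) (+-identityʳ (2 ^ length xs)) ⟨
  2 ^ length (x ∷ xs)                                             ∎
  where open ≡-Reasoning

filter∈sublists : {X : Set} {P : X → Set} (P? : ∀ x → Dec (P x)) (xs : List X) → List.filter P? xs ∈ sublists xs
filter∈sublists P? [] = here refl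
filter∈sublists P? (x ∷ xs) with P? x
... | yes _ = ∈-++⁺ˡ (∈-map⁺ (x ∷_) (filter∈sublists P? xs))
... | no _ = ∈-++⁺ʳ (List.map (x ∷_) (sublists xs)) (filter∈sublists P? xs)

filter-cong : {X : Set} {A P Q : X → Set} (P? : ∀ x → Dec (P x)) (Q? : ∀ x → Dec (Q x)) →
  (∀ x → A x → (P x → Q x) × (Q x → P x)) → ∀ {xs} → All A xs → List.filter P? xs ≡ List.filter Q? xs
filter-cong P? Q? h [] = refl
filter-cong P? Q? h {x ∷ _} (a ∷ as) with P? x | Q? x
... | yes _ | yes _ = cong (x ∷_) (filter-cong P? Q? h as)
... | no _ | no _ = filter-cong P? Q? h as
... | yes p | no nq = ⊥-elim (nq (proj₁ (h x a) p))
... | no np | yes q = ⊥-elim (np (proj₂ (h x a) q))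

rigid-before : {f : Vx T → Vx S} {g : Vx S → Vx T} → IsRigid {n = 0} (inj₂ ∘ f) g → ∀ x y → y ≺ g x → f y ⪯ x
rigid-before {f = f} R x y p with ≺-total (f y) x
... | inj₁ e = inj₁ e
... | inj₂ (inj₁ q) = inj₂ q
... | inj₂ (inj₂ q) = ⊥-elim (⊑⇒⋡ (IsRigid.least R y refl) (≺-trans p (IsRigid.mono R q)))

rigid-target : (t : F 0 T S) → IsRigid {n = 0} (inj₂ ∘ target ∘ fF t) (gF t)
rigid-target t = record { emb = R.emb ; section = λ x → trans (inj₂-target _) (R.section x)
                        ; least = λ y e → R.least y (trans (sym (inj₂-target _)) e) }
  where module R = IsRigid (rigid t)

-- A rigid surjection with its least section in both roles: a connection with empty B.
rigid-conn : {f : Vx T → Vx S} {g : Vx S → Vx T} → IsRigid {n = 0} (inj₂ ∘ f) g → IsConn f g g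
rigid-conn R = record
  { rigid-g = R ; emb-h = IsRigid.emb R ; section-h = λ x → inj₂-injective (IsRigid.section R x) ; before = rigid-before R }

-- The common value of a constant function, and zero if its domain is empty.
someValue : {X : Set} → Finite X → (X → Fin (suc r)) → Fin (suc r)
someValue fin χ with Finite.search fin (λ _ → yes tt)
... | yes (x , _) = χ x
... | no _ = zero

≡-someValue : {X : Set} (fin : Finite X) (χ : X → Fin (suc r)) → (∀ x y → χ x ≡ χ y) → ∀ x → χ x ≡ someValue fin χ
≡-someValue fin χ const x with Finite.search fin (λ _ → yes tt)
... | yes (y , _) = const x y
... | no empty = ⊥-elim (empty (x , tt))

candidates : (S : Tree) → List (Node S)
candidates S = List.filter (isA? S) (List.allFin (suc (size S)))

module _ (S : Tree) {A₀ : Fo} (RS : RootedRepr S A₀) where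
  open DecMembership (_≟F_ {suc (size S)}) using (_∈?_)

  inL : List (Node S) → Vx A₀ → Bool
  inL L v = ⌊ Repr.from RS (dn v) ∈? L ⌋

  -- The root stays unmarked because both embeddings send it to the root; so the doubled forest is
  -- again a single tree, with `doubled L` above its root.
  marks : List (Node S) → Marks (cons A₀ nil)
  marks L = off (mark (inL L)) nil

  doubled : List (Node S) → Fo
  doubled L = double (mark (inL L))

module _ (S T V : Tree) {A₀ B₀ C₀ : Fo} (RS : RootedRepr S A₀) (RT : RootedRepr T B₀) (RV : RootedRepr V C₀) where
  private
    module ST = Translate S T RS RT
    module SV = Translate S V RS RV
    module TV = Translate T V RT RV
    module S = Orders S RS
    module T = Orders T RT
    module V = Orders V RV

  open DecMembership (_≟F_ {suc (size S)}) using (_∈?_)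

  root-hit : ∀ {A S} (t : F 0 (cons A nil) (cons S nil)) → gF t here ≡ here
  root-hit t = rigid-root (rigid-target t)

  encode : ∀ L → F 0 (cons C₀ nil) (cons (doubled S RS L) nil) → Hom S V
  encode L t = SV.conn-from (encode-conn (marks S RS L) t) (root-hit t)

  base : F 1 C₀ B₀ → Hom T V
  base t = TV.conn-from (rigid-conn (rigid-target (hit t done))) refl

  module _ (c : Hom S T) where
    L = List.filter (ST.inB? c) (candidates S)

    inL⇒inB : ∀ v → inL S RS L v ≡ true → InB c (S.from (dn v))
    inL⇒inB v e with S.from (dn v) ∈? L | e
    ... | no _ | ()
    ... | yes m | _ = proj₂ (∈-filter⁻ (ST.inB? c) {xs = candidates S} m)

    ¬inL⇒¬inB : ∀ v → inL S RS L v ≡ false → ¬ InB c (S.from (dn v))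
    ¬inL⇒¬inB v e b with S.from (dn v) ∈? L | e
    ... | yes _ | ()
    ... | no nm | _ = nm (∈-filter⁺ (ST.inB? c) (∈-filter⁺ (isA? S) (∈-allFin _) (ST.inB⇒isA c _ b)) b)

    marked-inL : ∀ v → marked (mark (inL S RS L)) v ≡ inL S RS L v
    marked-inL = marked-mark (inL S RS L) λ v e → ST.inB⇒atMost1 c (dn v) (inL⇒inB v e)

    on≢ : ∀ x → marked (marks S RS L) x ≡ true → T.to (ST.least-emb c (S.from x)) ≢ T.to (im c (S.from x))
    on≢ (dn v) e h = ST.inB⇒≢ c _ (inL⇒inB v (trans (sym (marked-inL v)) e)) (T.to-injective h)

    off≡ : ∀ x → marked (marks S RS L) x ≡ false → T.to (ST.least-emb c (S.from x)) ≡ T.to (im c (S.from x))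
    off≡ here _ = cong T.to (ST.¬inB⇒≡ c _ λ b → proj₁ (ST.inB⇒isA c _ b) (S.to-injective (trans (S.to-from here) (sym S.to-root))))
    off≡ (dn v) e = cong T.to (ST.¬inB⇒≡ c _ (¬inL⇒¬inB v (trans (sym (marked-inL v)) e)))

    decoded : Σ (F 0 (cons B₀ nil) (cons (doubled S RS L) nil)) λ t →
      (∀ y → π (marks S RS L) (target (fF t y)) ≡ S.to (sm c (T.from y))) × (∀ x → gF t (ι (marks S RS L) x) ≡ T.to (ST.least-emb c (S.from x))) ×
      (∀ x → gF t (ι′ (marks S RS L) x) ≡ T.to (im c (S.from x)))
    decoded = decode-conn (ST.conn-to c) (marks S RS L) on≢ off≡

    -- Since `base s` uses one embedding in both roles, composing with it commutes with encoding.
    -- The two connections agree as maps, while their proof components may differ; hence `≈H`.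
    encode-decoded : ∀ (s : F 1 C₀ B₀) (d : Hom S V) → IsComp (base s) c d → encode L (hit s done ∙ proj₁ decoded) ≈H d
    encode-decoded s d (ds , di) = sm-eq , im-eq
      where
      open ≡-Reasoning
      t = proj₁ decoded
      sm-eq : ∀ y → S.from (π (marks S RS L) (target (fF (hit s done ∙ t) (V.to y)))) ≡ sm d y
      sm-eq y = begin
        S.from (π (marks S RS L) (target (fF (hit s done ∙ t) (V.to y))))
          ≡⟨ cong (S.from ∘ π (marks S RS L) ∘ target) (fF-comp idS (hit s done) t (V.to y)) ⟨
        S.from (π (marks S RS L) (target (rename idS (fF t) (fF (hit s done) (V.to y)))))
          ≡⟨ cong (λ l → S.from (π (marks S RS L) (target (rename idS (fF t) l)))) (inj₂-target (fF (hit s done) (V.to y))) ⟨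
        S.from (π (marks S RS L) (target (fF t (target (fF (hit s done) (V.to y))))))
          ≡⟨ cong S.from (proj₁ (proj₂ decoded) _) ⟩
        S.from (S.to (sm c (sm (base s) y)))
          ≡⟨ S.from-to _ ⟩
        sm c (sm (base s) y)
          ≡⟨ ds y ⟨
        sm d y ∎
      im-eq : ∀ x → V.from (gF (hit s done ∙ t) (ι′ (marks S RS L) (S.to x))) ≡ im d x
      im-eq x = begin
        V.from (gF (hit s done ∙ t) (ι′ (marks S RS L) (S.to x)))
          ≡⟨ cong V.from (gF-comp idS (hit s done) t _) ⟩
        V.from (gF (hit s done) (gF t (ι′ (marks S RS L) (S.to x))))
          ≡⟨ cong (V.from ∘ gF (hit s done)) (proj₂ (proj₂ (proj₂ decoded)) (S.to x)) ⟩
        V.from (gF (hit s done) (T.to (im c (S.from (S.to x)))))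
          ≡⟨ cong (λ v → V.from (gF (hit s done) (T.to (im c v)))) (S.from-to x) ⟩
        im (base s) (im c x)
          ≡⟨ di x ⟨
        im d x ∎

  colouring : (r : ℕ) (s : F 1 C₀ B₀) (χ : Hom S V → Fin (suc r)) → RespectsH χ →
    (∀ {L} → L ∈ sublists (candidates S) → (x y : F 1 B₀ (doubled S RS L)) → χ (encode L (hit (s ∙ x) done)) ≡ χ (encode L (hit (s ∙ y) done))) →
    Σ (List (Node S) → Fin (suc r)) λ col →
    ∀ (c : Hom S T) (d : Hom S V) → IsComp (base s) c d → χ d ≡ col (List.filter (ST.inB? c) (candidates S))
  colouring r s χ resp ram = col , λ c d comp′ → correct c d (decoded c) (encode-decoded c s d comp′)
    where
    χ′ : ∀ L → F 1 C₀ (doubled S RS L) → Fin (suc r)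
    χ′ L t = χ (encode L (hit t done))
    col : List (Node S) → Fin (suc r)
    col L = someValue (finite-F 1 B₀ (doubled S RS L)) λ t → χ′ L (s ∙ t)
    correct : ∀ c d → (D : Σ (F 0 (cons B₀ nil) (cons (doubled S RS (L c)) nil)) _) → encode (L c) (hit s done ∙ proj₁ D) ≈H d →
      χ d ≡ col (L c)
    -- Without letters the root can only be hit, so the surjection is given by its part `t` above
    -- the root, which has one letter.
    correct c d (hit t done , _) e = trans (sym (resp _ d e)) (≡-someValue (finite-F 1 B₀ (doubled S RS (L c))) _ (ram (filter∈sublists (ST.inB? c) (candidates S))) t)

abstract
  -- The colour is returned as a function of the list representing B. Equal sets B give equal lists,
  -- and there are at most `2 ^ cardA S` lists, which yields both halves of the theorem.
  connection-types : (S T : Tree) (r : ℕ) →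
    Σ (∀ (c : Hom S T) x → Dec (InB c x)) λ inB? → Σ Tree λ V → (χ : Hom S V → Fin (suc r)) → RespectsH χ →
    Σ (Hom T V) λ tj → Σ (List (Node S) → Fin (suc r)) λ col →
    ∀ (c : Hom S T) (d : Hom S V) → IsComp tj c d → χ d ≡ col (List.filter (inB? c) (candidates S))
  connection-types S T r =
    let A , RS = toForest S
        B , RT = toForest T
        C , ram = ramsey-list (doubled S RS) (sublists (candidates S)) 0 B (suc r)
        V , RV = toTree C
    in Translate.inB? S T RS RT , V , λ χ resp →
      let s , e = ram λ L t → χ (encode S T V RS RT RV L (hit t done))
      in base S T V RS RT RV s , colouring S T V RS RT RV r s χ resp e

theorem3p4 : (S : Tree) →
    ((T : Tree) (r : ℕ) → 0 < r →
    Σ Tree (λ V → (χ : Hom S V → Fin r) → RespectsH χ →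
    Σ (Hom T V) (λ tj → (c c' : Hom S T) (d d' : Hom S V) →
    IsComp tj c d → IsComp tj c' d' → SameB c c' → χ d ≡ χ d')))
    ×
    ((B : Tree) (r : ℕ) → 0 < r →
    Σ Tree (λ C → (χ : Hom S C → Fin r) → RespectsH χ →
    Σ (Hom B C) (λ f → Σ (List (Fin r)) (λ L →
    (length L ≤ 2 ^ cardA S) ×
    ((c : Hom S B) (d : Hom S C) → IsComp f c d → χ d ∈ L)))))
theorem3p4 S =
    (λ { T (suc r) _ → let inB? , V , colouring = connection-types S T r in V , λ χ resp →
      let tj , col , h = colouring χ resp
      in tj , λ c c' d d' e e' same → trans (h c d e) (trans
           (cong col (filter-cong {A = IsA S} {InB c} {InB c'} (inB? c) (inB? c') same
             (all-filter (isA? S) (List.allFin (suc (size S))))))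
           (sym (h c' d' e'))) })
  , (λ { B (suc r) _ → let inB? , V , colouring = connection-types S B r in V , λ χ resp →
      let tj , col , h = colouring χ resp
      in tj , List.map col (sublists (candidates S))
        , ≤-reflexive (trans (length-map col (sublists (candidates S))) (length-sublists (candidates S)))
        , λ c d e → subst (_∈ List.map col (sublists (candidates S))) (sym (h c d e))
            (∈-map⁺ col (filter∈sublists (inB? c) (candidates S))) })
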